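{- For any $n\ge1$ and $k\in[n]$, the four sets $\mathscr{T}_{n,k},\mathscr{U}_{n,k},\mathscr{V}_{n,k},\mathscr{W}_{n,k}$ are in bijection with one another. Consequently the number of $k$-dimensional faces of the Shi arrangement in $\mathbb{R}^n$ equals $|\mathscr{T}_{n,k}|=|\mathscr{U}_{n,k}|=|\mathscr{V}_{n,k}|=|\mathscr{W}_{n,k}|$.
   Context: $[n]=\{1,\dots,n\}$. The Shi arrangement in $\mathbb{R}^n$ consists of the hyperplanes $x_i-x_j=0$ and $x_i-x_j=1$, $1\le i<j\le n$; a face is a nonempty solution set of a system choosing for each hyperplane one of $<,=,>$, and its dimension is that of its affine span. A binary tree is a rooted plane tree in which every vertex has 0 or 2 children (left child and right child); childless vertices are leaves, others nodes; an internal edge joins two nodes. An $[n]$-decorated binary tree is a binary tree whose nodes are labeled by nonempty subsets of $[n]$ forming a set partition of $[n]$, with each right internal edge declared solid or dashed (others solid); a captive node is a node joined to its parent by a dashed edge, a free node one that is not captive. An internal edge is a descent if $\max A>\min B$ where $A$ is the parent's label and $B$ the child's label. $\mathscr{T}_{n,k}$: $[n]$-decorated binary trees in which all right internal edges are descents, with exactly $k$ free nodes. $\mathscr{U}_{n,k}$: binary trees with $n$ nodes, the nodes labeled bijectively by $[n]$, such that all right internal edges are descents, together with a set of $n-k$ marked nodes each of which has a left child that is not a leaf. $\mathscr{V}_{n,k}$: trees on the vertex set $[n+1]$ (Cayley trees) together with a set of $n-k$ marked internal vertices (vertices of degree at least two) among those labeled $1,\dots,n$. $\mathscr{W}_{n,k}$: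 pairs $(f,S)$ with $f:[n-1]\to[n+1]$ a function and $S\subset \mathrm{Im}(f)\cap[n]$ with $|S|=n-k$.
   Formalization: The faces of the Shi arrangement and their dimensions are taken in rational n-space instead of real n-space; since the hyperplanes are rational, the faces and dimensions correspond. -}

module Defs where

open import Data.Nat as ℕ using (ℕ; zero; suc; _∸_)
open import Data.Bool using (Bool; true; false; if_then_else_; not)
open import Data.Fin using (Fin; zero; suc; inject₁)
open import Data.Fin.Subset using (Subset; _∈_; Nonempty; ∣_∣)
open import Data.Vec using (Vec; lookup)
open import Data.List using (List; []; _∷_; _++_; length)
open import Data.List.Relation.Unary.All using (All)
import Data.List.Membership.Propositional
import Data.Fin
open import Data.List.Relation.Unary.Unique.Propositional using (Unique)
open import Data.Rational as ℚ using (ℚ; 0ℚ; 1ℚ)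
open import Data.Product using (Σ; ∃; ∃-syntax; _×_; _,_; proj₁)
open import Data.Unit using (⊤)
open import Data.Empty using (⊥)
open import Relation.Nullary using (¬_)
open import Relation.Binary using (Setoid)
open import Relation.Binary.PropositionalEquality as P using (_≡_)
open import Function.Bundles using (Inverse)

SubSetoid : (A : Set) → (A → Set) → Setoid _ _
SubSetoid A P = record
  { Carrier = Σ A P
  ; _≈_ = λ x y → proj₁ x ≡ proj₁ y
  ; isEquivalence = record
      { refl = P.refl ; sym = P.sym ; trans = P.trans } }

_≅_ : ∀ {a b l m} → Setoid a l → Setoid b m → Set _
X ≅ Y = Inverse X Y

-- Descents.  max A > min B  iff  some a ∈ A exceeds some b ∈ B.

Descent : ∀ {n} → Subset n → Subset n → Set
Descent A B = ∃[ a ] ∃[ b ] (a ∈ A × b ∈ B × b Data.Fin.< a)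

countIn : ∀ {n} → Fin n → List (Subset n) → ℕ
countIn i [] = 0
countIn i (A ∷ As) = (if lookup A i then 1 else 0) ℕ.+ countIn i As

IsSetPartition : ∀ {n} → List (Subset n) → Set
IsSetPartition {n} Ls = All Nonempty Ls × ((i : Fin n) → countIn i Ls ≡ 1)

-- 𝒯 : [n]-decorated binary trees.
-- node A l d r : label A, left subtree l, right subtree r, and
-- d = true iff the right edge is dashed.

data DTree (n : ℕ) : Set where
  leaf : DTree n
  node : Subset n → DTree n → Bool → DTree n → DTree n

dlabels : ∀ {n} → DTree n → List (Subset n)
dlabels leaf = []
dlabels (node A l d r) = A ∷ (dlabels l ++ dlabels r)

-- the right edge from a node labelled A with flag d to subtree r:
-- if r is a leaf the edge is not internal and must be solid (d = false);
-- if r is a node labelled B the internal edge must be a descent.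
RightEdgeOK : ∀ {n} → Subset n → Bool → DTree n → Set
RightEdgeOK A d leaf = d ≡ false
RightEdgeOK A d (node B _ _ _) = Descent A B

DWellFormed : ∀ {n} → DTree n → Set
DWellFormed leaf = ⊤
DWellFormed (node A l d r) = RightEdgeOK A d r × DWellFormed l × DWellFormed r

-- number of free nodes; first argument: is the root of this subtree free?
freeCount : ∀ {n} → Bool → DTree n → ℕ
freeCount f leaf = 0
freeCount f (node A l d r) =
  (if f then 1 else 0) ℕ.+ (freeCount true l ℕ.+ freeCount (not d) r)

freeNodes : ∀ {n} → DTree n → ℕ
freeNodes = freeCount true

IsT : (n k : ℕ) → DTree n → Set
IsT n k t = IsSetPartition (dlabels t) × DWellFormed t × freeNodes t ≡ k

𝒯 : ℕ → ℕ → Setoid _ _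
𝒯 n k = SubSetoid (DTree n) (IsT n k)

-- 𝒰 : binary trees with nodes labelled by [n], with marks.
-- node i m l r : label i, marked iff m = true.

data LTree (n : ℕ) : Set where
  leaf : LTree n
  node : Fin n → Bool → LTree n → LTree n → LTree n

nodeCount : ∀ {n} → LTree n → ℕ
nodeCount leaf = 0
nodeCount (node _ _ l r) = suc (nodeCount l ℕ.+ nodeCount r)

llabels : ∀ {n} → LTree n → List (Fin n)
llabels leaf = []
llabels (node i _ l r) = i ∷ (llabels l ++ llabels r)

markCount : ∀ {n} → LTree n → ℕ
markCount leaf = 0
markCount (node _ m l r) = (if m then 1 else 0) ℕ.+ (markCount l ℕ.+ markCount r)

RightDescL : ∀ {n} → Fin n → LTree n → Set
RightDescL i leaf = ⊤
RightDescL i (node j _ _ _) = j Data.Fin.< i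

MarkOK : ∀ {n} → Bool → LTree n → Set
MarkOK false l = ⊤
MarkOK true leaf = ⊥
MarkOK true (node _ _ _ _) = ⊤

LWellFormed : ∀ {n} → LTree n → Set
LWellFormed leaf = ⊤
LWellFormed (node i m l r) =
  RightDescL i r × MarkOK m l × LWellFormed l × LWellFormed r

IsU : (n k : ℕ) → LTree n → Set
IsU n k t = nodeCount t ≡ n
          × Unique (llabels t)
          × ((i : Fin n) → Data.List.Membership.Propositional._∈_ i (llabels t))
          × LWellFormed t
          × markCount t ≡ n ∸ k

𝒰 : ℕ → ℕ → Setoid _ _
𝒰 n k = SubSetoid (LTree n) (IsU n k)

-- 𝒱 : Cayley trees on [n+1] (vertex with index i ∈ Fin (n+1) has label
-- i+1), given by an adjacency matrix, with marked internal vertices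
-- among labels 1..n (given as a subset M of Fin n, embedded by inject₁).

Graph : ℕ → Set
Graph m = Vec (Vec Bool m) m

Adj : ∀ {m} → Graph m → Fin m → Fin m → Set
Adj G i j = lookup (lookup G i) j ≡ true

data Walk {m} (G : Graph m) : Fin m → Fin m → Set where
  here  : ∀ {i} → Walk G i i
  there : ∀ {i j l} → Adj G i j → Walk G j l → Walk G i l

Chain : ∀ {m} → Graph m → Fin m → List (Fin m) → Set
Chain G v [] = ⊤
Chain G v (w ∷ ws) = Adj G v w × Chain G w ws

last : ∀ {A : Set} → A → List A → A
last a [] = a
last a (b ∷ bs) = last b bs

Cycle : ∀ {m} → Graph m → Set
Cycle {m} G = Σ (Fin m) λ v → Σ (List (Fin m)) λ vs →
  2 ℕ.≤ length vs × Unique (v ∷ vs) × Chain G v vs × Adj G (last v vs) v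

IsTree : ∀ {m} → Graph m → Set
IsTree {m} G =
    ((i j : Fin m) → Adj G i j → Adj G j i)
  × ((i : Fin m) → ¬ Adj G i i)
  × ((i j : Fin m) → Walk G i j)
  × ¬ Cycle G

degree : ∀ {m} → Graph m → Fin m → ℕ
degree {m} G i = ∣ lookup G i ∣

IsV : (n k : ℕ) → Graph (suc n) × Subset n → Set
IsV n k (G , M) = IsTree G
                × ((i : Fin n) → i ∈ M → 2 ℕ.≤ degree G (inject₁ i))
                × ∣ M ∣ ≡ n ∸ k

𝒱 : ℕ → ℕ → Setoid _ _
𝒱 n k = SubSetoid (Graph (suc n) × Subset n) (IsV n k)

-- 𝒲 : f : [n-1] → [n+1] (as a vector), S ⊆ Im f ∩ [n], |S| = n - k.
-- Index i ∈ Fin (n+1) stands for the element i+1; [n] = inject₁ (Fin n).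

IsW : (n k : ℕ) → Vec (Fin (suc n)) (n ∸ 1) × Subset n → Set
IsW n k (f , S) = ((i : Fin n) → i ∈ S → ∃[ j ] lookup f j ≡ inject₁ i)
                × ∣ S ∣ ≡ n ∸ k

𝒲 : ℕ → ℕ → Setoid _ _
𝒲 n k = SubSetoid (Vec (Fin (suc n)) (n ∸ 1) × Subset n) (IsW n k)

-- Shi arrangement (over ℚ).
-- Hyperplane (i , j , c) with i < j, c ∈ {0,1}:  x_i - x_j = c.

data Sign : Set where
  lt eq gt : Sign

-- a choice of <, =, > for each hyperplane (entries with i ≥ j unused)
SignVector : ℕ → Set
SignVector n = Fin n → Fin n → Fin 2 → Sign

Point : ℕ → Set
Point n = Fin n → ℚ

const : Fin 2 → ℚ
const zero = 0ℚ
const (suc _) = 1ℚ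

SatSign : Sign → ℚ → ℚ → Set
SatSign lt a b = a ℚ.< b
SatSign eq a b = a ≡ b
SatSign gt a b = b ℚ.< a

InFace : ∀ {n} → SignVector n → Point n → Set
InFace {n} σ x = (i j : Fin n) → i Data.Fin.< j → (c : Fin 2) →
  SatSign (σ i j c) (x i ℚ.- x j) (const c)

sumF : ∀ {d} → (Fin d → ℚ) → ℚ
sumF {zero} f = 0ℚ
sumF {suc d} f = f zero ℚ.+ sumF (λ i → f (suc i))

AffinelyIndependent : ∀ {n d} → (Fin (suc d) → Point n) → Set
AffinelyIndependent {n} {d} p =
  (c : Fin d → ℚ) →
  ((t : Fin n) → sumF (λ i → c i ℚ.* (p (suc i) t ℚ.- p zero t)) ≡ 0ℚ) →
  (i : Fin d) → c i ≡ 0ℚ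

AffineDim : ∀ {n} → (Point n → Set) → ℕ → Set
AffineDim {n} S k =
    (∃[ p ] (((i : Fin (suc k)) → S (p i)) × AffinelyIndependent {n} {k} p))
  × ¬ (∃[ p ] (((i : Fin (suc (suc k))) → S (p i)) × AffinelyIndependent {n} {suc k} p))

IsShiFace : (n k : ℕ) → SignVector n → Set
IsShiFace n k σ = (∃[ x ] InFace σ x) × AffineDim (InFace σ) k

-- k-dimensional faces; two systems define the same face iff they agree on
-- every hyperplane
ShiFaces : ℕ → ℕ → Setoid _ _
ShiFaces n k = record
  { Carrier = Σ (SignVector n) (IsShiFace n k)
  ; _≈_ = λ σ τ → (i j : Fin n) → i Data.Fin.< j → (c : Fin 2) →
                   proj₁ σ i j c ≡ proj₁ τ i j c
  ; isEquivalence = record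
      { refl = λ i j _ c → P.refl
      ; sym = λ e i j p c → P.sym (e i j p c)
      ; trans = λ e f i j p c → P.trans (e i j p c) (f i j p c) } }

{-# OPTIONS --safe #-}

-- 𝒯 and 𝒰.  A left edge below a marked node a without right child becomes, if the image
-- of the left subtree has root label B, the merger of a into B when a < min B, and a
-- dashed right edge from {a} to B otherwise; if a marked node has a right child, that
-- right edge is dashed instead.  Reading the labels increasingly inverts this.
--
-- 𝒰, 𝒱 and 𝒲.  With left child = first child and right child = next sibling, a tree of
-- 𝒰 is a rooted forest on [n] whose siblings are listed in decreasing order, that is, an
-- acyclic parent map p : [n] → [n+1], that is, a Cayley tree rooted at n+1.  A vertex of
-- [n] is internal iff it lies in the image of p, and the Prüfer code of p has the same
-- image in [n] as p.
--
-- Faces.  A point x orders the numbers x b and x a + 1, and a queue of the blocks a with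
-- x a + 1 still to come turns this order into a binary tree: the left child of a block is
-- the block directly following x b, its right child the one directly following (solid)
-- or equal to (dashed) x b + 1.  The comparison of x b with x a + 1 is visible to the Shi
-- arrangement only if b < a; passing x a + 1 as late as the visible comparisons permit
-- gives a tree that depends on the face only, and these are the trees whose right edges
-- are descents.  The clusters joined by dashed edges move rigidly and independently of
-- each other, so the dimension is the number of free nodes.

module Submission where

open import Defs hiding (lt; eq; gt)
open import Data.Bool as Bool using (Bool; true; false; if_then_else_; not; _∨_)
open import Data.Product using (Σ; ∃; _×_; _,_; proj₁; proj₂)
open import Data.Sum using (_⊎_; inj₁; inj₂; [_,_]′)
open import Data.Unit using (⊤; tt)
open import Data.Empty using (⊥; ⊥-elim)
open import Function using (_∘_; id)
open import Function.Bundles using (Inverse; mk⇔)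
open import Relation.Nullary using (¬_; ¬?; Dec; yes; no; does)
open import Relation.Nullary.Decidable using (_→-dec_; _×-dec_; _⊎-dec_; dec-true)
open import Relation.Binary using (Setoid)
open import Relation.Binary.Definitions using (tri<; tri≈; tri>)
open import Relation.Binary.PropositionalEquality
open import Data.Nat as ℕ using (ℕ; zero; suc; _∸_; z≤n; s≤s)
import Data.Nat.Properties as ℕₚ
open import Data.Fin as Fin using (Fin; toℕ; zero; suc; punchIn; punchOut; _↑ˡ_; _↑ʳ_; splitAt; inject₁; fromℕ; combine; funToFin; finToFun)
import Data.Fin.Properties as Finₚ
open import Data.Fin.Subset as Subset using (Subset; Nonempty; ∣_∣; ⁅_⁆; _∪_; inside; outside; Empty)
open import Data.Vec as Vec using (lookup; []; _∷_; here; there; tabulate; Vec; toList)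
open import Data.List as List using (List; []; _∷_; _++_; length; map; allFin; _∷ʳ_)
open import Data.Rational as ℚ using (ℚ; 0ℚ; 1ℚ)
import Data.Rational.Properties as ℚₚ
open import Data.List.Membership.Propositional as List∈ using (lose)
import Data.List.Membership.Propositional.Properties as ∈ₚ
open import Data.List.Relation.Unary.All as All using (All; []; _∷_)
import Data.List.Relation.Unary.All.Properties as Allₚ
open import Data.List.Relation.Unary.Any as Any using (here; there; Any)
import Data.List.Relation.Unary.Any.Properties as Anyₚ
open import Data.List.Relation.Unary.AllPairs using ([]; _∷_)
open import Data.List.Relation.Unary.Unique.Propositional as Unique using (Unique)
import Data.List.Relation.Unary.Unique.Propositional.Properties as Uniqueₚ

-- All sets are compared by their underlying data, so a bijection is obtained from an injective map
-- with a section; between 𝒰 and the parent maps, two injections and finiteness suffice. The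
-- obstacle on the face side is that points of one face may order the values x b and x a + 1
-- differently, so a tree cannot simply be read off that order. Tree and point are therefore joined
-- by a relation, `Run`, which records visible comparisons only and hence passes from one point of a
-- face to every other. A run determines all signs, two runs over points of the same face belong to
-- the same tree, and runs exist over a given point as well as for a given tree; together this is
-- the bijection. Descents serve twice. A descent pair shows that a waiting block had to be closed
-- before the next block could start, and across a dashed edge it is a visible equality, from which
-- the whole lower block is tied to the upper one. The dimension is bounded below by shifting one
-- cluster at a time by a small amount, and above by elimination on one representative per cluster.

module Bijections where
  open import Data.Nat using (_+_)

  -- Criteria for bijections of setoids.

  module _ {a ℓ b m} (X : Setoid a ℓ) (Y : Setoid b m) where
    private
      module X = Setoid X
      module Y = Setoid Y

    -- Injectivity makes the chosen preimage unique up to equivalence, so `from` respects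
    -- equivalence although `sec` is an arbitrary choice.
    inverse-from-section : (f : X.Carrier → Y.Carrier) →
      (∀ {x x'} → x X.≈ x' → f x Y.≈ f x') → (∀ {x x'} → f x Y.≈ f x' → x X.≈ x') →
      (∀ y → ∃ λ x → f x Y.≈ y) → Inverse X Y
    inverse-from-section f f-cong f-inj sec = record
      { to = f ; from = λ y → proj₁ (sec y) ; to-cong = f-cong
      ; from-cong = λ {y} {y'} e →
          f-inj (Y.trans (proj₂ (sec y)) (Y.trans e (Y.sym (proj₂ (sec y')))))
      ; inverse = (λ {y} e → Y.trans (f-cong e) (proj₂ (sec y)))
                , (λ {x} {y} e → f-inj (Y.trans (proj₂ (sec y)) e)) }

  -- If f is injective and fⁱ y ≈ fʲ y with i < j, then y ≈ f (fʲ⁻ⁱ⁻¹ y).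
  module _ {a ℓ} (X : Setoid a ℓ) where
    private module X = Setoid X

    injective-endo⇒surjective : ∀ {N} (e : X.Carrier → Fin N) →
      (∀ {x x'} → e x ≡ e x' → x X.≈ x') → (f : X.Carrier → X.Carrier) →
      (∀ {x x'} → f x X.≈ f x' → x X.≈ x') → ∀ y → ∃ λ x → f x X.≈ y
    injective-endo⇒surjective {N} e e-inj f f-inj y = result
      where
      iter : ℕ → X.Carrier
      iter zero = y
      iter (suc i) = f (iter i)

      cancel : ∀ i d → iter i X.≈ iter (i + suc d) → ∃ λ x → f x X.≈ y
      cancel zero d eq = iter d , X.sym eq
      cancel (suc i) d eq = cancel i d (f-inj eq)

      result : ∃ λ x → f x X.≈ y
      result with Finₚ.pigeonhole (ℕₚ.n<1+n N) (λ i → e (iter (toℕ i)))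
      ... | i , j , i<j , eq with ℕₚ.m≤n⇒∃[o]m+o≡n i<j
      ...   | d , i+d≡j = cancel (toℕ i) d (subst (λ k → iter (toℕ i) X.≈ iter k)
                (sym (trans (ℕₚ.+-suc (toℕ i) d) i+d≡j)) (e-inj eq))

  module _ {a ℓ b m} (X : Setoid a ℓ) (Y : Setoid b m) where
    private
      module X = Setoid X
      module Y = Setoid Y

    -- The composite of `g` and `f` is an injective endomap of a setoid that embeds in `Fin N`,
    -- hence onto, and so `f` is onto. Nothing has to be shown about `g` inverting `f`.
    inverse-from-injections : ∀ {N} (e : Y.Carrier → Fin N) →
      (∀ {y y'} → e y ≡ e y' → y Y.≈ y') →
      (f : X.Carrier → Y.Carrier) → (∀ {x x'} → x X.≈ x' → f x Y.≈ f x') →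
      (∀ {x x'} → f x Y.≈ f x' → x X.≈ x') →
      (g : Y.Carrier → X.Carrier) → (∀ {y y'} → g y X.≈ g y' → y Y.≈ y') →
      Inverse X Y
    inverse-from-injections e e-inj f f-cong f-inj g g-inj =
      inverse-from-section X Y f f-cong f-inj λ y →
        let (y' , eq) = injective-endo⇒surjective Y e e-inj (λ y' → f (g y'))
                          (λ eq' → g-inj (f-inj eq')) y
        in g y' , eq

-- 𝒰 and 𝒯: marks against merged labels and dashed edges.

module TreeTransfer where
  open Bijections
  open import Data.Nat using (_+_; _≤_)
  open import Data.Nat.Solver using (module +-*-Solver)
  open import Data.Bool.Properties using (∨-identityʳ)
  open import Data.Fin.Subset using (_∈_; _∉_; _-_)
  open import Data.Fin.Subset.Properties
  open import Data.Vec.Properties using (lookup-zipWith; []=⇒lookup; lookup⇒[]=)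
  open import Data.List.Properties using (length-++; length-tabulate; map-++)
  open import Data.List.Membership.Propositional.Properties.WithK using (unique∧set⇒bag)
  open import Data.List.Relation.Binary.BagAndSetEquality using (∼bag⇒↭)
  open import Data.List.Relation.Binary.Permutation.Propositional using (_↭_)
  open import Data.List.Relation.Binary.Permutation.Propositional.Properties using (↭-length)

  bit : Bool → ℕ
  bit b = if b then 1 else 0

  ∉⇒lookup : ∀ {n} {A : Subset n} {i} → i ∉ A → lookup A i ≡ false
  ∉⇒lookup {A = A} {i} i∉A with lookup A i in eq
  ... | false = refl
  ... | true = ⊥-elim (i∉A (lookup⇒[]= i A eq))

  minimum : ∀ {n} (A : Subset n) → Nonempty A → ∃ λ a → a ∈ A × (∀ {b} → b ∈ A → a Fin.≤ b)
  minimum (inside ∷ A) ne = zero , here , λ _ → z≤n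
  minimum (outside ∷ A) (suc i , there i∈A) with minimum A (i , i∈A)
  ... | a , a∈A , a≤ = suc a , there a∈A , λ { (there b∈A) → s≤s (a≤ b∈A) }

  countIn-++ : ∀ {n} (i : Fin n) As Bs → countIn i (As ++ Bs) ≡ countIn i As + countIn i Bs
  countIn-++ i [] Bs = refl
  countIn-++ i (A ∷ As) Bs rewrite countIn-++ i As Bs = sym (ℕₚ.+-assoc (bit (lookup A i)) _ _)

  -- Multiplicity in a list, phrased through `countIn` of singletons so that it compares directly
  -- with the label counts in 𝒯.
  occ : ∀ {n} → Fin n → List (Fin n) → ℕ
  occ i js = countIn i (map ⁅_⁆ js)

  occ-++ : ∀ {n} (i : Fin n) js ks → occ i (js ++ ks) ≡ occ i js + occ i ks
  occ-++ i js ks rewrite map-++ ⁅_⁆ js ks = countIn-++ i (map ⁅_⁆ js) (map ⁅_⁆ ks)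

  bit-self : ∀ {n} (i : Fin n) → bit (lookup ⁅ i ⁆ i) ≡ 1
  bit-self i = cong bit ([]=⇒lookup (x∈⁅x⁆ i))

  bit-other : ∀ {n} {i j : Fin n} → i ≢ j → bit (lookup ⁅ j ⁆ i) ≡ 0
  bit-other i≢j = cong bit (∉⇒lookup (x≢y⇒x∉⁅y⁆ i≢j))

  ∈⇒1≤occ : ∀ {n} {i : Fin n} {L} → i List∈.∈ L → 1 ≤ occ i L
  ∈⇒1≤occ {i = i} (here refl) rewrite bit-self i = s≤s z≤n
  ∈⇒1≤occ (there p) = ℕₚ.≤-trans (∈⇒1≤occ p) (ℕₚ.m≤n+m _ _)

  ∉⇒occ : ∀ {n} {i : Fin n} L → ¬ i List∈.∈ L → occ i L ≡ 0
  ∉⇒occ [] _ = refl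
  ∉⇒occ (j ∷ L) i∉ rewrite bit-other (i∉ ∘ here) = ∉⇒occ L (i∉ ∘ there)

  1≤occ⇒∈ : ∀ {n} {i : Fin n} L → 1 ≤ occ i L → i List∈.∈ L
  1≤occ⇒∈ {i = i} (j ∷ L) 1≤ with i Finₚ.≟ j
  ... | yes i≡j = here i≡j
  ... | no i≢j = there (1≤occ⇒∈ L (subst (λ z → 1 ≤ z + occ i L) (bit-other i≢j) 1≤))

  unique⇒occ≤1 : ∀ {n} {i : Fin n} {L} → Unique L → occ i L ≤ 1
  unique⇒occ≤1 [] = z≤n
  unique⇒occ≤1 {i = i} {j ∷ L} (j∉L ∷ uniq) with i Finₚ.≟ j
  ... | no i≢j rewrite bit-other i≢j = unique⇒occ≤1 uniq
  ... | yes refl rewrite bit-self i | ∉⇒occ L (Allₚ.All¬⇒¬Any j∉L) = s≤s z≤n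

  occ≤1⇒unique : ∀ {n} (L : List (Fin n)) → (∀ i → occ i L ≤ 1) → Unique L
  occ≤1⇒unique [] _ = []
  occ≤1⇒unique (j ∷ L) occ≤1 = Allₚ.¬Any⇒All¬ L j∉L ∷ occ≤1⇒unique L (λ i → ℕₚ.≤-trans (ℕₚ.m≤n+m _ _) (occ≤1 i))
    where
    j∉L : ¬ j List∈.∈ L
    j∉L j∈L with s≤s () ← ℕₚ.≤-trans (s≤s (∈⇒1≤occ j∈L)) (subst (λ z → z + occ j L ≤ 1) (bit-self j) (occ≤1 j))

  complete⇒↭ : ∀ {n} {L : List (Fin n)} → Unique L → (∀ i → i List∈.∈ L) → L ↭ allFin n
  complete⇒↭ {n} uniq complete =
    ∼bag⇒↭ (unique∧set⇒bag uniq (Uniqueₚ.allFin⁺ n)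
      (mk⇔ (λ _ → ∈ₚ.∈-allFin _) (λ _ → complete _)))

  nodeCount≡length : ∀ {n} (u : LTree n) → nodeCount u ≡ length (llabels u)
  nodeCount≡length leaf = refl
  nodeCount≡length (node a m l r) rewrite length-++ (llabels l) {llabels r} =
    cong suc (cong₂ _+_ (nodeCount≡length l) (nodeCount≡length r))

  all-above? : ∀ {n} (a : Fin n) (B : Subset n) → Dec (∀ b → b ∈ B → a Fin.< b)
  all-above? a B = Finₚ.all? (λ b → (b ∈? B) →-dec (a Finₚ.<? b))

  -- The two outcomes stay distinguishable: a merger has at least two elements in its root label, a
  -- link has a singleton there and an empty left subtree. The clause for `leaf` is a default, since
  -- a marked node of a well-formed tree has a left child.
  prepend : ∀ {n} → Fin n → DTree n → DTree n
  prepend a leaf = node ⁅ a ⁆ leaf false leaf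
  prepend a (node B l d r) with all-above? a B
  ... | yes _ = node (⁅ a ⁆ ∪ B) l d r
  ... | no _ = node ⁅ a ⁆ leaf true (node B l d r)

  ψ : ∀ {n} → LTree n → DTree n
  ψ leaf = leaf
  ψ (node a false l r) = node ⁅ a ⁆ (ψ l) false (ψ r)
  ψ (node a true l leaf) = prepend a (ψ l)
  ψ (node a true l r@(node _ _ _ _)) = node ⁅ a ⁆ (ψ l) true (ψ r)

  -- As the root of a tree is the minimum of the root label of its image, `Descent` from a singleton
  -- to that label says the same as `RightDescL`.
  RootMin : ∀ {n} → LTree n → DTree n → Set
  RootMin leaf leaf = ⊤
  RootMin (node a _ _ _) (node B _ _ _) = a ∈ B × (∀ b → b ∈ B → a Fin.≤ b)
  RootMin _ _ = ⊥

  singleton-min : ∀ {n} (a b : Fin n) → b ∈ ⁅ a ⁆ → a Fin.≤ b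
  singleton-min a b b∈ = Finₚ.≤-reflexive (sym (x∈⁅y⁆⇒x≡y a b∈))

  root-ψ : ∀ {n} (u : LTree n) → RootMin u (ψ u)
  root-ψ leaf = tt
  root-ψ (node a false l r) = x∈⁅x⁆ a , singleton-min a
  root-ψ (node a true l (node _ _ _ _)) = x∈⁅x⁆ a , singleton-min a
  root-ψ (node a true l leaf) with ψ l
  ... | leaf = x∈⁅x⁆ a , singleton-min a
  ... | node B _ _ _ with all-above? a B
  ...   | no _ = x∈⁅x⁆ a , singleton-min a
  ...   | yes a<B = x∈p∪q⁺ (inj₁ (x∈⁅x⁆ a)) , min
    where
    min : ∀ b → b ∈ ⁅ a ⁆ ∪ B → a Fin.≤ b
    min b b∈ with x∈p∪q⁻ ⁅ a ⁆ B b∈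
    ... | inj₁ p = singleton-min a b p
    ... | inj₂ p = ℕₚ.<⇒≤ (a<B b p)

  bit-∪ : ∀ {n} (a : Fin n) B → (∀ b → b ∈ B → a Fin.< b) → ∀ i →
    bit (lookup (⁅ a ⁆ ∪ B) i) ≡ bit (lookup ⁅ a ⁆ i) + bit (lookup B i)
  bit-∪ a B a<B i rewrite lookup-zipWith _∨_ i ⁅ a ⁆ B with i Finₚ.≟ a
  ... | no i≢a rewrite ∉⇒lookup (x≢y⇒x∉⁅y⁆ i≢a) = refl
  ... | yes refl rewrite ∉⇒lookup {A = B} {i} (λ i∈B → Finₚ.<-irrefl refl (a<B i i∈B))
    = trans (cong bit (∨-identityʳ _)) (sym (ℕₚ.+-identityʳ _))

  count-prepend : ∀ {n} (i : Fin n) a t →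
    countIn i (dlabels (prepend a t)) ≡ bit (lookup ⁅ a ⁆ i) + countIn i (dlabels t)
  count-prepend i a leaf = refl
  count-prepend i a (node B l d r) with all-above? a B
  ... | no _ = refl
  ... | yes a<B rewrite bit-∪ a B a<B i = ℕₚ.+-assoc (bit (lookup ⁅ a ⁆ i)) _ _

  count-ψ : ∀ {n} (i : Fin n) (u : LTree n) → countIn i (dlabels (ψ u)) ≡ occ i (llabels u)
  count-ψ {n} i u = go u
    where
    children : ∀ As Bs js ks → countIn i As ≡ occ i js → countIn i Bs ≡ occ i ks →
      countIn i (As ++ Bs) ≡ occ i (js ++ ks)
    children As Bs js ks p q = trans (countIn-++ i As Bs) (trans (cong₂ _+_ p q) (sym (occ-++ i js ks)))
    go : ∀ (u : LTree n) → countIn i (dlabels (ψ u)) ≡ occ i (llabels u)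
    go leaf = refl
    go (node a true l leaf) = trans (count-prepend i a (ψ l)) (cong (bit (lookup ⁅ a ⁆ i) +_)
      (trans (go l) (trans (sym (ℕₚ.+-identityʳ _)) (sym (occ-++ i (llabels l) [])))))
    go (node a false l r) = cong (bit (lookup ⁅ a ⁆ i) +_)
      (children (dlabels (ψ l)) (dlabels (ψ r)) (llabels l) (llabels r) (go l) (go r))
    go (node a true l r@(node _ _ _ _)) = cong (bit (lookup ⁅ a ⁆ i) +_)
      (children (dlabels (ψ l)) (dlabels (ψ r)) (llabels l) (llabels r) (go l) (go r))

  -- Each mark costs exactly one free node: a merger loses a node, and a dashed edge makes a free
  -- node captive. Well-formedness excludes the default clause of `prepend`, where a mark would cost
  -- nothing.
  marks+free : ∀ {n} (u : LTree n) → LWellFormed u → markCount u + freeNodes (ψ u) ≡ nodeCount u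
  marks+free leaf _ = refl
  marks+free (node a false l r) (_ , _ , wl , wr) =
    trans (lem (markCount l) (markCount r) (freeNodes (ψ l)) (freeNodes (ψ r)))
          (cong suc (cong₂ _+_ (marks+free l wl) (marks+free r wr)))
    where
    open +-*-Solver
    lem : ∀ p q x y → (p + q) + suc (x + y) ≡ suc ((p + x) + (q + y))
    lem = solve 4 (λ p q x y → (p :+ q) :+ (con 1 :+ (x :+ y)) := con 1 :+ ((p :+ x) :+ (q :+ y))) refl
  marks+free (node a true l r@(node b m rl rr)) (_ , _ , wl , wr)
    with ψ r | marks+free r wr | root-ψ r
  ... | node B l' d r' | ih | _ =
    trans (lem (markCount l) (markCount r) (freeNodes (ψ l)) (freeCount false (node B l' d r')))
          (cong suc (cong₂ _+_ (marks+free l wl) ih))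
    where
    open +-*-Solver
    lem : ∀ p q x y → suc (p + q) + suc (x + y) ≡ suc ((p + x) + (q + suc y))
    lem = solve 4 (λ p q x y → (con 1 :+ (p :+ q)) :+ (con 1 :+ (x :+ y)) := con 1 :+ ((p :+ x) :+ (q :+ (con 1 :+ y)))) refl
  marks+free (node a true l@(node b m ll lr) leaf) (_ , _ , wl , _)
    with ψ l | marks+free l wl | root-ψ l
  ... | node B l' d r' | ih | _ with all-above? a B
  ...   | yes _ rewrite ℕₚ.+-identityʳ (markCount l) | ℕₚ.+-identityʳ (nodeCount l) = cong suc ih
  ...   | no _ rewrite ℕₚ.+-identityʳ (markCount l) | ℕₚ.+-identityʳ (nodeCount l) = cong suc ih

  Simple : ∀ {n} → LTree n → Set
  Simple u = ∀ i → occ i (llabels u) ≤ 1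

  -- Labels do not see marks, so `false` stands for any mark.
  simple-left : ∀ {n} a (l r : LTree n) → Simple (node a false l r) → Simple l
  simple-left a l r s i = ℕₚ.≤-trans
    (ℕₚ.≤-trans (ℕₚ.m≤m+n _ (occ i (llabels r))) (ℕₚ.≤-reflexive (sym (occ-++ i (llabels l) (llabels r)))))
    (ℕₚ.≤-trans (ℕₚ.m≤n+m _ (bit (lookup ⁅ a ⁆ i))) (s i))

  simple-right : ∀ {n} a (l r : LTree n) → Simple (node a false l r) → Simple r
  simple-right a l r s i = ℕₚ.≤-trans
    (ℕₚ.≤-trans (ℕₚ.m≤n+m _ (occ i (llabels l))) (ℕₚ.≤-reflexive (sym (occ-++ i (llabels l) (llabels r)))))
    (ℕₚ.≤-trans (ℕₚ.m≤n+m _ (bit (lookup ⁅ a ⁆ i))) (s i))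

  ¬all-above⇒descent : ∀ {n} {a : Fin n} {B} → a ∉ B → ¬ (∀ b → b ∈ B → a Fin.< b) → Descent ⁅ a ⁆ B
  ¬all-above⇒descent {a = a} {B} a∉B ¬above
    with Finₚ.¬∀⟶∃¬ _ _ (λ b → (b ∈? B) →-dec (a Finₚ.<? b)) ¬above
  ... | b , ¬imp with b ∈? B
  ...   | no b∉B = ⊥-elim (¬imp (λ b∈B → ⊥-elim (b∉B b∈B)))
  ...   | yes b∈B with Finₚ.<-cmp a b
  ...     | tri< a<b _ _ = ⊥-elim (¬imp (λ _ → a<b))
  ...     | tri≈ _ refl _ = ⊥-elim (a∉B b∈B)
  ...     | tri> _ _ b<a = a , b , x∈⁅x⁆ a , b∈B , b<a

  fresh-root : ∀ {n} a (l r : LTree n) {B l' d r'} → Simple (node a false l r) → ψ l ≡ node B l' d r' → a ∉ B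
  fresh-root a l r {B} simple eq a∈B = ℕₚ.<-irrefl refl (ℕₚ.≤-trans
    (ℕₚ.+-mono-≤ (ℕₚ.≤-reflexive (sym (bit-self a)))
      (ℕₚ.≤-trans a∈l (ℕₚ.≤-trans (ℕₚ.m≤m+n _ (occ a (llabels r))) (ℕₚ.≤-reflexive (sym (occ-++ a (llabels l) (llabels r)))))))
    (simple a))
    where
    a∈l : 1 ≤ occ a (llabels l)
    a∈l rewrite sym (count-ψ a l) | eq | []=⇒lookup a∈B = s≤s z≤n

  -- A merger only enlarges the upper end of the right edge below it, which keeps a descent. At a
  -- link, `a` is not below all of `B`, and it is not in `B` because labels occur once, so some
  -- element of `B` is smaller.
  ψ-wf : ∀ {n} (u : LTree n) → Simple u → LWellFormed u → DWellFormed (ψ u)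
  ψ-wf leaf _ _ = tt
  ψ-wf (node a false l leaf) s (_ , _ , wl , _) = refl , ψ-wf l (simple-left a l leaf s) wl , tt
  ψ-wf (node a false l r@(node b _ _ _)) s (b<a , _ , wl , wr)
    with ψ r | ψ-wf r (simple-right a l r s) wr | root-ψ r
  ... | node B _ _ _ | wr' | b∈B , _ = (a , b , x∈⁅x⁆ a , b∈B , b<a) , ψ-wf l (simple-left a l r s) wl , wr'
  ψ-wf (node a true l r@(node b _ _ _)) s (b<a , _ , wl , wr)
    with ψ r | ψ-wf r (simple-right a l r s) wr | root-ψ r
  ... | node B _ _ _ | wr' | b∈B , _ = (a , b , x∈⁅x⁆ a , b∈B , b<a) , ψ-wf l (simple-left a l r s) wl , wr'
  ψ-wf (node a true l@(node _ _ _ _) leaf) s (_ , _ , wl , _)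
    with ψ l in eq | ψ-wf l (simple-left a l leaf s) wl | root-ψ l
  ... | node B l' d r' | (re , wl' , wr') | _ with all-above? a B
  ...   | yes a<B = edge r' re , wl' , wr'
    where
    edge : ∀ r' → RightEdgeOK B d r' → RightEdgeOK (⁅ a ⁆ ∪ B) d r'
    edge leaf e = e
    edge (node _ _ _ _) (x , y , x∈ , y∈ , y<x) = x , y , x∈p∪q⁺ (inj₂ x∈) , y∈ , y<x
  ...   | no ¬above = ¬all-above⇒descent (fresh-root a l leaf s eq) ¬above , tt , (re , wl' , wr')

  ψ-nonempty : ∀ {n} (u : LTree n) → All Nonempty (dlabels (ψ u))
  ψ-nonempty leaf = []
  ψ-nonempty (node a false l r) = (a , x∈⁅x⁆ a) ∷ Allₚ.++⁺ (ψ-nonempty l) (ψ-nonempty r)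
  ψ-nonempty (node a true l r@(node _ _ _ _)) = (a , x∈⁅x⁆ a) ∷ Allₚ.++⁺ (ψ-nonempty l) (ψ-nonempty r)
  ψ-nonempty (node a true l leaf) with ψ l | ψ-nonempty l
  ... | leaf | _ = (a , x∈⁅x⁆ a) ∷ []
  ... | node B _ _ _ | ne@(_ ∷ ne') with all-above? a B
  ...   | yes _ = (a , x∈p∪q⁺ (inj₁ (x∈⁅x⁆ a))) ∷ ne'
  ...   | no _ = (a , x∈⁅x⁆ a) ∷ ne

  singleton-injective : ∀ {n} {a b : Fin n} → ⁅ a ⁆ ≡ ⁅ b ⁆ → a ≡ b
  singleton-injective {a = a} {b} eq = x∈⁅y⁆⇒x≡y b (subst (a ∈_) eq (x∈⁅x⁆ a))

  -- The element `a` is recovered as the minimum of the union, and `B` as what remains.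
  ∪-min-injective : ∀ {n} {a a' : Fin n} {B B'} → (∀ b → b ∈ B → a Fin.< b) → (∀ b → b ∈ B' → a' Fin.< b) →
    ⁅ a ⁆ ∪ B ≡ ⁅ a' ⁆ ∪ B' → a ≡ a' × B ≡ B'
  ∪-min-injective {a = a} {a'} {B} {B'} a<B a'<B' eq = a≡a' , ⊆-antisym (sub a<B a≡a' eq) (sub a'<B' (sym a≡a') (sym eq))
    where
    min : ∀ {a a' : Fin _} {B B'} → (∀ b → b ∈ B' → a' Fin.< b) → ⁅ a ⁆ ∪ B ≡ ⁅ a' ⁆ ∪ B' → a' Fin.≤ a
    min {a} {a'} {B} {B'} a'<B' eq with x∈p∪q⁻ ⁅ a' ⁆ B' (subst (a ∈_) eq (x∈p∪q⁺ (inj₁ (x∈⁅x⁆ a))))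
    ... | inj₁ p = singleton-min a' a p
    ... | inj₂ p = ℕₚ.<⇒≤ (a'<B' a p)
    a≡a' : a ≡ a'
    a≡a' = Finₚ.≤-antisym (min a<B (sym eq)) (min a'<B' eq)
    sub : ∀ {a a' : Fin _} {B B'} → (∀ b → b ∈ B → a Fin.< b) → a ≡ a' → ⁅ a ⁆ ∪ B ≡ ⁅ a' ⁆ ∪ B' →
      ∀ {i} → i ∈ B → i ∈ B'
    sub {a} {a'} {B} {B'} a<B refl eq {i} i∈B with x∈p∪q⁻ ⁅ a' ⁆ B' (subst (i ∈_) eq (x∈p∪q⁺ (inj₂ i∈B)))
    ... | inj₂ p = p
    ... | inj₁ p = ⊥-elim (Finₚ.<-irrefl (sym (x∈⁅y⁆⇒x≡y a p)) (a<B i i∈B))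

  singleton≢∪ : ∀ {n} {a a' : Fin n} {B b} → (∀ b → b ∈ B → a' Fin.< b) → b ∈ B → ⁅ a ⁆ ≢ ⁅ a' ⁆ ∪ B
  singleton≢∪ {a = a} {a'} {B} {b} a'<B b∈B eq = Finₚ.<-irrefl
    (trans (x∈⁅y⁆⇒x≡y a (subst (a' ∈_) (sym eq) (x∈p∪q⁺ (inj₁ (x∈⁅x⁆ a')))))
           (sym (x∈⁅y⁆⇒x≡y a (subst (b ∈_) (sym eq) (x∈p∪q⁺ (inj₂ b∈B))))))
    (a'<B b b∈B)

  node-injective : ∀ {n} {A A' : Subset n} {l l' d d' r r'} →
    node A l d r ≡ node A' l' d' r' → A ≡ A' × l ≡ l' × d ≡ d' × r ≡ r'
  node-injective refl = refl , refl , refl , refl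

  -- The shapes of an image, freed from the decisions inside `ψ`, so that injectivity becomes a
  -- comparison of pairs of shapes. The condition in `dashed` separates it from `link`, whose left
  -- subtree is empty.
  data Image {n} : LTree n → DTree n → Set where
    empty : Image leaf leaf
    plain : ∀ {a l r} → Image (node a false l r) (node ⁅ a ⁆ (ψ l) false (ψ r))
    dashed : ∀ {a l r} → ψ l ≢ leaf → Image (node a true l r) (node ⁅ a ⁆ (ψ l) true (ψ r))
    link : ∀ {a l} → Image (node a true l leaf) (node ⁅ a ⁆ leaf true (ψ l))
    merge : ∀ {a l B l' d r' b} → ψ l ≡ node B l' d r' → (∀ b → b ∈ B → a Fin.< b) → b ∈ B →
      Image (node a true l leaf) (node (⁅ a ⁆ ∪ B) l' d r')

  image : ∀ {n} (u : LTree n) → LWellFormed u → Image u (ψ u)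
  image leaf _ = empty
  image (node a false l r) _ = plain
  image (node a true l@(node _ _ _ _) r@(node _ _ _ _)) _ = dashed ψl≢leaf
    where
    ψl≢leaf : ψ l ≢ leaf
    ψl≢leaf eq with ψ l | root-ψ l
    ψl≢leaf () | node _ _ _ _ | _
  image (node a true l@(node _ _ _ _) leaf) _ with ψ l in eq | root-ψ l
  ... | node B l' d r' | b∈B , _ with all-above? a B
  ...   | yes a<B = merge eq a<B b∈B
  ...   | no _ = subst (λ t → Image (node a true l leaf) (node ⁅ a ⁆ leaf true t)) eq link

  ψ-injective : ∀ {n} (u v : LTree n) → LWellFormed u → LWellFormed v → ψ u ≡ ψ v → u ≡ v
  ψ-injective u v wu wv eq = go u v wu wv (image u wu) (image v wv) eq
    where
    go : ∀ {n} (u v : LTree n) {s t} → LWellFormed u → LWellFormed v → Image u s → Image v t → s ≡ t → u ≡ v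
    go leaf leaf _ _ empty empty _ = refl
    go (node a _ l r) (node a' _ l' r') (_ , _ , wl , wr) (_ , _ , wl' , wr') plain plain eq
      with eA , el , _ , er ← node-injective eq
      with refl ← singleton-injective eA
         | refl ← ψ-injective l l' wl wl' el
         | refl ← ψ-injective r r' wr wr' er = refl
    go (node a _ l r) (node a' _ l' r') (_ , _ , wl , wr) (_ , _ , wl' , wr') (dashed _) (dashed _) eq
      with eA , el , _ , er ← node-injective eq
      with refl ← singleton-injective eA
         | refl ← ψ-injective l l' wl wl' el
         | refl ← ψ-injective r r' wr wr' er = refl
    go (node a _ l _) (node a' _ l' _) (_ , _ , wl , _) (_ , _ , wl' , _) link link eq
      with eA , _ , _ , er ← node-injective eq
      with refl ← singleton-injective eA | refl ← ψ-injective l l' wl wl' er = refl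
    go (node a _ l _) (node a' _ l' _) (_ , _ , wl , _) (_ , _ , wl' , _) (merge e a<B _) (merge e' a'<B' _) eq
      with eA , refl , refl , refl ← node-injective eq
      with refl , refl ← ∪-min-injective a<B a'<B' eA
      with refl ← ψ-injective l l' wl wl' (trans e (sym e')) = refl
    go _ _ _ _ (dashed nl) link eq with _ , el , _ ← node-injective eq = ⊥-elim (nl el)
    go _ _ _ _ link (dashed nl) eq with _ , el , _ ← node-injective eq = ⊥-elim (nl (sym el))
    go _ _ _ _ plain (merge _ a<B b∈B) eq = ⊥-elim (singleton≢∪ a<B b∈B (proj₁ (node-injective eq)))
    go _ _ _ _ (dashed _) (merge _ a<B b∈B) eq = ⊥-elim (singleton≢∪ a<B b∈B (proj₁ (node-injective eq)))
    go _ _ _ _ link (merge _ a<B b∈B) eq = ⊥-elim (singleton≢∪ a<B b∈B (proj₁ (node-injective eq)))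
    go _ _ _ _ (merge _ a<B b∈B) plain eq = ⊥-elim (singleton≢∪ a<B b∈B (sym (proj₁ (node-injective eq))))
    go _ _ _ _ (merge _ a<B b∈B) (dashed _) eq = ⊥-elim (singleton≢∪ a<B b∈B (sym (proj₁ (node-injective eq))))
    go _ _ _ _ (merge _ a<B b∈B) link eq = ⊥-elim (singleton≢∪ a<B b∈B (sym (proj₁ (node-injective eq))))

  Preimage : ∀ {n} → DTree n → Set
  Preimage {n} t = Σ (LTree n) λ u → LWellFormed u × ψ u ≡ t

  prepend-merge : ∀ {n} (a : Fin n) B {l d r} → (∀ b → b ∈ B → a Fin.< b) →
    prepend a (node B l d r) ≡ node (⁅ a ⁆ ∪ B) l d r
  prepend-merge a B a<B with all-above? a B
  ... | yes _ = refl
  ... | no ¬a<B = ⊥-elim (¬a<B a<B)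

  prepend-link : ∀ {n} (a : Fin n) B {l d r} → Descent ⁅ a ⁆ B →
    prepend a (node B l d r) ≡ node ⁅ a ⁆ leaf true (node B l d r)
  prepend-link a B (x , y , x∈ , y∈B , y<x) with all-above? a B
  ... | no _ = refl
  ... | yes a<B rewrite x∈⁅y⁆⇒x≡y a x∈ = ⊥-elim (ℕₚ.<-asym y<x (a<B y y∈B))

  root-below : ∀ {n} {a : Fin n} {B l d r} v → ψ v ≡ node B l d r → Descent ⁅ a ⁆ B → RightDescL a v
  root-below leaf () _
  root-below {a = a} v@(node c _ _ _) eq (x , y , x∈ , y∈B , y<x) with root-ψ v
  ... | rm rewrite eq | x∈⁅y⁆⇒x≡y a x∈ = ℕₚ.≤-<-trans (proj₂ rm y y∈B) y<x

  ∈-minus : ∀ {n} {A : Subset n} {a b} → b ∈ A - a → b ∈ A × b ≢ a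
  ∈-minus {A = A} {a} b∈ = p─q⊆p A ⁅ a ⁆ b∈ , λ { refl → ℕₚ.<-irrefl refl
    (subst (λ S → ∣ S ∣ ℕ.< ∣ A - a ∣) (p─q─q≡p─q A ⁅ a ⁆) (x∈p⇒∣p-x∣<∣p∣ b∈)) }

  -- The elements of a label A = {a₁ < ⋯ < aₘ} become a chain of marked left edges.
  preimage-node : ∀ {n} fuel (A : Subset n) l d r → ∣ A ∣ ≤ fuel → Nonempty A → RightEdgeOK A d r →
    Preimage l → Preimage r → Preimage (node A l d r)
  preimage-node zero A l d r ∣A∣≤0 (a , a∈A) _ _ _ =
    ⊥-elim (ℕₚ.n≮0 (ℕₚ.<-≤-trans (x∈p⇒∣p-x∣<∣p∣ a∈A) ∣A∣≤0))
  preimage-node (suc fuel) A l d r ∣A∣≤ ne re pl@(u , wu , eu) pr@(v , wv , ev)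
    with minimum A ne
  ... | a , a∈A , a≤A with nonempty? (A - a)
  ...   | yes ne'@(a' , a'∈) = merged
    where
    a<A' : ∀ b → b ∈ A - a → a Fin.< b
    a<A' b b∈ = ℕₚ.≤∧≢⇒< (a≤A (proj₁ (∈-minus b∈))) (λ eq → proj₂ (∈-minus b∈) (sym (Finₚ.toℕ-injective eq)))
    edge : ∀ r → RightEdgeOK A d r → RightEdgeOK (A - a) d r
    edge leaf e = e
    edge (node _ _ _ _) (x , y , x∈ , y∈ , y<x) with x Finₚ.≟ a
    -- If the descent started at the removed minimum, the larger element `a'` serves as well.
    ... | yes refl = a' , y , a'∈ , y∈ , ℕₚ.<-trans y<x (a<A' a' a'∈)
    ... | no x≢a = x , y , x∈p∧x≢y⇒x∈p-y x∈ x≢a , y∈ , y<x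
    restore : ⁅ a ⁆ ∪ (A - a) ≡ A
    restore = ⊆-antisym to from
      where
      to : ∀ {i} → i ∈ ⁅ a ⁆ ∪ (A - a) → i ∈ A
      to {i} i∈ with x∈p∪q⁻ ⁅ a ⁆ (A - a) i∈
      ... | inj₁ p = subst (_∈ A) (sym (x∈⁅y⁆⇒x≡y a p)) a∈A
      ... | inj₂ p = proj₁ (∈-minus p)
      from : ∀ {i} → i ∈ A → i ∈ ⁅ a ⁆ ∪ (A - a)
      from {i} i∈ with i Finₚ.≟ a
      ... | yes refl = x∈p∪q⁺ (inj₁ (x∈⁅x⁆ a))
      ... | no i≢a = x∈p∪q⁺ (inj₂ (x∈p∧x≢y⇒x∈p-y i∈ i≢a))
    merged : Preimage (node A l d r)
    merged with preimage-node fuel (A - a) l d r (ℕₚ.≤-pred (ℕₚ.≤-trans (x∈p⇒∣p-x∣<∣p∣ a∈A) ∣A∣≤)) ne' (edge r re) pl pr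
    ... | leaf , _ , ()
    ... | w@(node _ _ _ _) , ww , ew = node a true w leaf , (tt , tt , ww , tt) ,
      trans (cong (prepend a) ew) (trans (prepend-merge a (A - a) a<A') (cong (λ S → node S l d r) restore))
  ...   | no A-a-empty with A≡a
    where
    A≡a : A ≡ ⁅ a ⁆
    A≡a = ⊆-antisym to (λ i∈ → subst (_∈ A) (sym (x∈⁅y⁆⇒x≡y a i∈)) a∈A)
      where
      to : ∀ {i} → i ∈ A → i ∈ ⁅ a ⁆
      to {i} i∈ with i Finₚ.≟ a
      ... | yes refl = x∈⁅x⁆ a
      ... | no i≢a = ⊥-elim (A-a-empty (i , x∈p∧x≢y⇒x∈p-y i∈ i≢a))
  ...     | refl = single d r u v re wu eu wv ev
    where
    single : ∀ d r u v → RightEdgeOK ⁅ a ⁆ d r → LWellFormed u → ψ u ≡ l → LWellFormed v → ψ v ≡ r → Preimage (node ⁅ a ⁆ l d r)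
    single d leaf u (node c m vl vr) _ _ _ _ ev with ψ (node c m vl vr) | root-ψ (node c m vl vr)
    single d leaf u (node c m vl vr) _ _ _ _ () | node _ _ _ _ | _
    single .false leaf u leaf refl wu eu _ _ =
      node a false u leaf , (tt , tt , wu , tt) , cong (λ s → node ⁅ a ⁆ s false leaf) eu
    single false r@(node _ _ _ _) u v re wu eu wv ev =
      node a false u v , (root-below v ev re , tt , wu , wv) , cong₂ (λ s t → node ⁅ a ⁆ s false t) eu ev
    single true (node _ _ _ _) _ leaf _ _ _ _ ()
    -- A dashed edge beside an empty left subtree comes from a marked node without right child: the
    -- preimage of the right subtree goes to the left.
    single true (node B _ _ _) leaf v@(node _ _ _ _) re _ refl wv ev =
      node a true v leaf , (tt , tt , wv , tt) , trans (cong (prepend a) ev) (prepend-link a B re)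
    single true r@(node _ _ _ _) u@(node _ _ _ _) v@(node _ _ _ _) re wu eu wv ev =
      node a true u v , (root-below v ev re , tt , wu , wv) , cong₂ (λ s t → node ⁅ a ⁆ s true t) eu ev

  preimage : ∀ {n} (t : DTree n) → All Nonempty (dlabels t) → DWellFormed t → Preimage t
  preimage leaf _ _ = leaf , tt , refl
  preimage (node A l d r) (ne ∷ nes) (re , wl , wr) =
    preimage-node ∣ A ∣ A l d r ℕₚ.≤-refl ne re
      (preimage l (Allₚ.++⁻ˡ (dlabels l) nes) wl) (preimage r (Allₚ.++⁻ʳ (dlabels l) nes) wr)

  occ≡1 : ∀ {n} {L : List (Fin n)} → Unique L → (∀ i → i List∈.∈ L) → ∀ i → occ i L ≡ 1
  occ≡1 uniq complete i = ℕₚ.≤-antisym (unique⇒occ≤1 uniq) (∈⇒1≤occ (complete i))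

  U→T : ∀ {n k} → k ≤ n → (u : LTree n) → IsU n k u → IsT n k (ψ u)
  U→T {n} {k} k≤n u (size , uniq , complete , wf , marks) =
    (ψ-nonempty u , λ i → trans (count-ψ i u) (occ≡1 uniq complete i)) ,
    ψ-wf u (λ i → unique⇒occ≤1 uniq) wf ,
    -- Marks and free nodes add up to `n`; since `k ≤ n`, the truncated difference can be cancelled.
    ℕₚ.+-cancelˡ-≡ (n ∸ k) _ _ (begin
      n ∸ k + freeNodes (ψ u)       ≡⟨ cong (_+ freeNodes (ψ u)) (sym marks) ⟩
      markCount u + freeNodes (ψ u) ≡⟨ marks+free u wf ⟩
      nodeCount u                   ≡⟨ size ⟩
      n                             ≡⟨ sym (ℕₚ.m∸n+n≡m k≤n) ⟩
      n ∸ k + k                     ∎)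
    where open ≡-Reasoning

  T→U : ∀ {n k} (u : LTree n) → LWellFormed u → IsT n k (ψ u) → IsU n k u
  T→U {n} {k} u wf ((_ , count) , _ , free) = size , uniq , complete , wf ,
    trans (sym (ℕₚ.m+n∸n≡m (markCount u) k))
          (cong (_∸ k) (trans (cong (markCount u +_) (sym free)) (trans (marks+free u wf) size)))
    where
    occ1 : ∀ i → occ i (llabels u) ≡ 1
    occ1 i = trans (sym (count-ψ i u)) (count i)
    uniq : Unique (llabels u)
    uniq = occ≤1⇒unique (llabels u) (λ i → ℕₚ.≤-reflexive (occ1 i))
    complete : ∀ i → i List∈.∈ llabels u
    complete i = 1≤occ⇒∈ (llabels u) (ℕₚ.≤-reflexive (sym (occ1 i)))
    size : nodeCount u ≡ n
    size = trans (nodeCount≡length u) (trans (↭-length (complete⇒↭ uniq complete)) (length-tabulate (λ i → i)))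

  𝒰≅𝒯 : ∀ n k → k ≤ n → 𝒰 n k ≅ 𝒯 n k
  𝒰≅𝒯 n k k≤n = inverse-from-section (𝒰 n k) (𝒯 n k)
    (λ (u , isU) → ψ u , U→T k≤n u isU) (cong ψ)
    (λ { {u , _ , _ , _ , wu , _} {v , _ , _ , _ , wv , _} eq → ψ-injective u v wu wv eq })
    λ { (t , isT@((ne , _) , wf , _)) → let (u , wu , eq) = preimage t ne wf
          in (u , T→U u wu (subst (IsT n k) (sym eq) isT)) , eq }

-- Rational arithmetic: density, signs and linear dependence.

module Rationals where
  open import Data.Rational using (_+_; _*_; _-_; -_; _<_; _≤_)
  open import Data.Rational.Solver using (module +-*-Solver)

  p<p+1 : ∀ {p} → p < p + 1ℚ
  p<p+1 {p} = subst (_< p + 1ℚ) (ℚₚ.+-identityʳ p) (ℚₚ.+-monoʳ-< p (ℚₚ.positive⁻¹ 1ℚ))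

  +1-mono : ∀ {p q} → p < q → p + 1ℚ < q + 1ℚ
  +1-mono = ℚₚ.+-monoˡ-< 1ℚ

  -- Density leaves room below finitely many bounds that exceed `τ`; this later places a block
  -- before all pending events.
  between : ∀ {m} τ {P : Fin m → Set} → (∀ i → Dec (P i)) → (u : Fin m → ℚ) → (∀ i → P i → τ < u i) →
    ∃ λ y → τ < y × (∀ i → P i → y < u i)
  between {zero} τ P? u τ<u = τ + 1ℚ , p<p+1 , λ ()
  between {suc m} τ P? u τ<u with between τ (P? ∘ suc) (u ∘ suc) (τ<u ∘ suc) | P? zero
  ... | y , τ<y , y<u | no ¬p = y , τ<y , λ { zero p → ⊥-elim (¬p p) ; (suc i) → y<u i }
  ... | y , τ<y , y<u | yes p with ℚₚ.<-cmp y (u zero)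
  ...   | tri< y<u₀ _ _ = y , τ<y , λ { zero _ → y<u₀ ; (suc i) → y<u i }
  ...   | tri≈ _ y≡u₀ _ with ℚₚ.<-dense τ<y
  ...     | z , τ<z , z<y = z , τ<z ,
            λ { zero _ → subst (z <_) y≡u₀ z<y ; (suc i) q → ℚₚ.<-trans z<y (y<u i q) }
  between {suc m} τ P? u τ<u | y , τ<y , y<u | yes p | tri> _ _ u₀<y with ℚₚ.<-dense (τ<u zero p)
  ...     | z , τ<z , z<u₀ = z , τ<z ,
            λ { zero _ → z<u₀ ; (suc i) q → ℚₚ.<-trans z<u₀ (ℚₚ.<-trans u₀<y (y<u i q)) }

  SatSign-shift : ∀ s p q c → SatSign s (p - q) c → SatSign s p (q + c)
  SatSign-shift s p q c = go s
    where
    open +-*-Solver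
    e : q + (p - q) ≡ p
    e = solve 2 (λ p q → q :+ (p :- q) := p) refl p q
    go : ∀ s → SatSign s (p - q) c → SatSign s p (q + c)
    go Sign.lt h = subst (_< q + c) e (ℚₚ.+-monoʳ-< q h)
    go Sign.eq h = trans (sym e) (cong (q +_) h)
    go Sign.gt h = subst (q + c <_) e (ℚₚ.+-monoʳ-< q h)

  SatSign-unshift : ∀ s p q c → SatSign s p (q + c) → SatSign s (p - q) c
  SatSign-unshift s p q c = go s
    where
    open +-*-Solver
    e : - q + (q + c) ≡ c
    e = solve 2 (λ q c → :- q :+ (q :+ c) := c) refl q c
    e' : - q + p ≡ p - q
    e' = ℚₚ.+-comm (- q) p
    go : ∀ s → SatSign s p (q + c) → SatSign s (p - q) c
    go Sign.lt h = subst₂ _<_ e' e (ℚₚ.+-monoʳ-< (- q) h)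
    go Sign.eq h = trans (sym e') (trans (cong (- q +_) h) e)
    go Sign.gt h = subst₂ _<_ e e' (ℚₚ.+-monoʳ-< (- q) h)

  sign : ℚ → ℚ → Sign
  sign p q with ℚₚ.<-cmp p q
  ... | tri< _ _ _ = Sign.lt
  ... | tri≈ _ _ _ = Sign.eq
  ... | tri> _ _ _ = Sign.gt

  sign-sat : ∀ p q → SatSign (sign p q) p q
  sign-sat p q with ℚₚ.<-cmp p q
  ... | tri< h _ _ = h
  ... | tri≈ _ h _ = h
  ... | tri> _ _ h = h

  sat-unique : ∀ s s' {p q} → SatSign s p q → SatSign s' p q → s ≡ s'
  sat-unique Sign.lt Sign.lt _ _ = refl
  sat-unique Sign.eq Sign.eq _ _ = refl
  sat-unique Sign.gt Sign.gt _ _ = refl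
  sat-unique Sign.lt Sign.eq h h' = ⊥-elim (ℚₚ.<-irrefl h' h)
  sat-unique Sign.eq Sign.lt h h' = ⊥-elim (ℚₚ.<-irrefl h h')
  sat-unique Sign.gt Sign.eq h h' = ⊥-elim (ℚₚ.<-irrefl (sym h') h)
  sat-unique Sign.eq Sign.gt h h' = ⊥-elim (ℚₚ.<-irrefl (sym h) h')
  sat-unique Sign.lt Sign.gt h h' = ⊥-elim (ℚₚ.<-asym h h')
  sat-unique Sign.gt Sign.lt h h' = ⊥-elim (ℚₚ.<-asym h h')

  uniform-bound : ∀ {m} (P : Fin m → ℚ → Set) → (∀ i {ε ε'} → ε' ≤ ε → P i ε → P i ε') →
    (∀ i → ∃ λ ε → 0ℚ < ε × P i ε) → ∃ λ ε → 0ℚ < ε × (∀ i → P i ε)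
  uniform-bound {zero} P down bound = 1ℚ , ℚₚ.positive⁻¹ 1ℚ , λ ()
  uniform-bound {suc m} P down bound with bound zero | uniform-bound (P ∘ suc) (down ∘ suc) (bound ∘ suc)
  ... | ε , 0<ε , p | ε' , 0<ε' , p' with ℚₚ.≤-total ε ε'
  ...   | inj₁ ε≤ε' = ε , 0<ε , λ { zero → p ; (suc i) → down (suc i) ε≤ε' (p' i) }
  ...   | inj₂ ε'≤ε = ε' , 0<ε' , λ { zero → down zero ε'≤ε p ; (suc i) → p' i }

  sumF-cong : ∀ {d} {f g : Fin d → ℚ} → (∀ i → f i ≡ g i) → sumF f ≡ sumF g
  sumF-cong {zero} e = refl
  sumF-cong {suc d} e = cong₂ _+_ (e zero) (sumF-cong (e ∘ suc))

  sumF-zero : ∀ d → sumF {d} (λ _ → 0ℚ) ≡ 0ℚ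
  sumF-zero zero = refl
  sumF-zero (suc d) = trans (ℚₚ.+-identityˡ _) (sumF-zero d)

  sumF-+ : ∀ {d} (f g : Fin d → ℚ) → sumF (λ i → f i + g i) ≡ sumF f + sumF g
  sumF-+ {zero} f g = refl
  sumF-+ {suc d} f g rewrite sumF-+ (f ∘ suc) (g ∘ suc) =
    solve 4 (λ a b c d → (a :+ b) :+ (c :+ d) := (a :+ c) :+ (b :+ d)) refl
      (f zero) (g zero) (sumF (f ∘ suc)) (sumF (g ∘ suc))
    where open +-*-Solver

  sumF-* : ∀ {d} a (f : Fin d → ℚ) → sumF (λ i → a * f i) ≡ a * sumF f
  sumF-* {zero} a f = sym (ℚₚ.*-zeroʳ a)
  sumF-* {suc d} a f rewrite sumF-* a (f ∘ suc) = sym (ℚₚ.*-distribˡ-+ a _ _)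

  sumF-punchIn : ∀ {d} (i : Fin (suc d)) (f : Fin (suc d) → ℚ) → sumF f ≡ f i + sumF (f ∘ punchIn i)
  sumF-punchIn zero f = refl
  sumF-punchIn {suc d} (suc i) f rewrite sumF-punchIn i (f ∘ suc) =
    solve 3 (λ a b c → a :+ (b :+ c) := b :+ (a :+ c)) refl
      (f zero) (f (suc i)) (sumF (f ∘ suc ∘ punchIn i))
    where open +-*-Solver

  sumF-single : ∀ {d} (j : Fin d) (f : Fin d → ℚ) → (∀ i → i ≢ j → f i ≡ 0ℚ) → sumF f ≡ f j
  sumF-single {suc d} j f off = trans (sumF-punchIn j f) (trans (cong (f j +_)
    (trans (sumF-cong (λ i → off _ (Finₚ.punchInᵢ≢i j i))) (sumF-zero d))) (ℚₚ.+-identityʳ (f j)))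

  *≢0 : ∀ {a b} → a ≢ 0ℚ → b ≢ 0ℚ → a * b ≢ 0ℚ
  *≢0 {a} {b} a≢0 b≢0 ab≡0 = b≢0 (begin
    b                 ≡⟨ sym (ℚₚ.*-identityˡ b) ⟩
    1ℚ * b            ≡⟨ cong (_* b) (sym (ℚₚ.*-inverseˡ a)) ⟩
    (ℚ.1/ a) * a * b  ≡⟨ ℚₚ.*-assoc (ℚ.1/ a) a b ⟩
    (ℚ.1/ a) * (a * b) ≡⟨ cong ((ℚ.1/ a) *_) ab≡0 ⟩
    (ℚ.1/ a) * 0ℚ     ≡⟨ ℚₚ.*-zeroʳ (ℚ.1/ a) ⟩
    0ℚ                ∎)
    where
    open ≡-Reasoning
    instance
      nz : ℚ.NonZero a
      nz = ℚ.≢-nonZero a≢0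

  -- Elimination without division. If some vector has a nonzero coordinate zero `a`, the
  -- combinations of `a` times another vector minus a multiple of the pivot vector vanish there, and
  -- a dependence among them lifts.
  linearly-dependent : ∀ k (v : Fin (suc k) → Fin k → ℚ) →
    ∃ λ (c : Fin (suc k) → ℚ) → (∃ λ i → c i ≢ 0ℚ) × (∀ j → sumF (λ i → c i * v i j) ≡ 0ℚ)
  linearly-dependent zero v = (λ _ → 1ℚ) , (zero , λ ()) , λ ()
  linearly-dependent (suc k) v with Finₚ.any? (λ i → ¬? (v i zero ℚₚ.≟ 0ℚ))
  ... | no none = c , (suc i , ci≢0) , vanish
    where
    ih = linearly-dependent k (λ i j → v (suc i) (suc j))
    c : Fin (suc (suc k)) → ℚ
    -- Coordinate zero vanishes on all vectors, so one vector can be spared along with it.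
    c zero = 0ℚ
    c (suc i) = proj₁ ih i
    i = proj₁ (proj₁ (proj₂ ih))
    ci≢0 = proj₂ (proj₁ (proj₂ ih))
    v≡0 : ∀ i → v i zero ≡ 0ℚ
    v≡0 i with v i zero ℚₚ.≟ 0ℚ
    ... | yes e = e
    ... | no ¬e = ⊥-elim (none (i , ¬e))
    vanish : ∀ j → sumF (λ i → c i * v i j) ≡ 0ℚ
    vanish zero = trans (sumF-cong (λ i → trans (cong (c i *_) (v≡0 i)) (ℚₚ.*-zeroʳ (c i)))) (sumF-zero (suc (suc k)))
    vanish (suc j) = trans (cong (_+ sumF (λ i → proj₁ ih i * v (suc i) (suc j))) (ℚₚ.*-zeroˡ (v zero (suc j))))
      (trans (ℚₚ.+-identityˡ _) (proj₂ (proj₂ ih) j))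
  ... | yes (i₀ , a≢0) = c , (punchIn i₀ i , c≢0) , vanish
    where
    a = v i₀ zero
    u : Fin (suc k) → Fin (suc k) → ℚ
    u i j = v (punchIn i₀ i) j
    ih = linearly-dependent k (λ i j → a * u i (suc j) - u i zero * v i₀ (suc j))
    b = proj₁ ih
    i = proj₁ (proj₁ (proj₂ ih))
    bi≢0 = proj₂ (proj₁ (proj₂ ih))
    -- The pivot's coefficient collects the multiples of the pivot vector that elimination
    -- subtracted; the other coefficients are those of the induction hypothesis times `a`, hence not
    -- all zero.
    c₀ : ℚ
    c₀ = - sumF (λ i → b i * u i zero)
    c : Fin (suc (suc k)) → ℚ
    c j with i₀ Finₚ.≟ j
    ... | yes _ = c₀
    ... | no i₀≢j = a * b (punchOut i₀≢j)
    c-pivot : c i₀ ≡ c₀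
    c-pivot with i₀ Finₚ.≟ i₀
    ... | yes _ = refl
    ... | no ne = ⊥-elim (ne refl)
    c-other : ∀ i → c (punchIn i₀ i) ≡ a * b i
    c-other i with i₀ Finₚ.≟ punchIn i₀ i
    ... | yes e = ⊥-elim (Finₚ.punchInᵢ≢i i₀ i (sym e))
    ... | no ne = cong (λ i → a * b i) (trans (Finₚ.punchOut-cong i₀ refl) (Finₚ.punchOut-punchIn i₀))
    c≢0 : c (punchIn i₀ i) ≢ 0ℚ
    c≢0 e = *≢0 a≢0 bi≢0 (trans (sym (c-other i)) e)
    split : ∀ j → sumF (λ i → c i * v i j) ≡ c₀ * v i₀ j + a * sumF (λ i → b i * u i j)
    split j = trans (sumF-punchIn i₀ (λ i → c i * v i j)) (cong₂ _+_ (cong (_* v i₀ j) c-pivot)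
      (trans (sumF-cong (λ i → trans (cong (_* u i j) (c-other i)) (ℚₚ.*-assoc a (b i) (u i j)))) (sumF-* a (λ i → b i * u i j))))
    vanish : ∀ j → sumF (λ i → c i * v i j) ≡ 0ℚ
    vanish zero = trans (split zero)
      (solve 2 (λ s a → (:- s) :* a :+ a :* s := con 0ℚ) refl (sumF (λ i → b i * u i zero)) a)
      where open +-*-Solver
    vanish (suc j) = trans (split (suc j)) (trans (sym expand) (proj₂ (proj₂ ih) j))
      where
      w = v i₀ (suc j)
      open +-*-Solver
      expand : sumF (λ i → b i * (a * u i (suc j) - u i zero * w)) ≡ c₀ * w + a * sumF (λ i → b i * u i (suc j))
      expand = begin
        sumF (λ i → b i * (a * u i (suc j) - u i zero * w))
          ≡⟨ sumF-cong (λ i → solve 5 (λ b a x y w → b :* (a :* x :- y :* w) := (:- w) :* (b :* y) :+ a :* (b :* x)) refl (b i) a (u i (suc j)) (u i zero) w) ⟩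
        sumF (λ i → (- w) * (b i * u i zero) + a * (b i * u i (suc j)))
          ≡⟨ sumF-+ (λ i → (- w) * (b i * u i zero)) (λ i → a * (b i * u i (suc j))) ⟩
        sumF (λ i → (- w) * (b i * u i zero)) + sumF (λ i → a * (b i * u i (suc j)))
          ≡⟨ cong₂ _+_ (sumF-* (- w) (λ i → b i * u i zero)) (sumF-* a (λ i → b i * u i (suc j))) ⟩
        (- w) * sumF (λ i → b i * u i zero) + a * sumF (λ i → b i * u i (suc j))
          ≡⟨ cong (_+ a * sumF (λ i → b i * u i (suc j))) (solve 2 (λ w s → (:- w) :* s := (:- s) :* w) refl w (sumF (λ i → b i * u i zero))) ⟩
        c₀ * w + a * sumF (λ i → b i * u i (suc j)) ∎
        where open ≡-Reasoning

-- Affine dimension of a face.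

module Dimension where
  open Rationals
  open import Data.Rational using (_+_; _*_; _-_; -_; _<_; _≤_)
  open import Data.Rational.Solver using (module +-*-Solver)

  -- Point zero is the base of all differences and has to stay, so the point after it is dropped; a
  -- relation among the rest extends by the coefficient `0ℚ`.
  independent-tail : ∀ {n d} (p : Fin (suc (suc d)) → Point n) → AffinelyIndependent {n} {suc d} p →
    AffinelyIndependent {n} {d} (λ i → p (Fin.punchIn (suc zero) i))
  independent-tail {n} {d} p ind c vanish i = ind c' vanish' (suc i)
    where
    c' : Fin (suc d) → ℚ
    c' zero = 0ℚ
    c' (suc i) = c i
    vanish' : ∀ t → sumF (λ i → c' i * (p (suc i) t - p zero t)) ≡ 0ℚ
    vanish' t = trans (cong₂ _+_ (ℚₚ.*-zeroˡ (p (suc zero) t - p zero t)) (vanish t)) refl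

  AffineDim-≤ : ∀ {n} {S : Point n → Set} {d k} → (∃ λ p → (∀ i → S (p i)) × AffinelyIndependent {n} {d} p) →
    ¬ (∃ λ p → (∀ i → S (p i)) × AffinelyIndependent {n} {suc k} p) → d ℕ.≤ k
  AffineDim-≤ {n} {S} {d} {k} (p , p∈S , ind) none with d ℕₚ.≤? k
  ... | yes d≤k = d≤k
  ... | no d≰k = ⊥-elim (none (shrink (ℕₚ.≤⇒≤′ (ℕₚ.≰⇒> d≰k)) p p∈S ind))
    where
    shrink : ∀ {d} → suc k ℕ.≤′ d → (p : Fin (suc d) → Point n) → (∀ i → S (p i)) → AffinelyIndependent {n} {d} p →
      ∃ λ p → (∀ i → S (p i)) × AffinelyIndependent {n} {suc k} p
    shrink ℕ.≤′-refl p p∈S ind = p , p∈S , ind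
    shrink (ℕ.≤′-step le) p p∈S ind = shrink le _ (λ i → p∈S (Fin.punchIn (suc zero) i)) (independent-tail p ind)

  AffineDim-unique : ∀ {n} {S : Point n → Set} {k k'} → AffineDim S k → AffineDim S k' → k ≡ k'
  AffineDim-unique {n} {S} (pts , none) (pts' , none') =
    ℕₚ.≤-antisym (AffineDim-≤ {n} {S} pts none') (AffineDim-≤ {n} {S} pts' none)

  -- Strict conditions survive a change of the difference by at most `ε`. Equalities are excluded
  -- because they tolerate no change.
  SlackAt : ∀ {n} → SignVector n → Point n → ℚ → Fin n → Fin n → Fin 2 → Set
  SlackAt σ x ε i j c = i Fin.< j → σ i j c ≢ Sign.eq → ∀ e → - ε ≤ e → e ≤ ε → SatSign (σ i j c) ((x i - x j) + e) (const c)

  slack-down : ∀ {n} {σ : SignVector n} {x ε ε'} i j c → ε' ≤ ε → SlackAt σ x ε i j c → SlackAt σ x ε' i j c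
  slack-down i j c ε'≤ε h i<j ne e lo hi =
    h i<j ne e (ℚₚ.≤-trans (ℚₚ.neg-antimono-≤ ε'≤ε) lo) (ℚₚ.≤-trans hi ε'≤ε)

  slack-at : ∀ {n} (σ : SignVector n) x → InFace σ x → ∀ i j c → ∃ λ ε → 0ℚ < ε × SlackAt σ x ε i j c
  slack-at σ x x∈σ i j c with i Finₚ.<? j
  ... | no i≮j = 1ℚ , ℚₚ.positive⁻¹ 1ℚ , λ i<j → ⊥-elim (i≮j i<j)
  ... | yes i<j with σ i j c | x∈σ i j i<j c
  ...   | Sign.eq | _ = 1ℚ , ℚₚ.positive⁻¹ 1ℚ , λ _ ne → ⊥-elim (ne refl)
  ...   | Sign.lt | h with ℚₚ.<-dense (gap h)
    where
    gap : x i - x j < const c → 0ℚ < const c - (x i - x j)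
    gap h = subst (_< const c - (x i - x j)) (ℚₚ.+-inverseʳ (x i - x j)) (ℚₚ.+-monoˡ-< (- (x i - x j)) h)
  ...     | ε , 0<ε , ε<gap = ε , 0<ε , λ _ _ e _ e≤ε →
    subst ((x i - x j) + e <_) (solve 2 (λ p c → p :+ (c :- p) := c) refl (x i - x j) (const c))
      (ℚₚ.+-monoʳ-< (x i - x j) (ℚₚ.≤-<-trans e≤ε ε<gap))
    where open +-*-Solver
  slack-at σ x x∈σ i j c | yes i<j | Sign.gt | h with ℚₚ.<-dense (gap h)
    where
    gap : const c < x i - x j → 0ℚ < (x i - x j) - const c
    gap h = subst (_< (x i - x j) - const c) (ℚₚ.+-inverseʳ (const c)) (ℚₚ.+-monoˡ-< (- const c) h)
  ...     | ε , 0<ε , ε<gap = ε , 0<ε , λ _ _ e -ε≤e _ →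
    subst (_< (x i - x j) + e) (solve 2 (λ p c → p :+ (:- (p :- c)) := c) refl (x i - x j) (const c))
      (ℚₚ.+-monoʳ-< (x i - x j) (ℚₚ.<-≤-trans (ℚₚ.neg-antimono-< ε<gap) -ε≤e))
    where open +-*-Solver

  slack : ∀ {n} (σ : SignVector n) x → InFace σ x → ∃ λ ε → 0ℚ < ε × (∀ i j c → SlackAt σ x ε i j c)
  slack σ x x∈σ =
    uniform-bound (λ i ε → ∀ j c → SlackAt σ x ε i j c) (λ i le h j c → slack-down {σ = σ} {x} i j c le (h j c)) λ i →
    uniform-bound (λ j ε → ∀ c → SlackAt σ x ε i j c) (λ j le h c → slack-down {σ = σ} {x} i j c le (h c)) λ j →
    uniform-bound (λ c ε → SlackAt σ x ε i j c) (λ c le h → slack-down {σ = σ} {x} i j c le h) λ c →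
    slack-at σ x x∈σ i j c

  -- A criterion for dimension `k` by a partition into `k` classes. Equalities stay inside classes,
  -- so each class can be shifted alone by a small `ε`, which gives `k` independent directions. By
  -- `rigid`, a difference of two points of the face is determined by its values at the `k`
  -- representatives, so `suc k` differences are dependent.
  module FaceDimension {n k} (σ : SignVector n) (x : Point n) (x∈σ : InFace σ x)
    (cls : Fin n → Fin k) (rep : Fin k → Fin n) (cls-rep : ∀ j → cls (rep j) ≡ j)
    (equal⇒cls : ∀ i j c → i Fin.< j → σ i j c ≡ Sign.eq → cls i ≡ cls j)
    (rigid : ∀ y y' → InFace σ y → InFace σ y' → ∀ i j → cls i ≡ cls j → y i - y' i ≡ y j - y' j) where

    private
      ε : ℚ
      ε = proj₁ (slack σ x x∈σ)
      0<ε : 0ℚ < ε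
      0<ε = proj₁ (proj₂ (slack σ x x∈σ))
      room = proj₂ (proj₂ (slack σ x x∈σ))

      bump : Fin k → Fin k → ℚ
      bump j c with j Finₚ.≟ c
      ... | yes _ = ε
      ... | no _ = 0ℚ

      bump-self : ∀ j → bump j j ≡ ε
      bump-self j with j Finₚ.≟ j
      ... | yes _ = refl
      ... | no ne = ⊥-elim (ne refl)

      bump-other : ∀ {j c} → j ≢ c → bump j c ≡ 0ℚ
      bump-other {j} {c} ne with j Finₚ.≟ c
      ... | yes e = ⊥-elim (ne e)
      ... | no _ = refl

      0≤bump : ∀ j c → 0ℚ ≤ bump j c
      0≤bump j c with j Finₚ.≟ c
      ... | yes _ = ℚₚ.<⇒≤ 0<ε
      ... | no _ = ℚₚ.≤-refl

      bump≤ε : ∀ j c → bump j c ≤ ε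
      bump≤ε j c with j Finₚ.≟ c
      ... | yes _ = ℚₚ.≤-refl
      ... | no _ = ℚₚ.<⇒≤ 0<ε

      points : Fin (suc k) → Point n
      points zero = x
      points (suc j) i = x i + bump j (cls i)

      isEq? : ∀ s → Dec (s ≡ Sign.eq)
      isEq? Sign.lt = no λ ()
      isEq? Sign.eq = yes refl
      isEq? Sign.gt = no λ ()

      points∈σ : ∀ m → InFace σ (points m)
      points∈σ zero = x∈σ
      points∈σ (suc m) i j i<j c =
        subst (λ q → SatSign (σ i j c) q (const c)) (sym (rearrange (x i) (x j) u v)) shifted
        where
        open +-*-Solver
        u = bump m (cls i)
        v = bump m (cls j)
        rearrange : ∀ p q u v → (p + u) - (q + v) ≡ (p - q) + (u - v)
        rearrange = solve 4 (λ p q u v → (p :+ u) :- (q :+ v) := (p :- q) :+ (u :- v)) refl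
        lower : - ε ≤ u - v
        lower = subst (_≤ u - v) (ℚₚ.+-identityˡ (- ε))
          (ℚₚ.+-mono-≤ (0≤bump m (cls i)) (ℚₚ.neg-antimono-≤ (bump≤ε m (cls j))))
        upper : u - v ≤ ε
        upper = subst (u - v ≤_) (ℚₚ.+-identityʳ ε)
          (ℚₚ.+-mono-≤ (bump≤ε m (cls i)) (ℚₚ.neg-antimono-≤ (0≤bump m (cls j))))
        -- Both ends of an equality move together; a strict condition absorbs `u - v`, which lies
        -- between `- ε` and `ε`.
        shifted : SatSign (σ i j c) ((x i - x j) + (u - v)) (const c)
        shifted with isEq? (σ i j c)
        ... | no ne = room i j c i<j ne (u - v) lower upper
        ... | yes e = subst (λ q → SatSign (σ i j c) q (const c)) (sym unmoved) (x∈σ i j i<j c)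
          where
          unmoved : (x i - x j) + (u - v) ≡ x i - x j
          unmoved = trans (cong (λ d → (x i - x j) + (bump m d - v)) (equal⇒cls i j c i<j e))
            (trans (cong ((x i - x j) +_) (ℚₚ.+-inverseʳ v)) (ℚₚ.+-identityʳ (x i - x j)))

      independent : AffinelyIndependent {n} {k} points
      independent c vanish j with c j ℚₚ.≟ 0ℚ
      ... | yes e = e
      ... | no ne = ⊥-elim (*≢0 ne (λ e → ℚₚ.<-irrefl (sym e) 0<ε) (trans (sym at-j) (vanish (rep j))))
        where
        open +-*-Solver
        diff : ∀ m t → points (suc m) t - points zero t ≡ bump m (cls t)
        diff m t = solve 2 (λ p q → (p :+ q) :- p := q) refl (x t) (bump m (cls t))
        term : Fin k → ℚ
        term i = c i * (points (suc i) (rep j) - points zero (rep j))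
        term≡ : ∀ i → term i ≡ c i * bump i j
        term≡ i = cong (c i *_) (trans (diff i (rep j)) (cong (bump i) (cls-rep j)))
        at-j : sumF term ≡ c j * ε
        at-j = trans (sumF-single j term (λ i i≢j → trans (term≡ i)
                 (trans (cong (c i *_) (bump-other i≢j)) (ℚₚ.*-zeroʳ (c i)))))
               (trans (term≡ j) (cong (c j *_) (bump-self j)))

      dependent : ¬ (∃ λ p → (∀ i → InFace σ (p i)) × AffinelyIndependent {n} {suc k} p)
      dependent (p , p∈σ , ind) with linearly-dependent k (λ i j → p (suc i) (rep j) - p zero (rep j))
      ... | c , (i , ci≢0) , vanish = ci≢0 (ind c (λ t → trans
        (sumF-cong (λ i → cong (c i *_) (rigid (p (suc i)) (p zero) (p∈σ (suc i)) (p∈σ zero) t (rep (cls t)) (sym (cls-rep (cls t))))))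
        (vanish (cls t))) i)

    dimension : AffineDim (InFace σ) k
    dimension = (points , points∈σ , independent) , dependent

-- Runs: compatibility of a tree with a point, transfer and uniqueness.

module Runs where
  open Rationals
  open import Data.Fin.Subset using (_∈_)
  open import Data.Fin.Subset.Properties using (_∈?_; ⊆-antisym)
  open import Data.List.Properties using (∷-injective; ∷ʳ-injective; map-++)
  open import Data.Rational using (_+_; _-_; _<_; _≤_)

  Entry : ℕ → Set
  Entry n = Subset n × Bool × DTree n

  Queue : ℕ → Set
  Queue n = List (Entry n)

  InTree : ∀ {n} → Fin n → DTree n → Set
  InTree i leaf = ⊥
  InTree i (node A l d r) = i ∈ A ⊎ InTree i l ⊎ InTree i r

  Behind : ∀ {n} → Fin n → Entry n → Set
  Behind i (A , d , r) = InTree i r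

  -- The indices still to be read: besides the current tree, the right subtrees held back by the
  -- queue.
  Rem : ∀ {n} → DTree n → Queue n → Fin n → Set
  Rem t Q i = InTree i t ⊎ Any (Behind i) Q

  Waiting : ∀ {n} → Fin n → Queue n → Set
  Waiting a = Any (λ e → a ∈ proj₁ e)

  -- Nonempty only for the root block at a dashed edge, the block that sits exactly at the value
  -- just passed.
  Captive : ∀ {n} → Bool → DTree n → Fin n → Set
  Captive false t i = ⊥
  Captive true leaf i = ⊥
  Captive true (node B _ _ _) i = i ∈ B

  captive? : ∀ {n} d (t : DTree n) i → Dec (Captive d t i)
  captive? false t i = no id
  captive? true leaf i = no id
  captive? true (node B _ _ _) i = i ∈? B

  module _ {n} {B : Subset n} {l : DTree n} {d : Bool} {r : DTree n} {Q : Queue n} where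
    rem-open⁻ : ∀ {i} → Rem (node B l d r) Q i → i ∈ B ⊎ Rem l (Q ∷ʳ (B , d , r)) i
    rem-open⁻ (inj₁ (inj₁ p)) = inj₁ p
    rem-open⁻ (inj₁ (inj₂ (inj₁ p))) = inj₂ (inj₁ p)
    rem-open⁻ (inj₁ (inj₂ (inj₂ p))) = inj₂ (inj₂ (Anyₚ.++⁺ʳ Q (here p)))
    rem-open⁻ (inj₂ p) = inj₂ (inj₂ (Anyₚ.++⁺ˡ p))

    rem-open⁺ : ∀ {i} → Rem l (Q ∷ʳ (B , d , r)) i → Rem (node B l d r) Q i
    rem-open⁺ (inj₁ p) = inj₁ (inj₂ (inj₁ p))
    rem-open⁺ (inj₂ p) with Anyₚ.++⁻ Q p
    ... | inj₁ q = inj₂ q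
    ... | inj₂ (here q) = inj₁ (inj₂ (inj₂ q))

  module _ {n} {A : Subset n} {d : Bool} {r : DTree n} {Q : Queue n} where
    rem-close⁻ : ∀ {i} → Rem leaf ((A , d , r) ∷ Q) i → Rem r Q i
    rem-close⁻ (inj₂ (here p)) = inj₁ p
    rem-close⁻ (inj₂ (there p)) = inj₂ p

    rem-close⁺ : ∀ {i} → Rem r Q i → Rem leaf ((A , d , r) ∷ Q) i
    rem-close⁺ (inj₁ p) = inj₂ (here p)
    rem-close⁺ (inj₂ p) = inj₂ (there p)

  ¬captive-leaf : ∀ {n} d {i : Fin n} → ¬ Captive d leaf i
  ¬captive-leaf true ()
  ¬captive-leaf false ()

  -- A run reads the values x b and x a + 1 in increasing order: the root of the current
  -- tree is the next block to appear, and the queue holds the blocks A whose value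
  -- x a + 1 has not been passed; the right subtree of A starts right after x a + 1 (at
  -- x a + 1 if the edge is dashed).  Of the comparisons of x b with x a + 1 only those
  -- with b < a, which the Shi arrangement sees, are imposed.
  data Run {n} (x : Point n) : DTree n → Queue n → Set where
    done : Run x leaf []
    close : ∀ {A d r Q} →
      (∀ {a b} → a ∈ A → Captive d r b → b Fin.< a → x b ≡ x a + 1ℚ) →
      (∀ {a b} → a ∈ A → Rem r Q b → ¬ Captive d r b → b Fin.< a → x a + 1ℚ < x b) →
      Run x r Q → Run x leaf ((A , d , r) ∷ Q)
    start : ∀ {B l d r Q} →
      (∀ {b b'} → b ∈ B → b' ∈ B → x b ≡ x b') →
      (∀ {b c} → b ∈ B → Rem l (Q ∷ʳ (B , d , r)) c → x b < x c) →
      (∀ {a b} → Waiting a Q → b ∈ B → b Fin.< a → x b < x a + 1ℚ) →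
      Run x l (Q ∷ʳ (B , d , r)) → Run x (node B l d r) Q

  record Same {n} (x y : Point n) : Set where
    field
      order : ∀ i j s → SatSign s (x i) (x j) → SatSign s (y i) (y j)
      unit : ∀ b a → b Fin.< a → ∀ s → SatSign s (x b) (x a + 1ℚ) → SatSign s (y b) (y a + 1ℚ)

  flip : Sign → Sign
  flip Sign.lt = Sign.gt
  flip Sign.eq = Sign.eq
  flip Sign.gt = Sign.lt

  flip-sat : ∀ s {p q} → SatSign s p q → SatSign (flip s) q p
  flip-sat Sign.lt h = h
  flip-sat Sign.eq h = sym h
  flip-sat Sign.gt h = h

  flip-sat⁻ : ∀ s {p q} → SatSign (flip s) q p → SatSign s p q
  flip-sat⁻ Sign.lt h = h
  flip-sat⁻ Sign.eq h = sym h
  flip-sat⁻ Sign.gt h = h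

  ≡⇒<+1 : ∀ {p q} → p ≡ q → p < q + 1ℚ
  ≡⇒<+1 refl = p<p+1

  -- By trichotomy one sign known to hold for both pairs settles all signs.
  agree : ∀ s {p q p' q'} → SatSign s p q → SatSign s p' q' → ∀ s' → SatSign s' p q → SatSign s' p' q'
  agree s h h' s' k with refl ← sat-unique s s' h k = h'

  same-face : ∀ {n} {σ : SignVector n} {x y} → InFace σ x → InFace σ y → Same x y
  same-face {n} {σ} {x} {y} x∈σ y∈σ = record { order = order ; unit = unit }
    where
    shifted : ∀ i j → i Fin.< j → ∀ c s → SatSign s (x i) (x j + const c) → SatSign s (y i) (y j + const c)
    shifted i j i<j c = agree (σ i j c)
      (SatSign-shift (σ i j c) (x i) (x j) (const c) (x∈σ i j i<j c))
      (SatSign-shift (σ i j c) (y i) (y j) (const c) (y∈σ i j i<j c))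
    plain : ∀ i j → i Fin.< j → ∀ s → SatSign s (x i) (x j) → SatSign s (y i) (y j)
    plain i j i<j s = subst₂ (λ p q → SatSign s (x i) p → SatSign s (y i) q)
      (ℚₚ.+-identityʳ (x j)) (ℚₚ.+-identityʳ (y j)) (shifted i j i<j zero s)
    order : ∀ i j s → SatSign s (x i) (x j) → SatSign s (y i) (y j)
    order i j s h with Finₚ.<-cmp i j
    ... | tri< i<j _ _ = plain i j i<j s h
    ... | tri> _ _ j<i = flip-sat⁻ s (plain j i j<i (flip s) (flip-sat s h))
    ... | tri≈ _ refl _ = agree Sign.eq {x i} refl refl s h
    unit : ∀ b a → b Fin.< a → ∀ s → SatSign s (x b) (x a + 1ℚ) → SatSign s (y b) (y a + 1ℚ)
    unit b a b<a s = shifted b a b<a (suc zero) s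

  module _ {n} {x y : Point n} (S : Same x y) where
    open Same S

    -- A run consists of comparisons of coordinates and of visible unit comparisons, all of which
    -- `Same` preserves; hence it belongs to the face and not to the point.
    run-transfer : ∀ {t Q} → Run x t Q → Run y t Q
    run-transfer done = done
    run-transfer (close eqs gts run) = close
      (λ {a} {b} a∈A cap b<a → unit b a b<a Sign.eq (eqs a∈A cap b<a))
      (λ {a} {b} a∈A rem ncap b<a → unit b a b<a Sign.gt (gts a∈A rem ncap b<a))
      (run-transfer run)
    run-transfer (start eqs lts uns run) = start
      (λ {b} {b'} b∈B b'∈B → order b b' Sign.eq (eqs b∈B b'∈B))
      (λ {b} {c} b∈B rem → order b c Sign.lt (lts b∈B rem))
      (λ {a} {b} w b∈B b<a → unit b a b<a Sign.lt (uns w b∈B b<a))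
      (run-transfer run)

  module _ {n} {x y : Point n} where
    -- Whichever comes first, the start of the block of `b` or the closing of the block of `a`,
    -- records the sign of `x b` against `x a + 1ℚ`.
    agree-waiting : ∀ {t Q} → Run x t Q → Run y t Q → ∀ {a b} → Waiting a Q → Rem t Q b → b Fin.< a →
      ∀ s → SatSign s (x b) (x a + 1ℚ) → SatSign s (y b) (y a + 1ℚ)
    agree-waiting (close {d = d} {r} eqs gts run) (close eqs' gts' run') {a} {b} (here a∈A) rem b<a with captive? d r b
    ... | yes cap = agree Sign.eq (eqs a∈A cap b<a) (eqs' a∈A cap b<a)
    ... | no ncap = agree Sign.gt (gts a∈A (rem-close⁻ rem) ncap b<a) (gts' a∈A (rem-close⁻ rem) ncap b<a)
    agree-waiting (close _ _ run) (close _ _ run') (there w) rem b<a = agree-waiting run run' w (rem-close⁻ rem) b<a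
    agree-waiting (start _ _ uns run) (start _ _ uns' run') w rem b<a with rem-open⁻ rem
    ... | inj₁ b∈B = agree Sign.lt (uns w b∈B b<a) (uns' w b∈B b<a)
    ... | inj₂ rem' = agree-waiting run run' (Anyₚ.++⁺ˡ w) rem' b<a

    agree-order : ∀ {t Q} → Run x t Q → Run y t Q → ∀ {i j} → Rem t Q i → Rem t Q j →
      ∀ s → SatSign s (x i) (x j) → SatSign s (y i) (y j)
    agree-order done _ (inj₂ ())
    agree-order (close _ _ run) (close _ _ run') ri rj = agree-order run run' (rem-close⁻ ri) (rem-close⁻ rj)
    agree-order (start eqs lts _ run) (start eqs' lts' _ run') ri rj with rem-open⁻ ri | rem-open⁻ rj
    ... | inj₁ i∈B | inj₁ j∈B = agree Sign.eq (eqs i∈B j∈B) (eqs' i∈B j∈B)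
    ... | inj₁ i∈B | inj₂ rj' = agree Sign.lt (lts i∈B rj') (lts' i∈B rj')
    ... | inj₂ ri' | inj₁ j∈B = agree Sign.gt (lts j∈B ri') (lts' j∈B ri')
    ... | inj₂ ri' | inj₂ rj' = agree-order run run' ri' rj'

    -- If `b` is read no later than `a`, then `x b < x a + 1ℚ` holds anyway; otherwise `a` is
    -- waiting when `b` is read, and `agree-waiting` applies.
    agree-unit : ∀ {t Q} → Run x t Q → Run y t Q → ∀ {b a} → Rem t Q b → Rem t Q a → b Fin.< a →
      ∀ s → SatSign s (x b) (x a + 1ℚ) → SatSign s (y b) (y a + 1ℚ)
    agree-unit done _ (inj₂ ())
    agree-unit (close _ _ run) (close _ _ run') rb ra = agree-unit run run' (rem-close⁻ rb) (rem-close⁻ ra)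
    agree-unit (start {Q = Q} eqs lts _ run) (start eqs' lts' _ run') rb ra b<a with rem-open⁻ rb | rem-open⁻ ra
    ... | inj₁ b∈B | inj₁ a∈B = agree Sign.lt (≡⇒<+1 (eqs b∈B a∈B)) (≡⇒<+1 (eqs' b∈B a∈B))
    ... | inj₁ b∈B | inj₂ ra' = agree Sign.lt (ℚₚ.<-trans (lts b∈B ra') p<p+1) (ℚₚ.<-trans (lts' b∈B ra') p<p+1)
    ... | inj₂ rb' | inj₁ a∈B = agree-waiting run run' (Anyₚ.++⁺ʳ Q (here a∈B)) rb' b<a
    ... | inj₂ rb' | inj₂ ra' = agree-unit run run' rb' ra' b<a

    run-determines-signs : ∀ {t} → Run x t [] → Run y t [] → (∀ i → InTree i t) →
      ∀ i j → i Fin.< j → ∀ c s → SatSign s (x i - x j) (const c) → SatSign s (y i - y j) (const c)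
    run-determines-signs run run' all i j i<j zero s h = SatSign-unshift s (y i) (y j) 0ℚ
      (subst (SatSign s (y i)) (sym (ℚₚ.+-identityʳ (y j)))
        (agree-order run run' (inj₁ (all i)) (inj₁ (all j)) s
          (subst (SatSign s (x i)) (ℚₚ.+-identityʳ (x j)) (SatSign-shift s (x i) (x j) 0ℚ h))))
    run-determines-signs run run' all i j i<j (suc zero) s h = SatSign-unshift s (y i) (y j) 1ℚ
      (agree-unit run run' (inj₁ (all i)) (inj₁ (all j)) i<j s (SatSign-shift s (x i) (x j) 1ℚ h))

  Good : ∀ {n} → DTree n → Set
  Good leaf = ⊤
  Good (node A l d r) = Nonempty A × RightEdgeOK A d r × Good l × Good r

  GoodEntry : ∀ {n} → Entry n → Set
  GoodEntry (A , d , r) = RightEdgeOK A d r × Good r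

  -- Closings are never premature. The next nonempty right subtree hangs by a descent, whose pair is
  -- a visible comparison: the next block lies at or after `x a + 1ℚ`. Closings with an empty right
  -- subtree are passed over until that one.
  blocked : ∀ {n} {x : Point n} {Q} → Run x leaf Q → All GoodEntry Q → ∀ {c} → Rem leaf Q c →
    ∃ λ a → ∃ λ b → Waiting a Q × Rem leaf Q b × (∀ {c} → Rem leaf Q c → x b ≤ x c) × b Fin.< a × x a + 1ℚ ≤ x b
  blocked done _ (inj₂ ())
  blocked (close {r = leaf} _ _ run) (_ ∷ good) rem with blocked run good (rem-close⁻ rem)
  ... | a , b , w , rb , min , b<a , le = a , b , there w , rem-close⁺ rb , min ∘ rem-close⁻ , b<a , le
  blocked {x = x} (close {A} {d} {r = node B _ _ _} {Q} eqs gts (start eqs' lts _ _)) (((a , b , a∈A , b∈B , b<a) , _) ∷ _) _ =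
    a , b , here a∈A , rem-close⁺ {A = A} {d} {Q = Q} (inj₁ (inj₁ b∈B)) , min , b<a , le
    where
    min : ∀ {c} → Rem leaf ((A , d , _) ∷ Q) c → x b ≤ x c
    min rem with rem-open⁻ (rem-close⁻ rem)
    ... | inj₁ c∈B = ℚₚ.≤-reflexive (eqs' b∈B c∈B)
    ... | inj₂ rem' = ℚₚ.<⇒≤ (lts b∈B rem')
    le : x a + 1ℚ ≤ x b
    le with captive? d (node B _ _ _) b
    ... | yes cap = ℚₚ.≤-reflexive (sym (eqs a∈A cap b<a))
    ... | no ncap = ℚₚ.<⇒≤ (gts a∈A (inj₁ (inj₁ b∈B)) ncap b<a)

  waiting-resp : ∀ {n} {Q Q' : Queue n} → map proj₁ Q ≡ map proj₁ Q' → ∀ {a} → Waiting a Q → Waiting a Q'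
  waiting-resp e w = Anyₚ.map⁻ (subst (Any (_ ∈_)) e (Anyₚ.map⁺ w))

  module _ {n} {x y : Point n} (yx : Same y x) where
    open Same yx

    -- Both runs start with the minimal block of the same set. An element of `B` read later in the
    -- second run would lie above `b'` for `y`, hence for `x`, against its minimality.
    block-⊆ : ∀ {B l d r Q B' l' d' r' Q'} → Run x (node B l d r) Q → Run y (node B' l' d' r') Q' →
      (∀ {i} → Rem (node B l d r) Q i → Rem (node B' l' d' r') Q' i) →
      (∀ {i} → Rem (node B' l' d' r') Q' i → Rem (node B l d r) Q i) → Nonempty B' → ∀ {b} → b ∈ B → b ∈ B'
    block-⊆ (start eqs lts _ _) (start _ lts' _ _) to from (b' , b'∈B') {b} b∈B with rem-open⁻ (to (inj₁ (inj₁ b∈B)))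
    ... | inj₁ b∈B' = b∈B'
    ... | inj₂ rem with rem-open⁻ (from (inj₁ (inj₁ b'∈B')))
    ...   | inj₁ b'∈B = ⊥-elim (ℚₚ.<-irrefl (eqs b'∈B b∈B) (order b' b Sign.lt (lts' b'∈B' rem)))
    ...   | inj₂ rem' = ⊥-elim (ℚₚ.<-asym (lts b∈B rem') (order b' b Sign.lt (lts' b'∈B' rem)))

    -- The pair from `blocked` has `b` of minimal value, so `b` lies in the block the other run
    -- starts; but starting it asserts `x b < x a + 1ℚ` for the same waiting `a`.
    ¬close-start : ∀ {Q B l d r Q'} → Run x leaf Q → All GoodEntry Q → Run y (node B l d r) Q' →
      Nonempty B → map proj₁ Q ≡ map proj₁ Q' →
      (∀ {i} → Rem leaf Q i → Rem (node B l d r) Q' i) →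
      (∀ {i} → Rem (node B l d r) Q' i → Rem leaf Q i) → ⊥
    ¬close-start {Q} {Q' = Q'} run good (start _ lts uns _) (b' , b'∈B) blocks to from with blocked run good (from (inj₁ (inj₁ b'∈B)))
    ... | a , b , w , rb , min , b<a , le with rem-open⁻ (to rb)
    ...   | inj₁ b∈B = ℚₚ.<-irrefl refl (ℚₚ.<-≤-trans (unit b a b<a Sign.lt (uns (waiting-resp {Q = Q} {Q'} blocks w) b∈B b<a)) le)
    ...   | inj₂ rem = ℚₚ.<-irrefl refl (ℚₚ.<-≤-trans (order b' b Sign.lt (lts b'∈B rem)) (min (from (inj₁ (inj₁ b'∈B)))))

    -- The descent pair makes the choice visible: equality for a dashed edge, strict inequality for
    -- a solid one.
    ¬dash-solid : ∀ {A : Subset n} {r Q} → Run x leaf ((A , true , r) ∷ Q) → Run y leaf ((A , false , r) ∷ Q) →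
      RightEdgeOK A true r → ⊥
    ¬dash-solid {r = leaf} _ _ ()
    ¬dash-solid {r = node B _ _ _} (close eqs _ _) (close _ gts _) (a , b , a∈A , b∈B , b<a) =
      ℚₚ.<-irrefl (sym (eqs a∈A b∈B b<a)) (unit b a b<a Sign.gt (gts a∈A (inj₁ (inj₁ b∈B)) id b<a))

  still-later : ∀ {n} {z : Point n} {B : Subset n} {P P' : Fin n → Set} →
    (∀ {b c} → b ∈ B → P c → z b < z c) → ∀ {i} → P i → i ∈ B ⊎ P' i → P' i
  still-later lts rem (inj₁ i∈B) = ⊥-elim (ℚₚ.<-irrefl refl (lts i∈B rem))
  still-later _ _ (inj₂ p) = p

  -- Only the blocks of the two queues are assumed equal, because a right subtree is not inspected
  -- before its block is closed. The conclusion hands the whole queue back, and its last entry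
  -- supplies the flag and right subtree of the block just started.
  run-unique : ∀ {n} {x y : Point n} → Same x y → Same y x → ∀ {t t' Q Q'} → Run x t Q → Run y t' Q' →
    map proj₁ Q ≡ map proj₁ Q' → (∀ {i} → Rem t Q i → Rem t' Q' i) → (∀ {i} → Rem t' Q' i → Rem t Q i) →
    Good t → Good t' → All GoodEntry Q → All GoodEntry Q' → t ≡ t' × Q ≡ Q'
  run-unique xy yx done done _ _ _ _ _ _ _ = refl , refl
  run-unique xy yx done (start _ _ _ _) _ _ from _ ((b , b∈B) , _) _ _ with from (inj₁ (inj₁ b∈B))
  ... | inj₂ ()
  run-unique xy yx (start _ _ _ _) done _ to _ ((b , b∈B) , _) _ _ _ with to (inj₁ (inj₁ b∈B))
  ... | inj₂ ()
  run-unique xy yx run@(close _ _ _) run'@(start _ _ _ _) blocks to from _ (ne , _) good _ =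
    ⊥-elim (¬close-start yx run good run' ne blocks to from)
  run-unique xy yx run@(start _ _ _ _) run'@(close _ _ _) blocks to from (ne , _) _ _ good' =
    ⊥-elim (¬close-start xy run' good' run ne (sym blocks) from to)
  run-unique {n} xy yx run@(close {A} {d} {r} {Q} _ _ sub) run'@(close {A'} {d'} {r'} {Q'} _ _ sub') blocks to from _ _ ((re , gr) ∷ good) ((re' , gr') ∷ good')
    with refl , blocks' ← ∷-injective blocks
    with refl , refl ← run-unique xy yx sub sub' blocks'
           (rem-close⁻ ∘ to ∘ rem-close⁺) (rem-close⁻ ∘ from ∘ rem-close⁺) gr gr' good good'
    = refl , cong (λ d → (A , d , r) ∷ Q) (flag d d' run run' re re')
    where
    flag : ∀ d d' → Run _ leaf ((A , d , r) ∷ Q) → Run _ leaf ((A , d' , r) ∷ Q) → RightEdgeOK A d r → RightEdgeOK A d' r → d ≡ d'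
    flag true true _ _ _ _ = refl
    flag false false _ _ _ _ = refl
    flag true false p q e _ = ⊥-elim (¬dash-solid yx p q e)
    flag false true p q _ e = ⊥-elim (¬dash-solid xy q p e)
  run-unique xy yx run@(start {B} {l} {d} {r} {Q} eqs lts _ sub) run'@(start {B'} {l'} {d'} {r'} {Q'} eqs' lts' _ sub') blocks to from
    (ne , re , gl , gr) (ne' , re' , gl' , gr') good good'
    with refl ← ⊆-antisym {i = B} {B'} (block-⊆ yx run run' to from ne') (block-⊆ xy run' run from to ne)
    with refl , eQ ← run-unique xy yx sub sub'
           (trans (map-++ proj₁ Q _) (trans (cong (_∷ʳ B) blocks) (sym (map-++ proj₁ Q' _))))
           (λ rem → still-later {P' = Rem l' (Q' ∷ʳ (B , d' , r'))} lts rem (rem-open⁻ {d = d'} (to (rem-open⁺ rem))))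
           (λ rem → still-later {P' = Rem l (Q ∷ʳ (B , d , r))} lts' rem (rem-open⁻ {d = d} (from (rem-open⁺ rem))))
           gl gl' (Allₚ.++⁺ good ((re , gr) ∷ [])) (Allₚ.++⁺ good' ((re' , gr') ∷ []))
    with refl , refl ← ∷ʳ-injective Q Q' eQ
    = refl , refl

-- A point for every tree.

module Realizations where
  open Rationals
  open TreeTransfer using (bit; ∉⇒lookup; countIn-++)
  open Runs
  open import Data.Nat.Solver using (module +-*-Solver)
  open import Data.Fin.Subset using (_∈_; _∉_)
  open import Data.Fin.Subset.Properties using (_∈?_)
  open import Data.Vec.Properties using ([]=⇒lookup; lookup⇒[]=)
  open import Data.Rational using (_+_; _<_; _≤_)

  treeCount : ∀ {n} → Fin n → DTree n → ℕ
  treeCount i t = countIn i (dlabels t)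

  queueCount : ∀ {n} → Fin n → Queue n → ℕ
  queueCount i [] = 0
  queueCount i ((A , d , r) ∷ Q) = treeCount i r ℕ.+ queueCount i Q

  remCount : ∀ {n} → Fin n → DTree n → Queue n → ℕ
  remCount i t Q = treeCount i t ℕ.+ queueCount i Q

  queueCount-∷ʳ : ∀ {n} (i : Fin n) Q A d r → queueCount i (Q ∷ʳ (A , d , r)) ≡ queueCount i Q ℕ.+ treeCount i r
  queueCount-∷ʳ i [] A d r = ℕₚ.+-identityʳ _
  queueCount-∷ʳ i ((_ , _ , r') ∷ Q) A d r rewrite queueCount-∷ʳ i Q A d r = sym (ℕₚ.+-assoc (treeCount i r') _ _)

  remCount-open : ∀ {n} (i : Fin n) B l d r Q →
    remCount i (node B l d r) Q ≡ bit (lookup B i) ℕ.+ remCount i l (Q ∷ʳ (B , d , r))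
  remCount-open i B l d r Q rewrite queueCount-∷ʳ i Q B d r | countIn-++ i (dlabels l) (dlabels r) =
    solve 4 (λ b x y q → (b :+ (x :+ y)) :+ q := b :+ (x :+ (q :+ y))) refl
      (bit (lookup B i)) (treeCount i l) (treeCount i r) (queueCount i Q)
    where open +-*-Solver

  ∈⇒bit : ∀ {n} {B : Subset n} {i} → i ∈ B → bit (lookup B i) ≡ 1
  ∈⇒bit i∈B = cong bit ([]=⇒lookup i∈B)

  inTree⇒count : ∀ {n} {i : Fin n} t → InTree i t → 1 ℕ.≤ treeCount i t
  inTree⇒count {i = i} (node A l d r) (inj₁ i∈A) rewrite ∈⇒bit i∈A = s≤s z≤n
  inTree⇒count {i = i} (node A l d r) (inj₂ p) rewrite countIn-++ i (dlabels l) (dlabels r) =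
    ℕₚ.≤-trans (sub p) (ℕₚ.m≤n+m _ (bit (lookup A i)))
    where
    sub : InTree i l ⊎ InTree i r → 1 ℕ.≤ treeCount i l ℕ.+ treeCount i r
    sub (inj₁ p) = ℕₚ.≤-trans (inTree⇒count l p) (ℕₚ.m≤m+n _ _)
    sub (inj₂ p) = ℕₚ.≤-trans (inTree⇒count r p) (ℕₚ.m≤n+m _ _)

  1≤+ : ∀ m {n} → 1 ℕ.≤ m ℕ.+ n → 1 ℕ.≤ m ⊎ 1 ℕ.≤ n
  1≤+ zero h = inj₂ h
  1≤+ (suc m) h = inj₁ (s≤s z≤n)

  count⇒inTree : ∀ {n} {i : Fin n} t → 1 ℕ.≤ treeCount i t → InTree i t
  count⇒inTree {i = i} (node A l d r) h with 1≤+ (bit (lookup A i)) h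
  ... | inj₂ h' rewrite countIn-++ i (dlabels l) (dlabels r) with 1≤+ (treeCount i l) h'
  ...   | inj₁ p = inj₂ (inj₁ (count⇒inTree l p))
  ...   | inj₂ p = inj₂ (inj₂ (count⇒inTree r p))
  count⇒inTree {i = i} (node A l d r) h | inj₁ h' with lookup A i in e
  ... | true = inj₁ (lookup⇒[]= i A e)

  rem⇒count : ∀ {n} {i : Fin n} t Q → Rem t Q i → 1 ℕ.≤ remCount i t Q
  rem⇒count t Q (inj₁ p) = ℕₚ.≤-trans (inTree⇒count t p) (ℕₚ.m≤m+n _ _)
  rem⇒count {i = i} t Q (inj₂ p) = ℕₚ.≤-trans (queue p) (ℕₚ.m≤n+m _ (treeCount i t))
    where
    queue : ∀ {Q} → Any (Behind i) Q → 1 ℕ.≤ queueCount i Q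
    queue {(_ , _ , r) ∷ Q} (here p) = ℕₚ.≤-trans (inTree⇒count r p) (ℕₚ.m≤m+n _ _)
    queue {(_ , _ , r) ∷ Q} (there p) = ℕₚ.≤-trans (queue p) (ℕₚ.m≤n+m _ (treeCount i r))

  ¬≤1 : ∀ {m n} → 1 ℕ.≤ m → 1 ℕ.≤ n → m ℕ.+ n ℕ.≤ 1 → ⊥
  ¬≤1 p q h with s≤s () ← ℕₚ.≤-trans (ℕₚ.+-mono-≤ p q) h

  -- The recursion scheme of Run, available before the point is known.
  data Machine {n} : DTree n → Queue n → Set where
    done : Machine leaf []
    close : ∀ {A d r Q} → Machine r Q → Machine leaf ((A , d , r) ∷ Q)
    start : ∀ {B l d r Q} → Machine l (Q ∷ʳ (B , d , r)) → Machine (node B l d r) Q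

  size : ∀ {n} → DTree n → ℕ
  size leaf = 0
  size (node A l d r) = suc (size l ℕ.+ size r)

  queueSize : ∀ {n} → Queue n → ℕ
  queueSize [] = 0
  queueSize ((A , d , r) ∷ Q) = size r ℕ.+ queueSize Q

  queueSize-∷ʳ : ∀ {n} (Q : Queue n) A d r → queueSize (Q ∷ʳ (A , d , r)) ≡ queueSize Q ℕ.+ size r
  queueSize-∷ʳ [] A d r = ℕₚ.+-identityʳ _
  queueSize-∷ʳ ((_ , _ , r') ∷ Q) A d r rewrite queueSize-∷ʳ Q A d r = sym (ℕₚ.+-assoc (size r') _ _)

  -- Starting a block uses up one node of tree and queue together; closing keeps their number and
  -- shortens the queue.
  machine : ∀ {n} fuel (t : DTree n) Q → size t ℕ.+ queueSize Q ℕ.≤ fuel → Machine t Q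
  machine fuel leaf [] _ = done
  machine fuel leaf ((A , d , r) ∷ Q) h = close (machine fuel r Q h)
  machine (suc fuel) (node B l d r) Q (s≤s h) = start (machine fuel l (Q ∷ʳ (B , d , r))
    (ℕₚ.≤-trans (ℕₚ.≤-reflexive (trans (cong (size l ℕ.+_) (queueSize-∷ʳ Q B d r))
      (solve 3 (λ x y q → x :+ (q :+ y) := (x :+ y) :+ q) refl (size l) (size r) (queueSize Q)))) h))
    where open +-*-Solver

  override : ∀ {n} → Subset n → ℚ → Point n → Point n
  override B y x i = if lookup B i then y else x i

  override-∈ : ∀ {n} {B : Subset n} {y} x {i} → i ∈ B → override B y x i ≡ y
  override-∈ x i∈B rewrite []=⇒lookup i∈B = refl

  override-∉ : ∀ {n} {B : Subset n} {y} x {i} → i ∉ B → override B y x i ≡ x i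
  override-∉ {B = B} x {i} i∉B rewrite ∉⇒lookup {A = B} {i} i∉B = refl

  -- Values increase along the queue, so its head has the smallest `x a + 1ℚ`; this is why blocks
  -- are closed in the order in which they were started.
  Sorted : ∀ {n} → Point n → Queue n → Set
  Sorted x [] = ⊤
  Sorted x ((A , _) ∷ Q) = (∀ {a a'} → a ∈ A → Waiting a' Q → x a < x a')
    × (∀ {a a'} → a ∈ A → a' ∈ A → x a ≡ x a') × Nonempty A × Sorted x Q

  sorted-resp : ∀ {n} {x x' : Point n} Q → (∀ {a} → Waiting a Q → x' a ≡ x a) → Sorted x Q → Sorted x' Q
  sorted-resp [] _ _ = tt
  sorted-resp (_ ∷ Q) e (lt , const , ne , s) =
    (λ a∈ w → subst₂ _<_ (sym (e (here a∈))) (sym (e (there w))) (lt a∈ w)) ,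
    (λ a∈ a'∈ → trans (e (here a∈)) (trans (const a∈ a'∈) (sym (e (here a'∈))))) ,
    ne , sorted-resp Q (e ∘ there) s

  sorted-∷ʳ : ∀ {n} {x : Point n} {y B d r} Q → (∀ {a} → Waiting a Q → x a < y) → (∀ {b} → b ∈ B → x b ≡ y) →
    Nonempty B → Sorted x Q → Sorted x (Q ∷ʳ (B , d , r))
  sorted-∷ʳ [] _ e ne _ = (λ _ ()) , (λ b∈ b'∈ → trans (e b∈) (sym (e b'∈))) , ne , tt
  sorted-∷ʳ {x = x} {y} {B} ((A , _) ∷ Q) below e ne (lt , const , ne' , s) =
    lt' , const , ne' , sorted-∷ʳ Q (below ∘ there) e ne s
    where
    lt' : ∀ {a a'} → a ∈ A → Waiting a' (Q ∷ʳ (B , _)) → x a < x a'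
    lt' {a} a∈ w with Anyₚ.++⁻ Q w
    ... | inj₁ w' = lt a∈ w'
    ... | inj₂ (here a'∈B) = subst (x a <_) (sym (e a'∈B)) (below (here a∈))

  -- The value `τ` is that of the latest event. A captive block will be placed at `τ` itself and
  -- must come after all waiting blocks, hence `strict`. The fields `fresh` and `once` ensure that a
  -- coordinate already placed is never overwritten.
  record Invariant {n} (x : Point n) (τ : ℚ) (cap : Bool) (t : DTree n) (Q : Queue n) : Set where
    field
      sorted : Sorted x Q
      below : ∀ {a} → Waiting a Q → x a ≤ τ
      strict : cap ≡ true → ∀ {a} → Waiting a Q → x a < τ
      above : ∀ {a} → Waiting a Q → τ < x a + 1ℚ
      fresh : ∀ {a} → Waiting a Q → ¬ Rem t Q a
      once : ∀ i → remCount i t Q ℕ.≤ 1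
      good : Good t
      goods : All GoodEntry Q

  record Realization {n} (x : Point n) (τ : ℚ) (cap : Bool) (t : DTree n) (Q : Queue n) : Set where
    field
      point : Point n
      fixed : ∀ {i} → ¬ Rem t Q i → point i ≡ x i
      run : Run point t Q
      later : ∀ {i} → Rem t Q i → ¬ Captive cap t i → τ < point i
      captive : ∀ {i} → Captive cap t i → point i ≡ τ

  waiting? : ∀ {n} (Q : Queue n) a → Dec (Waiting a Q)
  waiting? Q a = Any.any? (λ e → a ∈? proj₁ e) Q

  -- A captive block takes the value `τ`. Any other block is placed before every pending `x a + 1ℚ`,
  -- also the invisible ones, so that the constructed point follows the tree literally.
  next-value : ∀ {n} {x : Point n} {τ cap t Q} → Invariant x τ cap t Q →
    ∃ λ y → τ ≤ y × (cap ≡ true → y ≡ τ) × (cap ≡ false → τ < y) ×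
      (∀ {a} → Waiting a Q → y < x a + 1ℚ) × (∀ {a} → Waiting a Q → x a < y)
  next-value {τ = τ} {true} inv = τ , ℚₚ.≤-refl , (λ _ → refl) , (λ ()) , above , strict refl
    where open Invariant inv
  next-value {x = x} {τ} {false} {Q = Q} inv with between τ (waiting? Q) (λ a → x a + 1ℚ) (λ _ → Invariant.above inv)
  ... | y , τ<y , y<  = y , ℚₚ.<⇒≤ τ<y , (λ ()) , (λ _ → τ<y) , y< _ , (λ w → ℚₚ.≤-<-trans (Invariant.below inv w) τ<y)

  realize : ∀ {n} {t : DTree n} {Q} → Machine t Q → ∀ x τ cap → Invariant x τ cap t Q → Realization x τ cap t Q
  realize done x τ cap inv = record
    { point = x ; fixed = λ _ → refl ; run = done
    ; later = λ { (inj₁ ()) ; (inj₂ ()) }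
    ; captive = λ p → ⊥-elim (¬captive-leaf cap p) }
  realize {n} (close {A} {d} {r} {Q} m) x τ cap inv
    with Invariant.sorted inv
  ... | lt , const , (a₀ , a₀∈A) , sorted' = record
    { point = point ; fixed = λ ¬rem → fixed (¬rem ∘ rem-close⁺)
    ; run = close (λ a∈A cap b<a → trans (captive cap) (sym (value a∈A)))
                  (λ {a} {b} a∈A rem ncap b<a → subst (_< point b) (sym (value a∈A)) (later rem ncap)) run
    ; later = λ rem _ → later' (rem-close⁻ rem)
    ; captive = λ p → ⊥-elim (¬captive-leaf cap p) }
    where
    open Invariant inv
    -- Closing advances the current value to that of the event passed. All waiting blocks then lie
    -- strictly below it, as a captive block requires.
    τ' = x a₀ + 1ℚ
    τ<τ' : τ < τ'
    τ<τ' = above (here a₀∈A)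
    inv' : Invariant x τ' d r Q
    inv' = record
      { sorted = sorted' ; below = λ w → ℚₚ.<⇒≤ (ℚₚ.≤-<-trans (below (there w)) τ<τ')
      ; strict = λ _ w → ℚₚ.≤-<-trans (below (there w)) τ<τ' ; above = λ w → +1-mono (lt a₀∈A w)
      ; fresh = λ w rem → fresh (there w) (rem-close⁺ rem) ; once = once
      ; good = proj₂ (All.head goods) ; goods = All.tail goods }
    open Realization (realize m x τ' d inv')
    value : ∀ {a} → a ∈ A → point a + 1ℚ ≡ τ'
    value a∈A = cong (_+ 1ℚ) (trans (fixed (λ rem → fresh (here a∈A) (rem-close⁺ rem))) (const a∈A a₀∈A))
    later' : ∀ {i} → Rem r Q i → τ < point i
    later' {i} rem with captive? d r i
    ... | yes cap = subst (τ <_) (sym (captive cap)) τ<τ'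
    ... | no ncap = ℚₚ.<-trans τ<τ' (later rem ncap)
  realize {n} (start {B} {l} {d} {r} {Q} m) x τ cap inv with next-value inv
  ... | y , τ≤y , y≡τ , τ<y , y<above , below<y = record
    { point = point ; fixed = λ ¬rem → trans (fixed (¬rem ∘ rem-open⁺)) (override-∉ x (¬rem ∘ inj₁ ∘ inj₁))
    ; run = start (λ b∈ b'∈ → trans (value b∈) (sym (value b'∈)))
                  (λ {b} {c} b∈ rem → subst (_< point c) (sym (value b∈)) (later rem λ ()))
                  (λ {a} w b∈ b<a → subst₂ _<_ (sym (value b∈)) (cong (_+ 1ℚ) (sym (old w))) (y<above w))
                  run
    ; later = later' cap τ<y
    ; captive = captive' cap y≡τ }
    where
    open Invariant inv
    x₁ = override B y x
    waiting∉B : ∀ {a} → Waiting a Q → a ∉ B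
    waiting∉B w a∈B = fresh w (inj₁ (inj₁ a∈B))
    once' : ∀ i → bit (lookup B i) ℕ.+ remCount i l (Q ∷ʳ (B , d , r)) ℕ.≤ 1
    once' i = subst (ℕ._≤ 1) (remCount-open i B l d r Q) (once i)
    B-fresh : ∀ {b} → b ∈ B → ¬ Rem l (Q ∷ʳ (B , d , r)) b
    B-fresh {b} b∈B rem = ¬≤1 (ℕₚ.≤-reflexive (sym (∈⇒bit b∈B))) (rem⇒count l _ rem) (once' b)
    inv' : Invariant x₁ y false l (Q ∷ʳ (B , d , r))
    inv' = record
      { sorted = sorted-∷ʳ Q (λ w → subst (_< y) (sym (override-∉ x (waiting∉B w))) (below<y w)) (λ b∈ → override-∈ x b∈)
                   (proj₁ good) (sorted-resp {x = x} Q (λ w → override-∉ x (waiting∉B w)) sorted)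
      ; below = below' ; strict = λ () ; above = above' ; fresh = fresh'
      ; once = λ i → ℕₚ.≤-trans (ℕₚ.m≤n+m _ (bit (lookup B i))) (once' i)
      ; good = proj₁ (proj₂ (proj₂ good)) ; goods = Allₚ.++⁺ goods ((proj₁ (proj₂ good) , proj₂ (proj₂ (proj₂ good))) ∷ []) }
      where
      below' : ∀ {a} → Waiting a (Q ∷ʳ (B , d , r)) → x₁ a ≤ y
      below' w with Anyₚ.++⁻ Q w
      ... | inj₁ w' = subst (_≤ y) (sym (override-∉ x (waiting∉B w'))) (ℚₚ.<⇒≤ (below<y w'))
      ... | inj₂ (here b∈B) = ℚₚ.≤-reflexive (override-∈ x b∈B)
      above' : ∀ {a} → Waiting a (Q ∷ʳ (B , d , r)) → y < x₁ a + 1ℚ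
      above' w with Anyₚ.++⁻ Q w
      ... | inj₁ w' = subst (λ z → y < z + 1ℚ) (sym (override-∉ x (waiting∉B w'))) (y<above w')
      ... | inj₂ (here b∈B) = ≡⇒<+1 (sym (override-∈ x b∈B))
      fresh' : ∀ {a} → Waiting a (Q ∷ʳ (B , d , r)) → ¬ Rem l (Q ∷ʳ (B , d , r)) a
      fresh' w with Anyₚ.++⁻ Q w
      ... | inj₁ w' = fresh w' ∘ rem-open⁺
      ... | inj₂ (here b∈B) = B-fresh b∈B
    open Realization (realize m x₁ y false inv')
    value : ∀ {b} → b ∈ B → point b ≡ y
    value b∈B = trans (fixed (B-fresh b∈B)) (override-∈ x b∈B)
    old : ∀ {a} → Waiting a Q → point a ≡ x a
    old w = trans (fixed (fresh w ∘ rem-open⁺)) (override-∉ x (waiting∉B w))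
    later' : ∀ cap → (cap ≡ false → τ < y) → ∀ {i} → Rem (node B l d r) Q i → ¬ Captive cap (node B l d r) i → τ < point i
    later' cap τ<y {i} rem ncap with rem-open⁻ rem
    ... | inj₂ rem' = ℚₚ.≤-<-trans τ≤y (later rem' λ ())
    later' true τ<y {i} rem ncap | inj₁ i∈B = ⊥-elim (ncap i∈B)
    later' false τ<y {i} rem ncap | inj₁ i∈B = subst (τ <_) (sym (value i∈B)) (τ<y refl)
    captive' : ∀ cap → (cap ≡ true → y ≡ τ) → ∀ {i} → Captive cap (node B l d r) i → point i ≡ τ
    captive' true y≡τ i∈B = trans (value i∈B) (y≡τ refl)

  realizable : ∀ {n} (t : DTree n) → Good t → (∀ i → treeCount i t ℕ.≤ 1) → ∃ λ x → Run x t []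
  realizable t good once = Realization.point R , Realization.run R
    where
    R = realize (machine (size t ℕ.+ 0) t [] ℕₚ.≤-refl) (λ _ → 0ℚ) 0ℚ false (record
      { sorted = tt ; below = λ () ; strict = λ () ; above = λ () ; fresh = λ () ; good = good ; goods = []
      ; once = λ i → subst (ℕ._≤ 1) (sym (ℕₚ.+-identityʳ (treeCount i t))) (once i) })

-- A tree for every point.

module CanonicalTrees where
  open Rationals
  open TreeTransfer using (bit; ∉⇒lookup)
  open Runs
  open Realizations
  open import Data.Fin.Subset using (_∈_; _∉_)
  open import Data.Fin.Subset.Properties using (_∈?_; nonempty?; p⊂q⇒∣p∣<∣q∣; ∈⊤; ∣⊤∣≡n)
  open import Data.Vec.Properties using ([]=⇒lookup; lookup⇒[]=; lookup∘tabulate)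
  open import Data.List.Properties using (∷-injective)
  open import Data.Rational using (_+_; _<_; _≤_)

  select : ∀ {n} {P : Fin n → Set} → (∀ i → Dec (P i)) → Subset n
  select P? = tabulate (λ i → does (P? i))

  module _ {n} {P : Fin n → Set} (P? : ∀ i → Dec (P i)) where
    select⁺ : ∀ {i} → P i → i ∈ select P?
    select⁺ {i} p = lookup⇒[]= i _ (trans (lookup∘tabulate _ i) (dec-true (P? i) p))

    select⁻ : ∀ {i} → i ∈ select P? → P i
    select⁻ {i} i∈ with P? i | trans (sym (lookup∘tabulate (λ i → does (P? i)) i)) ([]=⇒lookup i∈)
    ... | yes p | _ = p

  argmin : ∀ {m} (f : Fin m → ℚ) {P : Fin m → Set} → (∀ i → Dec (P i)) → ∃ P → ∃ λ i → P i × (∀ j → P j → f i ≤ f j)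
  argmin {suc m} f {P} P? (i , p) with Finₚ.any? (P? ∘ suc) | P? zero
  ... | no none | no ¬p₀ = ⊥-elim (absurd i p)
    where
    absurd : ∀ i → ¬ P i
    absurd zero = ¬p₀
    absurd (suc i) q = none (i , q)
  ... | no none | yes p₀ = zero , p₀ , λ { zero _ → ℚₚ.≤-refl ; (suc j) q → ⊥-elim (none (j , q)) }
  ... | yes some | no ¬p₀ with argmin (f ∘ suc) (P? ∘ suc) some
  ...   | j , q , min = suc j , q , λ { zero p₀ → ⊥-elim (¬p₀ p₀) ; (suc j') → min j' }
  argmin {suc m} f {P} P? (i , p) | yes some | yes p₀ with argmin (f ∘ suc) (P? ∘ suc) some
  ... | j , q , min with ℚₚ.≤-total (f zero) (f (suc j))
  ...   | inj₁ le = zero , p₀ , λ { zero _ → ℚₚ.≤-refl ; (suc j') q' → ℚₚ.≤-trans le (min j' q') }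
  ...   | inj₂ le = suc j , q , λ { zero _ → le ; (suc j') → min j' }

  module Greedy {n} (x : Point n) where

    record MinBlock (R B : Subset n) : Set where
      field
        nonempty : Nonempty B
        sub : ∀ {b} → b ∈ B → b ∈ R
        const-on : ∀ {b b'} → b ∈ B → b' ∈ B → x b ≡ x b'
        less : ∀ {b c} → b ∈ B → c ∈ R → c ∉ B → x b < x c

      least : ∀ {b c} → b ∈ B → c ∈ R → x b ≤ x c
      least {b} {c} b∈B c∈R with c ∈? B
      ... | yes c∈B = ℚₚ.≤-reflexive (const-on b∈B c∈B)
      ... | no c∉B = ℚₚ.<⇒≤ (less b∈B c∈R c∉B)

    minBlock : ∀ R → Nonempty R → ∃ (MinBlock R)
    minBlock R ne with argmin x (_∈? R) ne
    ... | m , m∈R , min = select P? , record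
      { nonempty = m , select⁺ P? (m∈R , refl) ; sub = proj₁ ∘ select⁻ P?
      ; const-on = λ b∈ b'∈ → trans (proj₂ (select⁻ P? b∈)) (sym (proj₂ (select⁻ P? b'∈)))
      ; less = λ {b} {c} b∈ c∈R c∉ → ℚₚ.≰⇒> λ le → c∉ (select⁺ P? (c∈R ,
          ℚₚ.≤-antisym (subst (x c ≤_) (proj₂ (select⁻ P? b∈)) le) (min c c∈R))) }
      where
      P? : ∀ i → Dec (i ∈ R × x i ≡ x m)
      P? i = (i ∈? R) ×-dec (x i ℚₚ.≟ x m)

    rest? : ∀ (R B : Subset n) i → Dec (i ∈ R × i ∉ B)
    rest? R B i = (i ∈? R) ×-dec ¬? (i ∈? B)

    rest : Subset n → Subset n → Subset n
    rest R B = select (rest? R B)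

    module _ {R B : Subset n} (mb : MinBlock R B) where
      open MinBlock mb

      bit-rest : ∀ i → bit (lookup R i) ≡ bit (lookup B i) ℕ.+ bit (lookup (rest R B) i)
      bit-rest i with i ∈? B
      ... | yes i∈B rewrite []=⇒lookup i∈B | []=⇒lookup (sub i∈B)
            | ∉⇒lookup {A = rest R B} {i} (λ i∈ → proj₂ (select⁻ (rest? R B) i∈) i∈B) = refl
      ... | no i∉B rewrite ∉⇒lookup i∉B with i ∈? R
      ...   | yes i∈R rewrite []=⇒lookup i∈R | []=⇒lookup (select⁺ (rest? R B) (i∈R , i∉B)) = refl
      ...   | no i∉R rewrite ∉⇒lookup i∉R | ∉⇒lookup {A = rest R B} {i} (i∉R ∘ proj₁ ∘ select⁻ (rest? R B)) = refl

      ∣rest∣< : ∣ rest R B ∣ ℕ.< ∣ R ∣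
      ∣rest∣< = p⊂q⇒∣p∣<∣q∣ ((proj₁ ∘ select⁻ (rest? R B)) , proj₁ nonempty , sub (proj₂ nonempty) ,
        λ b∈ → proj₂ (select⁻ (rest? R B) b∈) (proj₂ nonempty))

    Blocks : Set
    Blocks = List (Subset n)

    Ordered : Blocks → Set
    Ordered [] = ⊤
    Ordered (A ∷ As) = (∀ {a a'} → a ∈ A → Any (a' ∈_) As → x a < x a')
      × (∀ {a a'} → a ∈ A → a' ∈ A → x a ≡ x a') × Ordered As

    ordered-∷ʳ : ∀ As {B} → Ordered As → (∀ {a b} → Any (a ∈_) As → b ∈ B → x a < x b) →
      (∀ {b b'} → b ∈ B → b' ∈ B → x b ≡ x b') → Ordered (As ∷ʳ B)
    ordered-∷ʳ [] _ _ eqs = (λ _ ()) , eqs , tt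
    ordered-∷ʳ (A ∷ As) {B} (lt , eqs' , ord) before eqs = lt' , eqs' , ordered-∷ʳ As ord (before ∘ there) eqs
      where
      lt' : ∀ {a a'} → a ∈ A → Any (a' ∈_) (As ∷ʳ B) → x a < x a'
      lt' a∈ w with Anyₚ.++⁻ As w
      ... | inj₁ w' = lt a∈ w'
      ... | inj₂ (here b∈B) = before (here a∈) b∈B

    Before : Blocks → Subset n → Set
    Before As R = ∀ {a c} → Any (a ∈_) As → c ∈ R → x a < x c

    -- The blocks of the queue are an input, the queue itself an output: flags and right subtrees
    -- become known only by the recursion.
    record Built (R : Subset n) (As : Blocks) (t : DTree n) : Set where
      field
        queue : Queue n
        blocks : map proj₁ queue ≡ As
        run : Run x t queue
        counts : ∀ i → remCount i t queue ≡ bit (lookup R i)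
        good : Good t
        goods : All GoodEntry queue

      rem⇒∈ : ∀ {i} → Rem t queue i → i ∈ R
      rem⇒∈ {i} rem with lookup R i in e | counts i
      ... | true | _ = lookup⇒[]= i R e
      ... | false | c with () ← subst (1 ℕ.≤_) c (rem⇒count t queue rem)

    -- The visible obstruction to starting `B` while `A` is still waiting.
    Forces : Subset n → Subset n → Set
    Forces B A = ∃ λ a → ∃ λ b → a ∈ A × b ∈ B × b Fin.< a × x a + 1ℚ ≤ x b

    forces? : ∀ B A → Dec (Forces B A)
    forces? B A = Finₚ.any? λ a → Finₚ.any? λ b →
      (a ∈? A) ×-dec ((b ∈? B) ×-dec ((b Finₚ.<? a) ×-dec (x a + 1ℚ ℚₚ.≤? x b)))

    split-∷ʳ : ∀ {As B} (Q : Queue n) → map proj₁ Q ≡ As ∷ʳ B →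
      ∃ λ Q' → ∃ λ d → ∃ λ r → Q ≡ Q' ∷ʳ (B , d , r) × map proj₁ Q' ≡ As
    split-∷ʳ {[]} ((B , d , r) ∷ []) refl = [] , d , r , refl , refl
    split-∷ʳ {[]} (_ ∷ _ ∷ _) ()
    split-∷ʳ {A ∷ As} (e ∷ Q) eq with refl , eq' ← ∷-injective eq with split-∷ʳ Q eq'
    ... | Q' , d , r , refl , refl = e ∷ Q' , d , r , refl , refl
    split-∷ʳ {[]} [] ()
    split-∷ʳ {_ ∷ _} [] ()

    drain : ∀ {R} → Empty R → ∀ As → Built R As leaf
    drain {R} empty [] = record { queue = [] ; blocks = refl ; run = done
      ; counts = λ i → sym (cong bit (∉⇒lookup (λ i∈R → empty (i , i∈R)))) ; good = tt ; goods = [] }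
    drain {R} empty (A ∷ As) = record { queue = (A , false , leaf) ∷ queue ; blocks = cong (A ∷_) blocks
      ; run = close (λ _ ()) (λ _ rem → ⊥-elim (empty (_ , rem⇒∈ rem))) run
      ; counts = counts ; good = tt ; goods = (refl , tt) ∷ goods }
      where open Built (drain {R} empty As)

    mutual
      -- The lazy strategy: a block is closed only if the next block forces it or forces one behind
      -- it in the queue. The fuel bounds the unread indices; closings recurse on the queue.
      build : ∀ fuel R As → ∣ R ∣ ℕ.≤ fuel → Ordered As → Before As R → ∃ (Built R As)
      build fuel R As h ord bef with nonempty? R
      ... | no empty = leaf , drain empty As
      ... | yes ne with minBlock R ne
      ...   | B , mb with Any.any? (forces? B) As
      ...     | yes forced = leaf , build-close fuel R As B h ord bef mb forced
      ...     | no free = let (l , d , r , b) = build-open fuel R As B h ord bef mb free in node B l d r , b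

      build-open : ∀ fuel R As B → ∣ R ∣ ℕ.≤ fuel → Ordered As → Before As R → MinBlock R B → ¬ Any (Forces B) As →
        ∃ λ l → ∃ λ d → ∃ λ r → Built R As (node B l d r)
      build-open zero R As B h ord bef mb free = ⊥-elim (ℕₚ.n≮0 (ℕₚ.<-≤-trans (∣rest∣< mb) h))
      build-open (suc fuel) R As B h ord bef mb free
        with build fuel (rest R B) (As ∷ʳ B) (ℕₚ.≤-pred (ℕₚ.≤-trans (∣rest∣< mb) h))
               (ordered-∷ʳ As ord (λ w b∈ → bef w (MinBlock.sub mb b∈)) (MinBlock.const-on mb))
               (λ w c∈ → before w (select⁻ (rest? R B) c∈))
        where
        before : ∀ {a c} → Any (a ∈_) (As ∷ʳ B) → c ∈ R × c ∉ B → x a < x c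
        before w (c∈R , c∉B) with Anyₚ.++⁻ As w
        ... | inj₁ w' = bef w' c∈R
        ... | inj₂ (here a∈B) = MinBlock.less mb a∈B c∈R c∉B
      ... | l , built@record { queue = Q₀ ; blocks = bl₀ } with split-∷ʳ Q₀ bl₀
      -- The last entry of the returned queue carries the flag and the right subtree of `B`.
      ...   | Q , d , r , refl , bl = l , d , r , record
        { queue = Q ; blocks = bl
        ; run = start const-on
            (λ b∈ rem → let (c∈R , c∉B) = select⁻ (rest? R B) (rem⇒∈ rem) in less b∈ c∈R c∉B)
            (λ {a} {b} w b∈ b<a → ℚₚ.≰⇒> λ le → free (Any.map (λ a∈A → a , b , a∈A , b∈ , b<a , le)
              (subst (Any (a ∈_)) bl (Anyₚ.map⁺ w))))
            run
        ; counts = λ i → trans (remCount-open i B l d r Q) (trans (cong (bit (lookup B i) ℕ.+_) (counts i)) (sym (bit-rest mb i)))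
        ; good = nonempty , proj₁ (All.head final) , good , proj₂ (All.head final)
        ; goods = Allₚ.++⁻ˡ Q goods }
        where
        open MinBlock mb
        open Built built
        final : All GoodEntry ((B , d , r) ∷ [])
        final = Allₚ.++⁻ʳ Q goods

      -- The queue order requires closing everything up to the last forcing block. Only that block
      -- gets `B` as right child, and forcing is the descent required of this edge; all blocks
      -- before it get an empty right subtree.
      build-close : ∀ fuel R As B → ∣ R ∣ ℕ.≤ fuel → Ordered As → Before As R → MinBlock R B → Any (Forces B) As →
        Built R As leaf
      build-close fuel R (A ∷ As) B h (lt , eqs , ord) bef mb forced with forces? B A
      ... | no ¬fA = record
        { queue = (A , false , leaf) ∷ queue ; blocks = cong (A ∷_) blocks
        ; run = close (λ _ ()) (λ a∈A rem _ _ → after a∈A (Any.tail ¬fA forced) (rem⇒∈ rem)) run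
        ; counts = counts ; good = tt ; goods = (refl , tt) ∷ goods }
        where
        open MinBlock mb
        open Built (build-close fuel R As B h ord (bef ∘ there) mb (Any.tail ¬fA forced))
        after : ∀ {a c} → a ∈ A → Any (Forces B) As → c ∈ R → x a + 1ℚ < x c
        after {a} {c} a∈A f c∈R = go f (lt a∈A)
          where
          go : ∀ {As} → Any (Forces B) As → (∀ {a'} → Any (a' ∈_) As → x a < x a') → x a + 1ℚ < x c
          -- Even an unforced `A` is passed strictly before the remaining indices, because a later
          -- block in the queue is passed no later than `B`.
          go (here (a' , b , a'∈ , b∈B , _ , le)) lt' =
            ℚₚ.<-≤-trans (+1-mono (lt' (here a'∈))) (ℚₚ.≤-trans le (least b∈B c∈R))
          go (there f) lt' = go f (lt' ∘ there)
      ... | yes (a₀ , b₀ , a₀∈A , b₀∈B , b₀<a₀ , le) with x b₀ ℚₚ.≟ x a₀ + 1ℚ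
      ...   | yes eq = dashed (build-open fuel R As B h ord (bef ∘ there) mb free)
        where
        open MinBlock mb
        -- When `B` sits exactly at `x a₀ + 1ℚ`, blocks further back have larger unit values and
        -- cannot force it.
        free : ¬ Any (Forces B) As
        free f = go f (lt a₀∈A)
          where
          go : ∀ {As} → Any (Forces B) As → (∀ {a'} → Any (a' ∈_) As → x a₀ < x a') → ⊥
          go (here (a' , b , a'∈ , b∈B , _ , le)) lt' = ℚₚ.<-irrefl refl
            (ℚₚ.<-≤-trans (subst (_< x a' + 1ℚ) (trans (sym eq) (const-on b₀∈B b∈B)) (+1-mono (lt' (here a'∈)))) le)
          go (there f) lt' = go f (lt' ∘ there)
        value : ∀ {a} → a ∈ A → x a + 1ℚ ≡ x b₀
        value a∈A = trans (cong (_+ 1ℚ) (eqs a∈A a₀∈A)) (sym eq)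
        dashed : (∃ λ l → ∃ λ d → ∃ λ r → Built R As (node B l d r)) → Built R (A ∷ As) leaf
        dashed (l , d , r , built) = record
          { queue = (A , true , node B l d r) ∷ queue ; blocks = cong (A ∷_) blocks
          ; run = close (λ a∈A b∈B _ → trans (const-on b∈B b₀∈B) (sym (value a∈A)))
                        (λ {a} {b} a∈A rem b∉B _ → subst (_< x b) (sym (value a∈A)) (less b₀∈B (rem⇒∈ rem) b∉B)) run
          ; counts = counts ; good = tt ; goods = ((a₀ , b₀ , a₀∈A , b₀∈B , b₀<a₀) , good) ∷ goods }
          where open Built built
      ...   | no neq = solid
        where
        open MinBlock mb
        after : ∀ {a c} → a ∈ A → c ∈ R → x a + 1ℚ < x c
        after {a} {c} a∈A c∈R = subst (λ z → z + 1ℚ < x c) (eqs a₀∈A a∈A)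
          (ℚₚ.<-≤-trans (ℚₚ.≰⇒> (λ le' → neq (ℚₚ.≤-antisym le' le))) (least b₀∈B c∈R))
        solid : Built R (A ∷ As) leaf
        solid with Any.any? (forces? B) As
        ... | yes forced' = record
          { queue = (A , false , leaf) ∷ queue ; blocks = cong (A ∷_) blocks
          ; run = close (λ _ ()) (λ a∈A rem _ _ → after a∈A (rem⇒∈ rem)) run
          ; counts = counts ; good = tt ; goods = (refl , tt) ∷ goods }
          where open Built (build-close fuel R As B h ord (bef ∘ there) mb forced')
        ... | no free with build-open fuel R As B h ord (bef ∘ there) mb free
        ...   | l , d , r , built = record
          { queue = (A , false , node B l d r) ∷ queue ; blocks = cong (A ∷_) blocks
          ; run = close (λ _ ()) (λ a∈A rem _ _ → after a∈A (rem⇒∈ rem)) run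
          ; counts = counts ; good = tt ; goods = ((a₀ , b₀ , a₀∈A , b₀∈B , b₀<a₀) , good) ∷ goods }
          where open Built built

    treeOf : ∃ λ t → Run x t [] × Good t × (∀ i → treeCount i t ≡ 1)
    treeOf with build n Subset.⊤ [] (ℕₚ.≤-reflexive (∣⊤∣≡n n)) tt (λ ())
    ... | t , record { queue = [] ; run = run ; counts = counts ; good = good } =
      t , run , good , λ i → trans (sym (ℕₚ.+-identityʳ _)) (trans (counts i) (∈⇒bit (∈⊤ {x = i})))

-- Clusters, dimension, and the bijection between faces and 𝒯.

module Faces where
  open Bijections
  open Rationals
  open Dimension
  open TreeTransfer using (bit; countIn-++)
  open Runs
  open Realizations
  open CanonicalTrees
  open import Data.Fin.Subset using (_∈_)
  open import Data.Maybe as Maybe using (Maybe; just; nothing; maybe)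
  open import Data.Maybe.Properties using (just-injective)
  open import Data.Rational using (_+_; _-_)
  open import Data.Rational.Solver using (module +-*-Solver)

  -- The cluster of a vertex is its component after the solid edges are cut; nothing
  -- stands for the cluster of the root, so that cls also makes sense below a dashed edge.
  mutual
    cls : ∀ {n} (t : DTree n) {i} → InTree i t → Maybe (Fin (freeCount false t))
    cls (node A l d r) (inj₁ _) = nothing
    cls (node A l d r) (inj₂ (inj₁ p)) = just (cluster l p ↑ˡ freeCount (not d) r)
    cls (node A l false r) (inj₂ (inj₂ p)) = just (freeCount true l ↑ʳ cluster r p)
    cls (node A l true r) (inj₂ (inj₂ p)) = Maybe.map (freeCount true l ↑ʳ_) (cls r p)

    cluster : ∀ {n} (t : DTree n) {i} → InTree i t → Fin (freeCount true t)
    cluster t@(node A l d r) p = maybe suc zero (cls t p)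

  cls⇒cluster : ∀ {n} (t : DTree n) {i j} (p : InTree i t) (q : InTree j t) → cls t p ≡ cls t q → cluster t p ≡ cluster t q
  cls⇒cluster (node A l d r) p q e = cong (maybe suc zero) e

  cluster-rep : ∀ {n} (t : DTree n) → Good t → (j : Fin (freeCount true t)) → ∃ λ i → Σ (InTree i t) λ p → cluster t p ≡ j
  cluster-rep (node A l d r) ((a , a∈A) , _) zero = a , inj₁ a∈A , refl
  cluster-rep (node A l d r) (_ , _ , gl , gr) (suc j) with splitAt (freeCount true l) j in e
  ... | inj₁ k with cluster-rep l gl k
  ...   | i , p , eq = i , inj₂ (inj₁ p) , cong suc (trans (cong (_↑ˡ _) eq) (Finₚ.splitAt⁻¹-↑ˡ e))
  cluster-rep (node A l false r) (_ , _ , gl , gr) (suc j) | inj₂ k with cluster-rep r gr k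
  ... | i , p , eq = i , inj₂ (inj₂ p) , cong suc (trans (cong (freeCount true l ↑ʳ_) eq) (Finₚ.splitAt⁻¹-↑ʳ e))
  cluster-rep (node A l true leaf) (_ , _ , gl , gr) (suc j) | inj₂ ()
  -- Cluster zero of `r` is that of its captive root and merges with the cluster of `A`; the others
  -- are shifted by one, hence `suc k`.
  cluster-rep (node A l true r@(node _ _ _ _)) (_ , _ , gl , gr) (suc j) | inj₂ k with cluster-rep r gr (suc k)
  ... | i , p , eq with cls r p in eq'
  cluster-rep (node A l true r@(node _ _ _ _)) (_ , _ , gl , gr) (suc j) | inj₂ k | i , p , refl | just .k =
    i , inj₂ (inj₂ p) , trans (cong (λ m → maybe suc zero (Maybe.map (freeCount true l ↑ʳ_) m)) eq') (cong suc (Finₚ.splitAt⁻¹-↑ʳ e))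

  -- Meant for the difference `z` of two points with the same run: the unit shift along a dashed
  -- edge cancels, leaving `z` constant on clusters.
  Rigid : ∀ {n} → (Fin n → ℚ) → DTree n → Set
  Rigid z leaf = ⊤
  Rigid z (node A l d r) = (∀ {a a'} → a ∈ A → a' ∈ A → z a ≡ z a')
    × (∀ {a b} → a ∈ A → Captive d r b → z b ≡ z a) × Rigid z l × Rigid z r

  ↑ˡ≢↑ʳ : ∀ {m n} (i : Fin m) (j : Fin n) → i ↑ˡ n ≢ m ↑ʳ j
  ↑ˡ≢↑ʳ {m} {n} i j e with () ← trans (sym (Finₚ.splitAt-↑ˡ m i n)) (trans (cong (splitAt m) e) (Finₚ.splitAt-↑ʳ m n j))

  map-nothing : ∀ {A B : Set} {f : A → B} m → Maybe.map f m ≡ nothing → m ≡ nothing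
  map-nothing nothing _ = refl

  map-injective : ∀ {A B : Set} {f : A → B} → (∀ {x y} → f x ≡ f y → x ≡ y) → ∀ m m' {k} →
    Maybe.map f m ≡ just k → Maybe.map f m' ≡ just k → ∃ λ k' → m ≡ just k' × m' ≡ just k'
  map-injective inj (just a) (just b) refl e = a , refl , cong just (inj (just-injective e))

  map-just : ∀ {A B : Set} {f : A → B} m {k} → Maybe.map f m ≡ just k → ∃ λ a → k ≡ f a
  map-just (just a) refl = a , refl

  module _ {n} {z : Fin n → ℚ} where
    root-tied : ∀ {A l d r} → Rigid z (node A l d r) → Good (node A l d r) → ∀ {i} (p : InTree i (node A l d r)) →
      cls (node A l d r) p ≡ nothing → ∀ {a} → a ∈ A → z i ≡ z a
    root-tied (eqs , _) _ (inj₁ i∈A) _ a∈A = eqs i∈A a∈A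
    root-tied {d = true} {r@(node B _ _ _)} (_ , edge , _ , rr) (_ , _ , _ , gr@((b , b∈B) , _)) (inj₂ (inj₂ p)) e a∈A =
      trans (root-tied rr gr p (map-nothing (cls r p) e) b∈B) (edge a∈A b∈B)

    mutual
      cls-tied : ∀ t → Rigid z t → Good t → ∀ {i j} (p : InTree i t) (q : InTree j t) {k} →
        cls t p ≡ just k → cls t q ≡ just k → z i ≡ z j
      cls-tied (node A l d r) (_ , _ , rl , _) (_ , _ , gl , _) (inj₂ (inj₁ p)) (inj₂ (inj₁ q)) e e' =
        cluster-tied l rl gl p q (Finₚ.↑ˡ-injective _ _ _ (just-injective (trans e (sym e'))))
      cls-tied (node A l false r) (_ , _ , _ , rr) (_ , _ , _ , gr) (inj₂ (inj₂ p)) (inj₂ (inj₂ q)) e e' =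
        cluster-tied r rr gr p q (Finₚ.↑ʳ-injective _ _ _ (just-injective (trans e (sym e'))))
      cls-tied (node A l true r) (_ , _ , _ , rr) (_ , _ , _ , gr) (inj₂ (inj₂ p)) (inj₂ (inj₂ q)) e e'
        with map-injective (λ {x} {y} → Finₚ.↑ʳ-injective _ x y) (cls r p) (cls r q) e e'
      ... | _ , f , f' = cls-tied r rr gr p q f f'
      cls-tied (node A l false r) _ _ (inj₂ (inj₁ p)) (inj₂ (inj₂ q)) e e' =
        ⊥-elim (↑ˡ≢↑ʳ _ _ (just-injective (trans e (sym e'))))
      cls-tied (node A l false r) _ _ (inj₂ (inj₂ p)) (inj₂ (inj₁ q)) e e' =
        ⊥-elim (↑ˡ≢↑ʳ _ _ (just-injective (trans e' (sym e))))
      cls-tied (node A l true r) _ _ (inj₂ (inj₁ p)) (inj₂ (inj₂ q)) e e' =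
        ⊥-elim (↑ˡ≢↑ʳ _ _ (trans (just-injective e) (proj₂ (map-just (cls r q) e'))))
      cls-tied (node A l true r) _ _ (inj₂ (inj₂ p)) (inj₂ (inj₁ q)) e e' =
        ⊥-elim (↑ˡ≢↑ʳ _ _ (trans (just-injective e') (proj₂ (map-just (cls r p) e))))

      cluster-tied : ∀ t → Rigid z t → Good t → ∀ {i j} (p : InTree i t) (q : InTree j t) → cluster t p ≡ cluster t q → z i ≡ z j
      cluster-tied t@(node A l d r) rt gt@((a , a∈A) , _) p q e with cls t p in ep | cls t q in eq
      ... | nothing | nothing = trans (root-tied {l = l} {r = r} rt gt p ep a∈A) (sym (root-tied {l = l} {r = r} rt gt q eq a∈A))
      ... | just k | just k' = cls-tied t rt gt p q ep (trans eq (cong just (sym (Finₚ.suc-injective e))))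
      cluster-tied t@(node A l d r) rt gt p q () | nothing | just _
      cluster-tied t@(node A l d r) rt gt p q () | just _ | nothing

  -- The pairs that a run can equate, directly or up to the unit shift along a dashed edge.
  Link : ∀ {n} → DTree n → Fin n → Fin n → Set
  Link leaf i j = ⊥
  Link (node A l d r) i j = (i ∈ A × j ∈ A) ⊎ (Captive d r i × j ∈ A) ⊎ Link l i j ⊎ Link r i j

  link⇒cls : ∀ {n} (t : DTree n) {i j} → Link t i j → Σ (InTree i t) λ p → Σ (InTree j t) λ q → cls t p ≡ cls t q
  link⇒cls (node A l d r) (inj₁ (i∈A , j∈A)) = inj₁ i∈A , inj₁ j∈A , refl
  link⇒cls (node A l true (node B _ _ _)) (inj₂ (inj₁ (i∈B , j∈A))) = inj₂ (inj₂ (inj₁ i∈B)) , inj₁ j∈A , refl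
  link⇒cls (node A l d r) (inj₂ (inj₂ (inj₁ link))) with link⇒cls l link
  ... | p , q , e = inj₂ (inj₁ p) , inj₂ (inj₁ q) , cong (λ c → just (c ↑ˡ _)) (cls⇒cluster l p q e)
  link⇒cls (node A l false r) (inj₂ (inj₂ (inj₂ link))) with link⇒cls r link
  ... | p , q , e = inj₂ (inj₂ p) , inj₂ (inj₂ q) , cong (λ c → just (freeCount true l ↑ʳ c)) (cls⇒cluster r p q e)
  link⇒cls (node A l true r) (inj₂ (inj₂ (inj₂ link))) with link⇒cls r link
  ... | p , q , e = inj₂ (inj₂ p) , inj₂ (inj₂ q) , cong (Maybe.map (freeCount true l ↑ʳ_)) e

  -- Since `cls` is computed from a position, multiplicity at most one is what makes it a function
  -- of the index.
  cls-unique : ∀ {n} (t : DTree n) {i} → treeCount i t ℕ.≤ 1 → (p q : InTree i t) → cls t p ≡ cls t q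
  cls-unique (node A l d r) {i} once p q = go d p q
    where
    once' : bit (lookup A i) ℕ.+ (treeCount i l ℕ.+ treeCount i r) ℕ.≤ 1
    once' = subst (λ c → bit (lookup A i) ℕ.+ c ℕ.≤ 1) (countIn-++ i (dlabels l) (dlabels r)) once
    onceLR : treeCount i l ℕ.+ treeCount i r ℕ.≤ 1
    onceLR = ℕₚ.≤-trans (ℕₚ.m≤n+m _ (bit (lookup A i))) once'
    atA : i ∈ A → 1 ℕ.≤ bit (lookup A i)
    atA i∈A = ℕₚ.≤-reflexive (sym (∈⇒bit i∈A))
    below : InTree i l ⊎ InTree i r → 1 ℕ.≤ treeCount i l ℕ.+ treeCount i r
    below (inj₁ p) = ℕₚ.≤-trans (inTree⇒count l p) (ℕₚ.m≤m+n _ _)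
    below (inj₂ p) = ℕₚ.≤-trans (inTree⇒count r p) (ℕₚ.m≤n+m _ _)
    go : ∀ d (p q : InTree i (node A l d r)) → cls (node A l d r) p ≡ cls (node A l d r) q
    go d (inj₁ _) (inj₁ _) = refl
    go d (inj₁ i∈A) (inj₂ q) = ⊥-elim (¬≤1 (atA i∈A) (below q) once')
    go d (inj₂ p) (inj₁ i∈A) = ⊥-elim (¬≤1 (atA i∈A) (below p) once')
    go d (inj₂ (inj₁ p)) (inj₂ (inj₁ q)) = cong (λ c → just (c ↑ˡ _))
      (cls⇒cluster l p q (cls-unique l (ℕₚ.≤-trans (ℕₚ.m≤m+n _ _) onceLR) p q))
    go false (inj₂ (inj₂ p)) (inj₂ (inj₂ q)) = cong (λ c → just (freeCount true l ↑ʳ c))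
      (cls⇒cluster r p q (cls-unique r (ℕₚ.≤-trans (ℕₚ.m≤n+m _ (treeCount i l)) onceLR) p q))
    go true (inj₂ (inj₂ p)) (inj₂ (inj₂ q)) = cong (Maybe.map (freeCount true l ↑ʳ_))
      (cls-unique r (ℕₚ.≤-trans (ℕₚ.m≤n+m _ (treeCount i l)) onceLR) p q)
    go d (inj₂ (inj₁ p)) (inj₂ (inj₂ q)) = ⊥-elim (¬≤1 (inTree⇒count l p) (inTree⇒count r q) onceLR)
    go d (inj₂ (inj₂ p)) (inj₂ (inj₁ q)) = ⊥-elim (¬≤1 (inTree⇒count l q) (inTree⇒count r p) onceLR)

  LinkBehind : ∀ {n} → Fin n → Fin n → Entry n → Set
  LinkBehind i j (A , d , r) = Link r i j

  StateLink : ∀ {n} → DTree n → Queue n → Fin n → Fin n → Set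
  StateLink t Q i j = Link t i j ⊎ Any (LinkBehind i j) Q

  link-open : ∀ {n} {B : Subset n} {l d r Q i j} → StateLink l (Q ∷ʳ (B , d , r)) i j → StateLink (node B l d r) Q i j
  link-open (inj₁ p) = inj₁ (inj₂ (inj₂ (inj₁ p)))
  link-open {Q = Q} (inj₂ p) with Anyₚ.++⁻ Q p
  ... | inj₁ q = inj₂ q
  ... | inj₂ (here q) = inj₁ (inj₂ (inj₂ (inj₂ q)))

  link-close : ∀ {n} {A : Subset n} {d r Q i j} → StateLink r Q i j → StateLink leaf ((A , d , r) ∷ Q) i j
  link-close (inj₁ p) = inj₂ (here p)
  link-close (inj₂ p) = inj₂ (there p)

  module _ {n} {x : Point n} where
    equal⇒link : ∀ {t Q} → Run x t Q → ∀ {i j} → Rem t Q i → Rem t Q j → x i ≡ x j → StateLink t Q i j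
    equal⇒link done (inj₂ ())
    equal⇒link (close _ _ run) ri rj e = link-close (equal⇒link run (rem-close⁻ ri) (rem-close⁻ rj) e)
    equal⇒link (start eqs lts _ run) ri rj e with rem-open⁻ ri | rem-open⁻ rj
    ... | inj₁ i∈B | inj₁ j∈B = inj₁ (inj₁ (i∈B , j∈B))
    ... | inj₁ i∈B | inj₂ rj' = ⊥-elim (ℚₚ.<-irrefl e (lts i∈B rj'))
    ... | inj₂ ri' | inj₁ j∈B = ⊥-elim (ℚₚ.<-irrefl (sym e) (lts j∈B ri'))
    ... | inj₂ ri' | inj₂ rj' = link-open (equal⇒link run ri' rj' e)

    -- A visible equality can only come from a dashed edge: a block read before the closing lies
    -- strictly below `x a + 1ℚ`, and one read after it without being captive lies strictly above.
    unit⇒captive : ∀ {t Q} → Run x t Q → ∀ {a b} → Rem t Q b → b Fin.< a → x b ≡ x a + 1ℚ →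
      All (λ (A , d , r) → a ∈ A → Captive d r b) Q
    unit⇒captive done _ _ _ = []
    unit⇒captive (close {A} {d} {r} {Q} _ gts run) {a} {b} rem b<a e = head ∷ unit⇒captive run (rem-close⁻ rem) b<a e
      where
      head : a ∈ A → Captive d r b
      head a∈A with captive? d r b
      ... | yes cap = cap
      ... | no ncap = ⊥-elim (ℚₚ.<-irrefl (sym e) (gts a∈A (rem-close⁻ rem) ncap b<a))
    unit⇒captive (start {Q = Q} _ _ uns run) {a} {b} rem b<a e with rem-open⁻ rem
    ... | inj₂ rem' = Allₚ.++⁻ˡ Q (unit⇒captive run rem' b<a e)
    ... | inj₁ b∈B = All.tabulate λ e∈Q a∈A → ⊥-elim (ℚₚ.<-irrefl e (uns (lose e∈Q a∈A) b∈B b<a))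

    unit⇒link : ∀ {t Q} → Run x t Q → ∀ {b a} → Rem t Q b → Rem t Q a → b Fin.< a → x b ≡ x a + 1ℚ → StateLink t Q b a
    unit⇒link done (inj₂ ())
    unit⇒link (close _ _ run) rb ra b<a e = link-close (unit⇒link run (rem-close⁻ rb) (rem-close⁻ ra) b<a e)
    unit⇒link (start {Q = Q} eqs lts _ run) rb ra b<a e with rem-open⁻ rb | rem-open⁻ ra
    ... | inj₁ b∈B | inj₁ a∈B = ⊥-elim (ℚₚ.<-irrefl e (≡⇒<+1 (eqs b∈B a∈B)))
    ... | inj₁ b∈B | inj₂ ra' = ⊥-elim (ℚₚ.<-irrefl e (ℚₚ.<-trans (lts b∈B ra') p<p+1))
    ... | inj₂ rb' | inj₂ ra' = link-open (unit⇒link run rb' ra' b<a e)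
    ... | inj₂ rb' | inj₁ a∈B =
      inj₁ (inj₂ (inj₁ (All.head (Allₚ.++⁻ʳ Q (unit⇒captive run rb' b<a e)) a∈B , a∈B)))

  module _ {n} {x y : Point n} where
    private
      z : Fin n → ℚ
      z i = x i - y i

    -- Constancy on `A` was recorded when the block was started and is out of sight when it is
    -- closed, so it enters as a premise, discharged at the start.
    EdgeRigid : Entry n → Set
    EdgeRigid (A , d , r) = Rigid z r ×
      ((∀ {a a'} → a ∈ A → a' ∈ A → z a ≡ z a') → ∀ {a b} → a ∈ A → Captive d r b → z b ≡ z a)

    rigid : ∀ {t Q} → Run x t Q → Run y t Q → Good t → All GoodEntry Q → Rigid z t × All EdgeRigid Q
    rigid done done _ _ = tt , []
    rigid (close {A} {d} {r} eqs _ run) (close eqs' _ run') _ ((re , gr) ∷ goods) with rigid run run' gr goods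
    ... | rr , rQ = tt , (rr , edge d r re rr eqs eqs') ∷ rQ
      where
      edge : ∀ d r → RightEdgeOK A d r → Rigid z r →
        (∀ {a b} → a ∈ A → Captive d r b → b Fin.< a → x b ≡ x a + 1ℚ) →
        (∀ {a b} → a ∈ A → Captive d r b → b Fin.< a → y b ≡ y a + 1ℚ) →
        (∀ {a a'} → a ∈ A → a' ∈ A → z a ≡ z a') → ∀ {a b} → a ∈ A → Captive d r b → z b ≡ z a
      -- The run grants the unit equality only for `b < a`. The descent is one such pair, and
      -- constancy on both blocks spreads it to all pairs.
      edge true (node B _ _ _) (a₀ , b₀ , a₀∈A , b₀∈B , b₀<a₀) (eqB , _) ex ey eqA {a} {b} a∈A b∈B = begin
        x b - y b                    ≡⟨ eqB b∈B b₀∈B ⟩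
        x b₀ - y b₀                  ≡⟨ cong₂ _-_ (ex a₀∈A b₀∈B b₀<a₀) (ey a₀∈A b₀∈B b₀<a₀) ⟩
        (x a₀ + 1ℚ) - (y a₀ + 1ℚ)    ≡⟨ solve 3 (λ p q u → (p :+ u) :- (q :+ u) := p :- q) refl (x a₀) (y a₀) 1ℚ ⟩
        x a₀ - y a₀                  ≡⟨ eqA a₀∈A a∈A ⟩
        x a - y a                    ∎
        where
        open ≡-Reasoning
        open +-*-Solver
    rigid (start {B} {l} {d} {r} {Q} eqs _ _ run) (start eqs' _ _ run') (_ , re , gl , gr) goods
      with rigid run run' gl (Allₚ.++⁺ goods ((re , gr) ∷ []))
    ... | rl , rQ with Allₚ.++⁻ʳ Q rQ
    ...   | (rr , edge) ∷ [] = (eqB , edge eqB , rl , rr) , Allₚ.++⁻ˡ Q rQ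
      where
      eqB : ∀ {a a'} → a ∈ B → a' ∈ B → z a ≡ z a'
      eqB a∈ a'∈ = cong₂ _-_ (eqs a∈ a'∈) (eqs' a∈ a'∈)

  run⇒dimension : ∀ {n} {σ : SignVector n} {x t} → InFace σ x → Run x t [] → Good t → (∀ i → treeCount i t ≡ 1) →
    AffineDim (InFace σ) (freeNodes t)
  run⇒dimension {n} {σ} {x} {t} x∈σ run good counts =
    FaceDimension.dimension σ x x∈σ class (λ j → proj₁ (cluster-rep t good j)) class-rep equal⇒class rigid-class
    where
    member : ∀ i → InTree i t
    member i = count⇒inTree t (ℕₚ.≤-reflexive (sym (counts i)))
    class : Fin n → Fin (freeNodes t)
    class i = cluster t (member i)
    class≡ : ∀ {i} (p : InTree i t) → class i ≡ cluster t p
    class≡ {i} p = cls⇒cluster t (member i) p (cls-unique t (ℕₚ.≤-reflexive (counts i)) (member i) p)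
    class-rep : ∀ j → class (proj₁ (cluster-rep t good j)) ≡ j
    class-rep j with cluster-rep t good j
    ... | i , p , e = trans (class≡ p) e
    link⇒class : ∀ {i j} → StateLink t [] i j → class i ≡ class j
    link⇒class (inj₁ link) with link⇒cls t link
    ... | p , q , e = trans (class≡ p) (trans (cls⇒cluster t p q e) (sym (class≡ q)))
    equal⇒class : ∀ i j c → i Fin.< j → σ i j c ≡ Sign.eq → class i ≡ class j
    equal⇒class i j c i<j e = go c
      (SatSign-shift Sign.eq (x i) (x j) (const c) (subst (λ s → SatSign s (x i - x j) (const c)) e (x∈σ i j i<j c)))
      where
      go : ∀ c → x i ≡ x j + const c → class i ≡ class j
      go zero eq = link⇒class (equal⇒link run (inj₁ (member i)) (inj₁ (member j)) (trans eq (ℚₚ.+-identityʳ (x j))))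
      go (suc zero) eq = link⇒class (unit⇒link run (inj₁ (member i)) (inj₁ (member j)) i<j eq)
    rigid-class : ∀ y y' → InFace σ y → InFace σ y' → ∀ i j → class i ≡ class j → y i - y' i ≡ y j - y' j
    rigid-class y y' y∈σ y'∈σ i j e = cluster-tied {z = λ i → y i - y' i} t
      (proj₁ (rigid (run-transfer (same-face {σ = σ} {x} {y} x∈σ y∈σ) run) (run-transfer (same-face {σ = σ} {x} {y'} x∈σ y'∈σ) run) good []))
      good (member i) (member j) e

  wf⇒good : ∀ {n} (t : DTree n) → All Nonempty (dlabels t) → DWellFormed t → Good t
  wf⇒good leaf _ _ = tt
  wf⇒good (node A l d r) (ne ∷ nes) (re , wl , wr) =
    ne , re , wf⇒good l (Allₚ.++⁻ˡ (dlabels l) nes) wl , wf⇒good r (Allₚ.++⁻ʳ (dlabels l) nes) wr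

  good⇒wf : ∀ {n} (t : DTree n) → Good t → All Nonempty (dlabels t) × DWellFormed t
  good⇒wf leaf _ = [] , tt
  good⇒wf (node A l d r) (ne , re , gl , gr) with good⇒wf l gl | good⇒wf r gr
  ... | nl , wl | nr , wr = ne ∷ Allₚ.++⁺ nl nr , re , wl , wr

  signsOf : ∀ {n} → Point n → SignVector n
  signsOf x i j c = sign (x i - x j) (const c)

  signsOf-face : ∀ {n} (x : Point n) → InFace (signsOf x) x
  signsOf-face x i j _ c = sign-sat (x i - x j) (const c)

  -- The tree is computed from the witness point of a face; uniqueness of runs makes it independent
  -- of that point.
  ShiFaces≅𝒯 : ∀ n k → ShiFaces n k ≅ 𝒯 n k
  ShiFaces≅𝒯 n k = inverse-from-section (ShiFaces n k) (𝒯 n k) to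
    (λ {F} {F'} → to-cong {F} {F'}) (λ {F} {F'} → to-injective {F} {F'}) section
    where
    open Greedy using (treeOf)
    Face = Σ (SignVector n) (IsShiFace n k)
    point : Face → Point n
    point (_ , (x , _) , _) = x
    in-face : (F : Face) → InFace (proj₁ F) (point F)
    in-face (_ , (_ , x∈σ) , _) = x∈σ
    tree : Face → DTree n
    tree F = proj₁ (treeOf (point F))
    tree-run : (F : Face) → Run (point F) (tree F) []
    tree-run F = proj₁ (proj₂ (treeOf (point F)))
    tree-good : (F : Face) → Good (tree F)
    tree-good F = proj₁ (proj₂ (proj₂ (treeOf (point F))))
    tree-counts : (F : Face) → ∀ i → treeCount i (tree F) ≡ 1
    tree-counts F = proj₂ (proj₂ (proj₂ (treeOf (point F))))
    free : (F : Face) → freeNodes (tree F) ≡ k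
    free F@(σ , _ , dim) = AffineDim-unique {S = InFace σ} (run⇒dimension {σ = σ} {x = point F} (in-face F) (tree-run F) (tree-good F) (tree-counts F)) dim
    to : Face → Σ (DTree n) (IsT n k)
    to F with good⇒wf (tree F) (tree-good F)
    ... | ne , wf = tree F , (ne , tree-counts F) , wf , free F
    inTree : ∀ {t : DTree n} → (∀ i → treeCount i t ≡ 1) → ∀ i → InTree i t
    inTree {t} counts i = count⇒inTree t (ℕₚ.≤-reflexive (sym (counts i)))
    same-tree : ∀ {x y : Point n} {t t'} → Same x y → Same y x → Run x t [] → Run y t' [] → Good t → Good t' →
      (∀ i → treeCount i t ≡ 1) → (∀ i → treeCount i t' ≡ 1) → t ≡ t'
    same-tree xy yx run run' good good' counts counts' = proj₁ (run-unique xy yx run run' refl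
      (λ _ → inj₁ (inTree counts' _)) (λ _ → inj₁ (inTree counts _)) good good' [] [])
    move : ∀ {σ σ' : SignVector n} → (∀ i j → i Fin.< j → ∀ c → σ i j c ≡ σ' i j c) → ∀ {x} → InFace σ' x → InFace σ x
    move e {x} x∈σ' i j i<j c = subst (λ s → SatSign s (x i - x j) (const c)) (sym (e i j i<j c)) (x∈σ' i j i<j c)
    to-cong : ∀ {F F' : Face} → (∀ i j → i Fin.< j → ∀ c → proj₁ F i j c ≡ proj₁ F' i j c) → tree F ≡ tree F'
    to-cong {F} {F'} e = same-tree (same-face {σ = proj₁ F} {point F} {point F'} (in-face F) y∈) (same-face {σ = proj₁ F} {point F'} {point F} y∈ (in-face F))
      (tree-run F) (tree-run F') (tree-good F) (tree-good F') (tree-counts F) (tree-counts F')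
      where
      y∈ : InFace (proj₁ F) (point F')
      y∈ = move {proj₁ F} {proj₁ F'} e {point F'} (in-face F')
    to-injective : ∀ {F F' : Face} → tree F ≡ tree F' → ∀ i j → i Fin.< j → ∀ c → proj₁ F i j c ≡ proj₁ F' i j c
    to-injective {F} {F'} e i j i<j c = sat-unique _ _
      (run-determines-signs (tree-run F) (subst (λ t → Run (point F') t []) (sym e) (tree-run F')) (inTree (tree-counts F))
        i j i<j c _ (in-face F i j i<j c))
      (in-face F' i j i<j c)
    section : ∀ (T : Σ (DTree n) (IsT n k)) → ∃ λ F → tree F ≡ proj₁ T
    section (t , (ne , counts) , wf , refl) with realizable t (wf⇒good t ne wf) (λ i → ℕₚ.≤-reflexive (counts i))
    -- The canonical tree of the realizing point is the given tree, since both have a run over that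
    -- point.
    ... | x , run = F , same-tree x~x x~x (tree-run F) run (tree-good F) (wf⇒good t ne wf) (tree-counts F) counts
      where
      σ : SignVector n
      σ = signsOf x
      x~x : Same x x
      x~x = record { order = λ _ _ _ h → h ; unit = λ _ _ _ _ h → h }
      F : Face
      F = σ , (x , signsOf-face x) , run⇒dimension {σ = σ} {x = x} (signsOf-face x) run (wf⇒good t ne wf) counts

-- Acyclic parent maps and their Prüfer codes.

module ParentMaps where
  open Bijections
  open import Data.Nat using (_≤_; _<_)
  open import Data.Fin.Relation.Unary.Top using (view; ‵fromℕ; ‵inj₁)
  import Data.Vec.Properties as Vecₚ
  import Data.List.Properties as Listₚ
  open import Data.List.Membership.Propositional using (_∈_; _∉_)
  import Data.List.Membership.DecPropositional as DecMem

  -- A map p : [n] → [n+1] is read as a parent map with root n+1, the vertex fromℕ n.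
  data Reach {n} (p : Fin n → Fin (suc n)) : Fin (suc n) → Set where
    root : ∀ {v} → v ≡ fromℕ n → Reach p v
    step : ∀ {v} i → v ≡ inject₁ i → Reach p (p i) → Reach p v

  depth : ∀ {n} {p : Fin n → Fin (suc n)} {v} → Reach p v → ℕ
  depth (root _) = 0
  depth (step _ _ r) = suc (depth r)

  depth-unique : ∀ {n} {p : Fin n → Fin (suc n)} {v} (r r' : Reach p v) → depth r ≡ depth r'
  depth-unique (root _) (root _) = refl
  depth-unique (root e) (step i e' _) = ⊥-elim (Finₚ.fromℕ≢inject₁ (trans (sym e) e'))
  depth-unique (step i e' _) (root e) = ⊥-elim (Finₚ.fromℕ≢inject₁ (trans (sym e) e'))
  depth-unique {p = p} (step i e r) (step j e' r') with refl ← Finₚ.inject₁-injective (trans (sym e) e') =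
    cong suc (depth-unique r r')

  Acyclic : ∀ {n} → (Fin n → Fin (suc n)) → Set
  Acyclic p = ∀ v → Reach p v

  acyclic : ∀ {n} {p : Fin n → Fin (suc n)} → (∀ i → Reach p (inject₁ i)) → Acyclic p
  acyclic reach v with view v
  ... | ‵fromℕ = root refl
  ... | ‵inj₁ {i = i} _ = reach i

  parent-shallower : ∀ {n} {p : Fin n → Fin (suc n)} (ac : Acyclic p) i → depth (ac (p i)) < depth (ac (inject₁ i))
  parent-shallower {p = p} ac i = ℕₚ.≤-reflexive (depth-unique (step i refl (ac (p i))) (ac (inject₁ i)))

  -- The common form of 𝒰, 𝒱 and 𝒲: a mark requires a child, which is a left child in 𝒰, a second
  -- neighbour in 𝒱 and an occurrence in the code in 𝒲.
  IsP : (n k : ℕ) → Vec (Fin (suc n)) n × Subset n → Set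
  IsP n k (p , M) = Acyclic (lookup p)
                  × (∀ i → i Subset.∈ M → ∃ λ j → lookup p j ≡ inject₁ i)
                  × ∣ M ∣ ≡ n ∸ k

  𝒫 : ℕ → ℕ → _
  𝒫 n k = SubSetoid (Vec (Fin (suc n)) n × Subset n) (IsP n k)

  lookup-ext : ∀ {A : Set} {n} {u v : Vec A n} → (∀ i → lookup u i ≡ lookup v i) → u ≡ v
  lookup-ext {u = u} {v} e = trans (sym (Vecₚ.tabulate∘lookup u)) (trans (Vecₚ.tabulate-cong e) (Vecₚ.tabulate∘lookup v))

  boolToFin : Bool → Fin 2
  boolToFin false = zero
  boolToFin true = suc zero

  boolToFin-injective : ∀ {a b} → boolToFin a ≡ boolToFin b → a ≡ b
  boolToFin-injective {false} {false} _ = refl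
  boolToFin-injective {true} {true} _ = refl

  funToFin-injective : ∀ {m n} {f g : Fin m → Fin n} → funToFin f ≡ funToFin g → ∀ i → f i ≡ g i
  funToFin-injective {f = f} {g} e i =
    trans (sym (Finₚ.finToFun-funToFin f i)) (trans (cong (λ c → finToFun c i) e) (Finₚ.finToFun-funToFin g i))

  -- An embedding into a finite set, for the counting argument of `inverse-from-injections`.
  rankP : ∀ {n} → Vec (Fin (suc n)) n × Subset n → Fin ((suc n ℕ.^ n) ℕ.* (2 ℕ.^ n))
  rankP (p , M) = combine (funToFin (lookup p)) (funToFin (boolToFin ∘ lookup M))

  rankP-injective : ∀ {n} {a b : Vec (Fin (suc n)) n × Subset n} → rankP a ≡ rankP b → a ≡ b
  rankP-injective {n} {p , M} {p' , M'} e with Finₚ.combine-injective {suc n ℕ.^ n} {2 ℕ.^ n} _ _ _ _ e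
  ... | e₁ , e₂ = cong₂ _,_ (lookup-ext (funToFin-injective e₁)) (lookup-ext (boolToFin-injective ∘ funToFin-injective e₂))

  -- Prüfer codes

  module _ {n : ℕ} where
    open DecMem (Finₚ._≟_ {suc n}) using (_∈?_)

    -- One Prüfer step: with `C` the code of the remaining vertices `X`, its entries are exactly the
    -- parents among them, so `v` is the first remaining leaf and `Y` is what is left after its
    -- removal.
    data First (C : List (Fin (suc n))) : List (Fin n) → Fin n → List (Fin n) → Set where
      hit : ∀ {v X} → inject₁ v ∉ C → First C (v ∷ X) v X
      skip : ∀ {u v X Y} → inject₁ u ∈ C → First C X v Y → First C (u ∷ X) v (u ∷ Y)

    first-unique : ∀ {C X v v' Y Y'} → First C X v Y → First C X v' Y' → v ≡ v' × Y ≡ Y'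
    first-unique (hit _) (hit _) = refl , refl
    first-unique (hit ∉C) (skip ∈C _) = ⊥-elim (∉C ∈C)
    first-unique (skip ∈C _) (hit ∉C) = ⊥-elim (∉C ∈C)
    first-unique (skip _ f) (skip _ f') with refl , refl ← first-unique f f' = refl , refl

    first-resp : ∀ {C C' X v Y} → (∀ {u} → inject₁ u ∈ C → inject₁ u ∈ C') → (∀ {u} → inject₁ u ∈ C' → inject₁ u ∈ C) →
      First C X v Y → First C' X v Y
    first-resp to from (hit ∉C) = hit (∉C ∘ from)
    first-resp to from (skip ∈C f) = skip (to ∈C) (first-resp to from f)

    first? : ∀ C X → (∀ {u} → u ∈ X → inject₁ u ∈ C) ⊎ (∃ λ v → ∃ λ Y → First C X v Y)
    first? C [] = inj₁ λ ()
    first? C (u ∷ X) with inject₁ u ∈? C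
    ... | no ∉C = inj₂ (u , X , hit ∉C)
    ... | yes ∈C with first? C X
    ...   | inj₁ all = inj₁ λ { (here refl) → ∈C ; (there u∈X) → all u∈X }
    ...   | inj₂ (v , Y , f) = inj₂ (v , u ∷ Y , skip ∈C f)

    first-∈ : ∀ {C X v Y} → First C X v Y → v ∈ X
    first-∈ (hit _) = here refl
    first-∈ (skip _ f) = there (first-∈ f)

    first-∉ : ∀ {C X v Y} → First C X v Y → inject₁ v ∉ C
    first-∉ (hit ∉C) = ∉C
    first-∉ (skip _ f) = first-∉ f

    first-⊆ : ∀ {C X v Y} → First C X v Y → ∀ {u} → u ∈ Y → u ∈ X
    first-⊆ (hit _) u∈ = there u∈
    first-⊆ (skip _ f) (here e) = here e
    first-⊆ (skip _ f) (there u∈) = there (first-⊆ f u∈)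

    first-split : ∀ {C X v Y} → First C X v Y → ∀ {u} → u ∈ X → u ≡ v ⊎ u ∈ Y
    first-split (hit _) (here e) = inj₁ e
    first-split (hit _) (there u∈) = inj₂ u∈
    first-split (skip _ f) (here e) = inj₂ (here e)
    first-split (skip _ f) (there u∈) with first-split f u∈
    ... | inj₁ e = inj₁ e
    ... | inj₂ u∈Y = inj₂ (there u∈Y)

    first-length : ∀ {C X v Y} → First C X v Y → length X ≡ suc (length Y)
    first-length (hit _) = refl
    first-length (skip _ f) = cong suc (first-length f)

    first-all : ∀ {P : Fin n → Set} {C X v Y} → First C X v Y → All P X → All P Y
    first-all (hit _) (_ ∷ ps) = ps
    first-all (skip _ f) (p ∷ ps) = p ∷ first-all f ps

    first-unique-list : ∀ {C X v Y} → First C X v Y → Unique X → Unique Y × v ∉ Y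
    first-unique-list (hit _) (v∉ ∷ uX) = uX , Allₚ.All¬⇒¬Any v∉
    first-unique-list (skip _ f) (u∉ ∷ uX) with first-unique-list f uX
    ... | uY , v∉Y = first-all f u∉ ∷ uY , λ { (here refl) → All.lookup u∉ (first-∈ f) refl ; (there v∈) → v∉Y v∈ }

    -- Leaves are tested against the code and not against `p`, so the same relation serves for
    -- encoding and decoding. One entry is kept for every vertex of `X`; the usual code omits the
    -- last, which is the root.
    data Code (p : Fin n → Fin (suc n)) : List (Fin n) → List (Fin (suc n)) → Set where
      [] : Code p [] []
      cons : ∀ {c C X v Y} → First (c ∷ C) X v Y → p v ≡ c → Code p Y C → Code p X (c ∷ C)

    module _ {p : Fin n → Fin (suc n)} where
      code-image⁻ : ∀ {X C c} → Code p X C → c ∈ C → ∃ λ u → u ∈ X × p u ≡ c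
      code-image⁻ (cons f e code) (here refl) = _ , first-∈ f , e
      code-image⁻ (cons f e code) (there c∈) with code-image⁻ code c∈
      ... | u , u∈Y , e' = u , first-⊆ f u∈Y , e'

      code-image⁺ : ∀ {X C u} → Code p X C → u ∈ X → p u ∈ C
      code-image⁺ (cons f e code) u∈X with first-split f u∈X
      ... | inj₁ refl = here e
      ... | inj₂ u∈Y = there (code-image⁺ code u∈Y)

      code-length : ∀ {X C} → Code p X C → length C ≡ length X
      code-length [] = refl
      code-length (cons f _ code) = trans (cong suc (code-length code)) (sym (first-length f))

      code-⊆ : ∀ {X C C' c} → Code p X C → Code p X C' → c ∈ C → c ∈ C'
      code-⊆ code code' c∈C with code-image⁻ code c∈C
      ... | u , u∈X , refl = code-image⁺ code' u∈X

      -- Both codes have the image of `X` under `p` as their set of entries, so they agree on which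
      -- vertex is the first leaf.
      encode-unique : ∀ {X C C'} → Code p X C → Code p X C' → C ≡ C'
      encode-unique [] [] = refl
      encode-unique [] (cons () _ _)
      encode-unique code@(cons f e sub) code'@(cons f' e' sub')
        with refl , refl ← first-unique f (first-resp (code-⊆ code' code) (code-⊆ code code') f')
        = cong₂ _∷_ (trans (sym e) e') (encode-unique sub sub')

      -- The removed vertex does not occur in the code from its own entry on. Hence parents of the
      -- rest stay in the rest or are the root, and so does the parent of the removed vertex.
      code-reach : ∀ {X C} → Code p X C → All (λ c → c ≡ fromℕ n ⊎ ∃ λ w → w ∈ X × c ≡ inject₁ w) C →
        ∀ {u} → u ∈ X → Reach p (inject₁ u)
      code-reach {X} (cons {v = v} {Y} f e code) (c∈ ∷ C∈) u∈X = [ (λ { refl → reach-v c∈ }) , reach-Y ]′ (first-split f u∈X)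
        where
        shrink : ∀ {c} → c ∈ _ ∷ _ → c ≡ fromℕ n ⊎ (∃ λ w → w ∈ X × c ≡ inject₁ w) → c ≡ fromℕ n ⊎ ∃ λ w → w ∈ Y × c ≡ inject₁ w
        shrink _ (inj₁ e) = inj₁ e
        shrink c∈C (inj₂ (w , w∈X , refl)) with first-split f w∈X
        ... | inj₁ refl = ⊥-elim (first-∉ f c∈C)
        ... | inj₂ w∈Y = inj₂ (w , w∈Y , refl)
        reach-Y : ∀ {u} → u ∈ Y → Reach p (inject₁ u)
        reach-Y = code-reach code (All.tabulate λ c∈C → shrink (there c∈C) (All.lookup C∈ c∈C))
        reach-v : _ → Reach p (inject₁ v)
        reach-v c∈ with shrink (here refl) c∈
        ... | inj₁ c≡top = step v refl (root (trans e c≡top))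
        ... | inj₂ (w , w∈Y , c≡w) = step v refl (subst (Reach p) (sym (trans e c≡w)) (reach-Y w∈Y))

      deepest : (ac : Acyclic p) → ∀ u X → ∃ λ v → v ∈ u ∷ X × (∀ {w} → w ∈ u ∷ X → depth (ac (inject₁ w)) ≤ depth (ac (inject₁ v)))
      deepest ac u [] = u , here refl , λ { (here refl) → ℕₚ.≤-refl }
      deepest ac u (u' ∷ X) with deepest ac u' X
      ... | v , v∈ , max with ℕₚ.≤-total (depth (ac (inject₁ u))) (depth (ac (inject₁ v)))
      ...   | inj₁ le = v , there v∈ , λ { (here refl) → le ; (there w∈) → max w∈ }
      ...   | inj₂ le = u , here refl , λ { (here refl) → ℕₚ.≤-refl ; (there w∈) → ℕₚ.≤-trans (max w∈) le }

      encode : Acyclic p → ∀ m X → length X ≡ m → ∃ λ C → Code p X C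
      -- Before the code is known, `map p X` replaces it in the leaf test; the two have the same
      -- members.
      encode ac zero [] _ = [] , []
      encode ac (suc m) X@(u₀ ∷ X₀) len with first? (map p X) X
      ... | inj₂ (v , Y , f) with encode ac m Y (ℕₚ.suc-injective (trans (sym (first-length f)) len))
      ...   | C , code = p v ∷ C , cons (first-resp to from f) refl code
        where
        to : ∀ {c} → c ∈ map p X → c ∈ p v ∷ C
        to c∈ with ∈ₚ.∈-map⁻ p c∈
        ... | u , u∈X , refl with first-split f u∈X
        ...   | inj₁ refl = here refl
        ...   | inj₂ u∈Y = there (code-image⁺ code u∈Y)
        from : ∀ {c} → c ∈ p v ∷ C → c ∈ map p X
        from (here refl) = ∈ₚ.∈-map⁺ p (first-∈ f)
        from (there c∈C) with code-image⁻ code c∈C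
        ... | u , u∈Y , refl = ∈ₚ.∈-map⁺ p (first-⊆ f u∈Y)
      encode ac (suc m) X@(u₀ ∷ X₀) len | inj₁ all with deepest ac u₀ X₀
      ... | v , v∈X , max with ∈ₚ.∈-map⁻ p (all v∈X)
      -- If no vertex is a leaf, even the deepest one is a parent, and its child would be deeper.
      ...   | w , w∈X , v≡pw = ⊥-elim (ℕₚ.<-irrefl refl (ℕₚ.<-≤-trans
              (subst (λ z → depth (ac z) < depth (ac (inject₁ w))) (sym v≡pw) (parent-shallower ac w)) (max w∈X)))

    decode-unique : ∀ {p p' X C} → Code p X C → Code p' X C → ∀ {u} → u ∈ X → p u ≡ p' u
    decode-unique (cons f e code) (cons f' e' code') u∈X
      with refl , refl ← first-unique f f' with first-split f u∈X
    ... | inj₁ refl = trans e (sym e')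
    ... | inj₂ u∈Y = decode-unique code code' u∈Y

    code-resp : ∀ {p p' X C} → (∀ {u} → u ∈ X → p u ≡ p' u) → Code p X C → Code p' X C
    code-resp e [] = []
    code-resp e (cons f e' code) = cons f (trans (sym (e (first-∈ f))) e') (code-resp (e ∘ first-⊆ f) code)

    -- The vertex removed last has no remaining vertex as parent and is not its own parent.
    code-ends-at-root : ∀ {p X C} → Code p X C → (∀ {u} → u ∈ X → p u ≡ fromℕ n ⊎ ∃ λ w → w ∈ X × p u ≡ inject₁ w) →
      C ≡ [] ⊎ ∃ λ C₀ → C ≡ C₀ ∷ʳ fromℕ n
    code-ends-at-root [] _ = inj₁ refl
    code-ends-at-root {p} {X} (cons {v = v} {Y} f refl code) closed = inj₂ (ending code (code-ends-at-root code closed'))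
      where
      closed' : ∀ {u} → u ∈ Y → p u ≡ fromℕ n ⊎ ∃ λ w → w ∈ Y × p u ≡ inject₁ w
      closed' u∈Y with closed (first-⊆ f u∈Y)
      ... | inj₁ e = inj₁ e
      ... | inj₂ (w , w∈X , e) with first-split f w∈X
      ...   | inj₂ w∈Y = inj₂ (w , w∈Y , e)
      ...   | inj₁ refl = ⊥-elim (first-∉ f (there (subst (_∈ _) e (code-image⁺ code u∈Y))))
      ending : ∀ {C} → Code p Y C → C ≡ [] ⊎ (∃ λ C₀ → C ≡ C₀ ∷ʳ fromℕ n) → ∃ λ C₀ → p v ∷ C ≡ C₀ ∷ʳ fromℕ n
      ending _ (inj₂ (C₀ , refl)) = p v ∷ C₀ , refl
      ending [] (inj₁ refl) with closed (first-∈ f)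
      ... | inj₁ e = [] , cong (_∷ []) e
      ... | inj₂ (w , w∈X , e) with first-split f w∈X
      ...   | inj₁ refl = ⊥-elim (first-∉ f (here (sym e)))
      ...   | inj₂ ()

    unique-⊆-length : ∀ {A : Set} (L K : List A) → Unique L → (∀ {a} → a ∈ L → a ∈ K) → length L ≤ length K
    unique-⊆-length [] K _ _ = z≤n
    unique-⊆-length (a ∷ L) K (a∉ ∷ uL) sub with ∈ₚ.∈-∃++ (sub (here refl))
    ... | K₁ , K₂ , refl = ℕₚ.≤-trans (s≤s (unique-⊆-length L (K₁ ++ K₂) uL sub'))
        (ℕₚ.≤-reflexive (trans (cong suc (Listₚ.length-++ K₁)) (trans (sym (ℕₚ.+-suc (length K₁) (length K₂))) (sym (Listₚ.length-++ K₁)))))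
      where
      sub' : ∀ {b} → b ∈ L → b ∈ K₁ ++ K₂
      sub' {b} b∈L with ∈ₚ.∈-++⁻ K₁ (sub (there b∈L))
      ... | inj₁ b∈ = ∈ₚ.∈-++⁺ˡ b∈
      ... | inj₂ (here refl) = ⊥-elim (All.lookup a∉ b∈L refl)
      ... | inj₂ (there b∈) = ∈ₚ.∈-++⁺ʳ K₁ b∈

    Ends : List (Fin (suc n)) → Set
    Ends [] = ⊤
    Ends (c ∷ []) = c ≡ fromℕ n
    Ends (c ∷ C@(_ ∷ _)) = Ends C

    ends-∈ : ∀ c C → Ends (c ∷ C) → fromℕ n ∈ c ∷ C
    ends-∈ c [] e = here (sym e)
    ends-∈ c (c' ∷ C) e = there (ends-∈ c' C e)

    ends-tail : ∀ c C → Ends (c ∷ C) → Ends C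
    ends-tail c [] _ = tt
    ends-tail c (_ ∷ _) e = e

    ends-∷ʳ : ∀ C → Ends (C ∷ʳ fromℕ n)
    ends-∷ʳ [] = refl
    ends-∷ʳ (c ∷ []) = refl
    ends-∷ʳ (c ∷ c' ∷ C) = ends-∷ʳ (c' ∷ C)

    Legal : List (Fin n) → Fin (suc n) → Set
    Legal X c = c ≡ fromℕ n ⊎ ∃ λ w → w ∈ X × c ≡ inject₁ w

    -- Without a leaf, all of `X` and, by `Ends`, also the root would occur in the code: one
    -- distinct entry more than its length allows.
    decode : ∀ X C → Unique X → length C ≡ length X → Ends C → All (Legal X) C → ∃ λ p → Code p X C
    -- The root is a default value, overridden at each vertex as it is removed.
    decode [] [] _ _ _ _ = (λ _ → fromℕ n) , []
    decode X (c ∷ C) uX len ends (_ ∷ legal) with first? (c ∷ C) X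
    ... | inj₁ all = ⊥-elim (ℕₚ.<-irrefl refl (ℕₚ.<-≤-trans (ℕₚ.≤-reflexive (cong suc (trans len (sym (Listₚ.length-map inject₁ X)))))
        (unique-⊆-length (fromℕ n ∷ map inject₁ X) (c ∷ C)
          (All.tabulate (λ v∈ e → let (w , _ , e') = ∈ₚ.∈-map⁻ inject₁ v∈ in Finₚ.fromℕ≢inject₁ (trans e e'))
            ∷ Uniqueₚ.map⁺ Finₚ.inject₁-injective uX)
          λ { (here refl) → ends-∈ c C ends ; (there v∈) → let (w , w∈X , e') = ∈ₚ.∈-map⁻ inject₁ v∈ in subst (_∈ c ∷ C) (sym e') (all w∈X) })))
    ... | inj₂ (v , Y , f) with first-unique-list f uX
    ...   | uY , v∉Y with decode Y C uY (ℕₚ.suc-injective (trans len (first-length f))) (ends-tail c C ends) (All.tabulate shrink)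
      where
      shrink : ∀ {b} → b ∈ C → Legal Y b
      shrink b∈C with All.lookup legal b∈C
      ... | inj₁ e = inj₁ e
      ... | inj₂ (w , w∈X , refl) with first-split f w∈X
      ...   | inj₁ refl = ⊥-elim (first-∉ f (there b∈C))
      ...   | inj₂ w∈Y = inj₂ (w , w∈Y , refl)
    ...     | p , code = p' , cons f p'v (code-resp agrees code)
      where
      p' : Fin n → Fin (suc n)
      p' u with u Finₚ.≟ v
      ... | yes _ = c
      ... | no _ = p u
      p'v : p' v ≡ c
      p'v with v Finₚ.≟ v
      ... | yes _ = refl
      ... | no ne = ⊥-elim (ne refl)
      agrees : ∀ {u} → u ∈ Y → p u ≡ p' u
      agrees {u} u∈Y with u Finₚ.≟ v
      ... | yes refl = ⊥-elim (v∉Y u∈Y)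
      ... | no _ = refl

  vecOf : ∀ {A : Set} m (L : List A) → length L ≡ m → ∃ λ (v : Vec A m) → toList v ≡ L
  vecOf zero [] _ = [] , refl
  vecOf (suc m) (a ∷ L) e with vecOf m L (ℕₚ.suc-injective e)
  ... | v , refl = a ∷ v , refl

  toList-injective : ∀ {A : Set} {m} {u v : Vec A m} → toList u ≡ toList v → u ≡ v
  toList-injective {u = []} {[]} _ = refl
  toList-injective {u = a ∷ u} {b ∷ v} e with refl , e' ← Listₚ.∷-injective e = cong (a ∷_) (toList-injective e')

  ∈-toList⁻ : ∀ {A : Set} {m} {a : A} (v : Vec A m) → a ∈ toList v → ∃ λ j → lookup v j ≡ a
  ∈-toList⁻ (b ∷ v) (here refl) = zero , refl
  ∈-toList⁻ (b ∷ v) (there a∈) with ∈-toList⁻ v a∈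
  ... | j , e = suc j , e

  ∈-toList⁺ : ∀ {A : Set} {m} (v : Vec A m) j → lookup v j ∈ toList v
  ∈-toList⁺ (b ∷ v) zero = here refl
  ∈-toList⁺ (b ∷ v) (suc j) = there (∈-toList⁺ v j)

  legal-all : ∀ {n} (c : Fin (suc n)) → Legal (allFin n) c
  legal-all c with view c
  ... | ‵fromℕ = inj₁ refl
  ... | ‵inj₁ {i = i} _ = inj₂ (i , ∈ₚ.∈-allFin i , refl)

  -- The code of a parent map on `suc n` vertices ends in the root; dropping that entry leaves `n`
  -- letters and the same image among the labels that can be marked.
  𝒫≅𝒲 : ∀ n k → 𝒫 (suc n) k ≅ 𝒲 (suc n) k
  𝒫≅𝒲 n k = inverse-from-section (𝒫 (suc n) k) (𝒲 (suc n) k) to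
    (λ {a} {b} → to-cong {a} {b}) (λ {a} {b} → to-injective {a} {b}) section
    where
    N = suc n
    X = allFin N
    P = Σ (Vec (Fin (suc N)) N × Subset N) (IsP N k)
    W = Σ (Vec (Fin (suc N)) n × Subset N) (IsW N k)

    word : Vec (Fin (suc N)) n → List (Fin (suc N))
    word f = toList f ∷ʳ fromℕ N

    length-word : ∀ f → length (word f) ≡ N
    length-word f = trans (Listₚ.length-++ (toList f)) (trans (ℕₚ.+-comm (length (toList f)) 1) (cong suc (Vecₚ.length-toList f)))

    pruefer : ∀ p → Acyclic (lookup p) → ∃ λ f → Code (lookup p) X (word f)
    pruefer p ac with encode ac N X (Listₚ.length-tabulate id)
    ... | C , code with code-ends-at-root code (λ {u} _ → legal-all (lookup p u))
    ...   | inj₁ refl with () ← trans (code-length code) (Listₚ.length-tabulate {n = N} id)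
    ...   | inj₂ (C₀ , refl) with vecOf n C₀ (ℕₚ.suc-injective (trans (sym (ℕₚ.+-comm (length C₀) 1))
               (trans (sym (Listₚ.length-++ C₀)) (trans (code-length code) (Listₚ.length-tabulate {n = N} id)))))
    ...     | f , refl = f , code

    image⇒ : ∀ {p f} → Code p X (word f) → ∀ {i} → (∃ λ j → p j ≡ inject₁ i) → ∃ λ j → lookup f j ≡ inject₁ i
    image⇒ {f = f} code (j , e) with ∈ₚ.∈-++⁻ (toList f) (subst (_∈ word f) e (code-image⁺ code (∈ₚ.∈-allFin j)))
    ... | inj₁ i∈ = ∈-toList⁻ f i∈
    ... | inj₂ (here e') = ⊥-elim (Finₚ.fromℕ≢inject₁ (sym e'))

    image⇐ : ∀ {p f} → Code p X (word f) → ∀ {i} → (∃ λ j → lookup f j ≡ inject₁ i) → ∃ λ j → p j ≡ inject₁ i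
    image⇐ {f = f} code (j , e) with code-image⁻ code (∈ₚ.∈-++⁺ˡ (subst (_∈ toList f) e (∈-toList⁺ f j)))
    ... | u , _ , e' = u , e'

    to : P → W
    to ((p , M) , ac , marks , size) with pruefer p ac
    ... | f , code = (f , M) , (λ i i∈M → image⇒ code (marks i i∈M)) , size

    to-code : (a : P) → Code (lookup (proj₁ (proj₁ a))) X (word (proj₁ (proj₁ (to a))))
    to-code ((p , M) , ac , _) with pruefer p ac
    ... | f , code = code

    word-injective : ∀ {f g} → word f ≡ word g → f ≡ g
    word-injective {f} {g} e = toList-injective (proj₁ (Listₚ.∷ʳ-injective (toList f) (toList g) e))

    to-cong : ∀ {a b : P} → proj₁ a ≡ proj₁ b → proj₁ (to a) ≡ proj₁ (to b)
    to-cong {a} {b} refl = cong (_, _) (word-injective (encode-unique (to-code a) (to-code b)))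

    to-injective : ∀ {a b : P} → proj₁ (to a) ≡ proj₁ (to b) → proj₁ a ≡ proj₁ b
    to-injective {a} {b} e = cong₂ _,_
      (lookup-ext λ i → decode-unique (subst (λ w → Code _ X (word (proj₁ w))) e (to-code a)) (to-code b) (∈ₚ.∈-allFin i))
      (cong proj₂ e)

    section : ∀ (w : W) → ∃ λ a → proj₁ (to a) ≡ proj₁ w
    section ((f , S) , marks , size) with decode X (word f) (Uniqueₚ.allFin⁺ N)
        (trans (length-word f) (sym (Listₚ.length-tabulate {n = N} id))) (ends-∷ʳ (toList f)) (All.tabulate λ _ → legal-all _)
    ... | p₀ , code₀ = a , cong (_, S) (word-injective (encode-unique (to-code a) code))
      where
      p : Vec (Fin (suc N)) N
      p = tabulate p₀
      code : Code (lookup p) X (word f)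
      code = code-resp (λ {u} _ → sym (Vecₚ.lookup∘tabulate p₀ u)) code₀
      a : P
      a = (p , S) , acyclic (λ i → code-reach code (All.tabulate λ _ → legal-all _) (∈ₚ.∈-allFin i)) ,
          (λ i i∈S → image⇐ code (marks i i∈S)) , size

-- 𝒰 and parent maps: binary trees as sorted forests.

module Forests where
  open Bijections
  open TreeTransfer
  open CanonicalTrees using (select; select⁺; select⁻)
  open ParentMaps
  open import Data.Nat using (_+_; _≤_)
  open import Data.Nat.ListAction using (sum)
  open import Data.Nat.ListAction.Properties using (sum-↭; sum-++)
  open import Data.Nat.Solver using (module +-*-Solver)
  import Data.Vec.Properties as Vecₚ
  import Data.List.Properties as Listₚ
  open import Data.List.Membership.Propositional using (_∈_)
  open import Data.List.Relation.Binary.Permutation.Propositional.Properties using (↭-length; map⁺)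

  Has : ∀ {n} → Fin n → LTree n → Set
  Has i leaf = ⊥
  Has i (node a m l s) = i ≡ a ⊎ Has i l ⊎ Has i s

  -- A binary tree is read as a forest of plane trees below r: the left child of a node is
  -- its first child and the right child is its next sibling.
  ParentIn : ∀ {n} → Fin (suc n) → LTree n → Fin n → Fin (suc n) → Set
  ParentIn r leaf i j = ⊥
  ParentIn r (node a m l s) i j = (i ≡ a × j ≡ r) ⊎ ParentIn (inject₁ a) l i j ⊎ ParentIn r s i j

  occ-node : ∀ {n} (i a : Fin n) (l s : LTree n) →
    occ i (a ∷ llabels l ++ llabels s) ≡ bit (lookup ⁅ a ⁆ i) + (occ i (llabels l) + occ i (llabels s))
  occ-node i a l s = cong (bit (lookup ⁅ a ⁆ i) +_) (occ-++ i (llabels l) (llabels s))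

  has⇒occ : ∀ {n} {i : Fin n} t → Has i t → 1 ≤ occ i (llabels t)
  has⇒occ {i = i} (node a m l s) (inj₁ refl) rewrite bit-self i = s≤s z≤n
  has⇒occ {i = i} (node a m l s) (inj₂ h) rewrite occ-node i a l s = ℕₚ.≤-trans (below h) (ℕₚ.m≤n+m _ (bit (lookup ⁅ a ⁆ i)))
    where
    below : Has i l ⊎ Has i s → 1 ≤ occ i (llabels l) + occ i (llabels s)
    below (inj₁ h) = ℕₚ.≤-trans (has⇒occ l h) (ℕₚ.m≤m+n _ _)
    below (inj₂ h) = ℕₚ.≤-trans (has⇒occ s h) (ℕₚ.m≤n+m _ _)

  ∈⇒has : ∀ {n} {i : Fin n} t → i ∈ llabels t → Has i t
  ∈⇒has (node a m l s) (here e) = inj₁ e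
  ∈⇒has (node a m l s) (there i∈) with ∈ₚ.∈-++⁻ (llabels l) i∈
  ... | inj₁ i∈l = inj₂ (inj₁ (∈⇒has l i∈l))
  ... | inj₂ i∈s = inj₂ (inj₂ (∈⇒has s i∈s))

  occ⇒has : ∀ {n} {i : Fin n} t → 1 ≤ occ i (llabels t) → Has i t
  occ⇒has t h = ∈⇒has t (1≤occ⇒∈ (llabels t) h)

  2≰1 : ∀ {m n k} → 1 ≤ m → 1 ≤ n → m + n ≤ k → k ≤ 1 → ⊥
  2≰1 p q h h' with s≤s () ← ℕₚ.≤-trans (ℕₚ.+-mono-≤ p q) (ℕₚ.≤-trans h h')

  record Split {n} (a : Fin n) (l s : LTree n) : Set where
    field
      a∉l : ¬ Has a l
      a∉s : ¬ Has a s
      disjoint : ∀ {i} → Has i l → ¬ Has i s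
      left : Simple l
      right : Simple s

  split : ∀ {n} a (l s : LTree n) → Simple (node a false l s) → Split a l s
  split a l s simple = record
    { a∉l = λ h → 2≰1 (at a) (has⇒occ l h) (ℕₚ.+-monoʳ-≤ (bit (lookup ⁅ a ⁆ a)) (ℕₚ.m≤m+n _ _)) (once a)
    ; a∉s = λ h → 2≰1 (at a) (has⇒occ s h) (ℕₚ.+-monoʳ-≤ (bit (lookup ⁅ a ⁆ a)) (ℕₚ.m≤n+m _ (occ a (llabels l)))) (once a)
    ; disjoint = λ {i} h h' → 2≰1 (has⇒occ l h) (has⇒occ s h') (ℕₚ.m≤n+m _ (bit (lookup ⁅ a ⁆ i))) (once i)
    ; left = simple-left a l s simple ; right = simple-right a l s simple }
    where
    once : ∀ i → bit (lookup ⁅ a ⁆ i) + (occ i (llabels l) + occ i (llabels s)) ≤ 1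
    once i = subst (_≤ 1) (occ-node i a l s) (simple i)
    at : ∀ i → 1 ≤ bit (lookup ⁅ i ⁆ i)
    at i = ℕₚ.≤-reflexive (sym (bit-self i))

  child-in : ∀ {n r} (t : LTree n) {i j} → ParentIn r t i j → Has i t
  child-in (node a m l s) (inj₁ (e , _)) = inj₁ e
  child-in (node a m l s) (inj₂ (inj₁ p)) = inj₂ (inj₁ (child-in l p))
  child-in (node a m l s) (inj₂ (inj₂ p)) = inj₂ (inj₂ (child-in s p))

  parent-in : ∀ {n r} (t : LTree n) {i j} → ParentIn r t i j → j ≡ r ⊎ ∃ λ b → Has b t × j ≡ inject₁ b
  parent-in (node a m l s) (inj₁ (_ , e)) = inj₁ e
  parent-in (node a m l s) (inj₂ (inj₁ p)) with parent-in l p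
  ... | inj₁ e = inj₂ (a , inj₁ refl , e)
  ... | inj₂ (b , h , e) = inj₂ (b , inj₂ (inj₁ h) , e)
  parent-in (node a m l s) (inj₂ (inj₂ p)) with parent-in s p
  ... | inj₁ e = inj₁ e
  ... | inj₂ (b , h , e) = inj₂ (b , inj₂ (inj₂ h) , e)

  has-parent : ∀ {n} r (t : LTree n) {i} → Has i t → ∃ λ j → ParentIn r t i j
  has-parent r (node a m l s) (inj₁ e) = r , inj₁ (e , refl)
  has-parent r (node a m l s) (inj₂ (inj₁ h)) with has-parent (inject₁ a) l h
  ... | j , p = j , inj₂ (inj₁ p)
  has-parent r (node a m l s) (inj₂ (inj₂ h)) with has-parent r s h
  ... | j , p = j , inj₂ (inj₂ p)

  parent-unique : ∀ {n r} (t : LTree n) → Simple t → ∀ {i j j'} → ParentIn r t i j → ParentIn r t i j' → j ≡ j'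
  parent-unique (node a m l s) simple = go
    where
    open Split (split a l s simple)
    go : ∀ {r i j j'} → ParentIn r (node a m l s) i j → ParentIn r (node a m l s) i j' → j ≡ j'
    go (inj₁ (_ , e)) (inj₁ (_ , e')) = trans e (sym e')
    go (inj₁ (refl , _)) (inj₂ (inj₁ q)) = ⊥-elim (a∉l (child-in l q))
    go (inj₁ (refl , _)) (inj₂ (inj₂ q)) = ⊥-elim (a∉s (child-in s q))
    go (inj₂ (inj₁ p)) (inj₁ (refl , _)) = ⊥-elim (a∉l (child-in l p))
    go (inj₂ (inj₂ p)) (inj₁ (refl , _)) = ⊥-elim (a∉s (child-in s p))
    go (inj₂ (inj₁ p)) (inj₂ (inj₁ q)) = parent-unique l left p q
    go (inj₂ (inj₂ p)) (inj₂ (inj₂ q)) = parent-unique s right p q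
    go (inj₂ (inj₁ p)) (inj₂ (inj₂ q)) = ⊥-elim (disjoint (child-in l p) (child-in s q))
    go (inj₂ (inj₂ p)) (inj₂ (inj₁ q)) = ⊥-elim (disjoint (child-in l q) (child-in s p))

  reach-in : ∀ {n} {p : Fin n → Fin (suc n)} r (t : LTree n) → Reach p r → (∀ {i j} → ParentIn r t i j → p i ≡ j) →
    ∀ {i} → Has i t → Reach p (inject₁ i)
  reach-in {p = p} r (node a m l s) reach par = go
    where
    reach-a : Reach p (inject₁ a)
    reach-a = step a refl (subst (Reach p) (sym (par (inj₁ (refl , refl)))) reach)
    go : ∀ {i} → Has i (node a m l s) → Reach p (inject₁ i)
    go (inj₁ refl) = reach-a
    go (inj₂ (inj₁ h)) = reach-in (inject₁ a) l reach-a (par ∘ inj₂ ∘ inj₁) h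
    go (inj₂ (inj₂ h)) = reach-in r s reach (par ∘ inj₂ ∘ inj₂) h

  Agrees : ∀ {n} → Subset n → LTree n → Set
  Agrees M leaf = ⊤
  Agrees M (node a m l s) = m ≡ lookup M a × Agrees M l × Agrees M s

  -- A sum over the label list is invariant under permutation, so it equals the size of `M` whatever
  -- the order of the labels in the tree.
  markWeight : ∀ {n} → Subset n → List (Fin n) → ℕ
  markWeight M L = sum (map (λ i → bit (lookup M i)) L)

  markCount≡weight : ∀ {n} {M : Subset n} t → Agrees M t → markCount t ≡ markWeight M (llabels t)
  markCount≡weight leaf _ = refl
  markCount≡weight {M = M} (node a m l s) (refl , al , as)
    rewrite Listₚ.map-++ (λ i → bit (lookup M i)) (llabels l) (llabels s)
          | sum-++ (map (λ i → bit (lookup M i)) (llabels l)) (map (λ i → bit (lookup M i)) (llabels s))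
    = cong (bit (lookup M a) +_) (cong₂ _+_ (markCount≡weight l al) (markCount≡weight s as))

  weight-allFin : ∀ {n} (M : Subset n) → markWeight M (allFin n) ≡ ∣ M ∣
  weight-allFin [] = refl
  weight-allFin {suc n} (b ∷ M) = trans (cong (bit b +_) (trans (cong sum tail) (weight-allFin M))) (count b)
    where
    tail : map (λ i → bit (lookup (b ∷ M) i)) (List.tabulate suc) ≡ map (λ i → bit (lookup M i)) (allFin n)
    tail = trans (Listₚ.map-tabulate suc (λ i → bit (lookup (b ∷ M) i))) (sym (Listₚ.map-tabulate id (λ i → bit (lookup M i))))
    count : ∀ b → bit b + ∣ M ∣ ≡ ∣ b ∷ M ∣
    count true = refl
    count false = refl

  weight-complete : ∀ {n} (M : Subset n) {L} → Unique L → (∀ i → i ∈ L) → markWeight M L ≡ ∣ M ∣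
  weight-complete M uniq complete = trans (sum-↭ (map⁺ (λ i → bit (lookup M i)) (complete⇒↭ uniq complete))) (weight-allFin M)

  Marked : ∀ {n} → Fin n → LTree n → Set
  Marked i leaf = ⊥
  Marked i (node a m l s) = (i ≡ a × m ≡ true) ⊎ Marked i l ⊎ Marked i s

  marked? : ∀ {n} (t : LTree n) i → Dec (Marked i t)
  marked? leaf i = no id
  marked? (node a m l s) i = ((i Finₚ.≟ a) ×-dec (m Bool.≟ true)) ⊎-dec (marked? l i ⊎-dec marked? s i)

  marked-has : ∀ {n} {i : Fin n} t → Marked i t → Has i t
  marked-has (node a m l s) (inj₁ (e , _)) = inj₁ e
  marked-has (node a m l s) (inj₂ (inj₁ h)) = inj₂ (inj₁ (marked-has l h))
  marked-has (node a m l s) (inj₂ (inj₂ h)) = inj₂ (inj₂ (marked-has s h))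

  agrees-marked : ∀ {n} {M : Subset n} t → Simple t → (∀ {i} → Has i t → i Subset.∈ M → Marked i t) →
    (∀ {i} → Marked i t → i Subset.∈ M) → Agrees M t
  agrees-marked leaf _ _ _ = tt
  agrees-marked {M = M} (node a m l s) simple to from =
    at-root m (λ a∈M → to (inj₁ refl) a∈M) (λ e → from (inj₁ (refl , e))) ,
    agrees-marked l left (λ h i∈M → inLeft h (to (inj₂ (inj₁ h)) i∈M)) (from ∘ inj₂ ∘ inj₁) ,
    agrees-marked s right (λ h i∈M → inRight h (to (inj₂ (inj₂ h)) i∈M)) (from ∘ inj₂ ∘ inj₂)
    where
    open Split (split a l s simple)
    at-root : ∀ m' → (a Subset.∈ M → (a ≡ a × m' ≡ true) ⊎ Marked a l ⊎ Marked a s) → (m' ≡ true → a Subset.∈ M) → m' ≡ lookup M a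
    at-root true _ back = sym (Vecₚ.[]=⇒lookup (back refl))
    at-root false forth _ = sym (∉⇒lookup λ a∈M → absurd (forth a∈M))
      where
      absurd : ¬ ((a ≡ a × false ≡ true) ⊎ Marked a l ⊎ Marked a s)
      absurd (inj₂ (inj₁ h)) = a∉l (marked-has l h)
      absurd (inj₂ (inj₂ h)) = a∉s (marked-has s h)
    inLeft : ∀ {i} → Has i l → Marked i (node a m l s) → Marked i l
    inLeft h (inj₁ (refl , _)) = ⊥-elim (a∉l h)
    inLeft h (inj₂ (inj₁ q)) = q
    inLeft h (inj₂ (inj₂ q)) = ⊥-elim (disjoint h (marked-has s q))
    inRight : ∀ {i} → Has i s → Marked i (node a m l s) → Marked i s
    inRight h (inj₁ (refl , _)) = ⊥-elim (a∉s h)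
    inRight h (inj₂ (inj₂ q)) = q
    inRight h (inj₂ (inj₁ q)) = ⊥-elim (disjoint (marked-has l q) h)

  marked-parent : ∀ {n} r (t : LTree n) → LWellFormed t → ∀ {i} → Marked i t → ∃ λ j → ParentIn r t j (inject₁ i)
  marked-parent r (node a .true (node b _ _ _) s) _ (inj₁ (refl , refl)) = b , inj₂ (inj₁ (inj₁ (refl , refl)))
  marked-parent r (node a .true leaf s) (_ , () , _) (inj₁ (refl , refl))
  marked-parent r (node a m l s) (_ , _ , wl , _) (inj₂ (inj₁ h)) with marked-parent (inject₁ a) l wl h
  ... | j , p = j , inj₂ (inj₁ p)
  marked-parent r (node a m l s) (_ , _ , _ , ws) (inj₂ (inj₂ h)) with marked-parent r s ws h
  ... | j , p = j , inj₂ (inj₂ p)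

  -- Keeps the nominal parent `r` of the top level apart from the vertices inside, so that a pair
  -- with parent `r` belongs to the right spine.
  Outside : ∀ {n} → Fin (suc n) → LTree n → Set
  Outside r t = ∀ {b} → Has b t → r ≢ inject₁ b

  -- Siblings decrease along the right spine, so the root is the largest child of `r` and is thus
  -- determined by the parent relation.
  top-child-≤ : ∀ {n r} a m (l s : LTree n) → LWellFormed (node a m l s) → Outside r (node a m l s) →
    ∀ {i} → ParentIn r (node a m l s) i r → i Fin.≤ a
  top-child-≤ a m l s _ _ (inj₁ (refl , _)) = ℕₚ.≤-refl
  top-child-≤ a m l s _ out (inj₂ (inj₁ p)) with parent-in l p
  ... | inj₁ e = ⊥-elim (out (inj₁ refl) e)
  ... | inj₂ (b , h , e) = ⊥-elim (out (inj₂ (inj₁ h)) e)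
  top-child-≤ a m l (node b m' l' s') (b<a , _ , _ , ws) out (inj₂ (inj₂ p)) =
    ℕₚ.≤-trans (top-child-≤ b m' l' s' ws (out ∘ inj₂ ∘ inj₂) p) (ℕₚ.<⇒≤ b<a)

  -- Descendants of `a` are followed downwards: a parent that is `a` or lies in `l'` is neither `r`
  -- nor in `s'`, so its children lie in `l'` again.
  transport-left : ∀ {n r a m m'} (l s l' s' : LTree n) → Split a l' s' → Outside r (node a m' l' s') →
    (∀ {i j} → ParentIn r (node a m l s) i j → ParentIn r (node a m' l' s') i j) →
    ∀ {i j} → ParentIn (inject₁ a) l i j → ParentIn (inject₁ a) l' i j
  transport-left {n} {r} {a} {m} {m'} l s l' s' sp out sub = go l (inject₁ a) (inj₁ refl) (sub ∘ inj₂ ∘ inj₁)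
    where
    open Split sp
    go : ∀ u c → (c ≡ inject₁ a ⊎ ∃ λ b → Has b l' × c ≡ inject₁ b) →
      (∀ {i j} → ParentIn c u i j → ParentIn r (node a m' l' s') i j) →
      ∀ {i j} → ParentIn c u i j → ParentIn (inject₁ a) l' i j
    go (node b _ ul us) c c∈ emb = λ
      { (inj₁ (refl , refl)) → at-b
      ; (inj₂ (inj₁ p)) → go ul (inject₁ b) (inj₂ (b , child-in l' at-b , refl)) (emb ∘ inj₂ ∘ inj₁) p
      ; (inj₂ (inj₂ p)) → go us c c∈ (emb ∘ inj₂ ∘ inj₂) p }
      where
      c≢r : c ≢ r
      c≢r refl = [ out (inj₁ refl) , (λ (_ , h , e) → out (inj₂ (inj₁ h)) e) ]′ c∈
      c∉s' : ∀ {b} → Has b s' → c ≢ inject₁ b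
      c∉s' {b} h e = [ (λ e' → a∉s (subst (λ z → Has z s') (Finₚ.inject₁-injective (trans (sym e) e')) h))
        , (λ (b' , h' , e') → disjoint h' (subst (λ z → Has z s') (Finₚ.inject₁-injective (trans (sym e) e')) h)) ]′ c∈
      at-b : ParentIn (inject₁ a) l' b c
      at-b with emb (inj₁ (refl , refl))
      ... | inj₁ (_ , e) = ⊥-elim (c≢r e)
      ... | inj₂ (inj₁ p) = p
      ... | inj₂ (inj₂ p) with parent-in s' p
      ...   | inj₁ e = ⊥-elim (c≢r e)
      ...   | inj₂ (_ , h , e) = ⊥-elim (c∉s' h e)

  -- The roots agree as largest children of `r`, the left subtrees contain the same descendants of
  -- the root, and the remaining pairs belong to the right subtrees.
  parents-determine : ∀ {n} {M : Subset n} r (t t' : LTree n) → Simple t → Simple t' → LWellFormed t → LWellFormed t' →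
    Outside r t → Outside r t' → Agrees M t → Agrees M t' →
    (∀ {i j} → ParentIn r t i j → ParentIn r t' i j) → (∀ {i j} → ParentIn r t' i j → ParentIn r t i j) → t ≡ t'
  parents-determine r leaf leaf _ _ _ _ _ _ _ _ _ _ = refl
  parents-determine r leaf (node a m l s) _ _ _ _ _ _ _ _ _ from = ⊥-elim (from (inj₁ (refl , refl)))
  parents-determine r (node a m l s) leaf _ _ _ _ _ _ _ _ to _ = ⊥-elim (to (inj₁ (refl , refl)))
  parents-determine {M = M} r (node a m l s) (node a' m' l' s') simple simple' wf@(_ , _ , wl , ws) wf'@(_ , _ , wl' , ws') out out'
    (em , al , as) (em' , al' , as') to from
    with refl ← Finₚ.≤-antisym {i = a} {a'} (top-child-≤ a' m' l' s' wf' out' (to (inj₁ (refl , refl))))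
                               (top-child-≤ a m l s wf out (from (inj₁ (refl , refl))))
    with refl ← trans em (sym em')
    = cong₂ (node a m)
        (parents-determine (inject₁ a) l l' (Split.left sp) (Split.left sp') wl wl'
          (λ h e → Split.a∉l sp (subst (λ b → Has b l) (sym (Finₚ.inject₁-injective e)) h))
          (λ h e → Split.a∉l sp' (subst (λ b → Has b l') (sym (Finₚ.inject₁-injective e)) h)) al al' toL fromL)
        (parents-determine r s s' (Split.right sp) (Split.right sp') ws ws' (out ∘ inj₂ ∘ inj₂) (out' ∘ inj₂ ∘ inj₂) as as'
          (λ p → keep sp fromL p (to (inj₂ (inj₂ p)))) (λ p → keep sp' toL p (from (inj₂ (inj₂ p)))))
    where
    sp : Split a l s
    sp = split a l s simple
    sp' : Split a l' s'
    sp' = split a l' s' simple'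
    toL : ∀ {i j} → ParentIn (inject₁ a) l i j → ParentIn (inject₁ a) l' i j
    toL = transport-left {m = m} {m} l s l' s' sp' out' to
    fromL : ∀ {i j} → ParentIn (inject₁ a) l' i j → ParentIn (inject₁ a) l i j
    fromL = transport-left {m = m} {m} l' s' l s sp out from
    keep : ∀ {l s l' s' : LTree _} → Split a l s → (∀ {i j} → ParentIn (inject₁ a) l' i j → ParentIn (inject₁ a) l i j) →
      ∀ {i j} → ParentIn r s i j → ParentIn r (node a m l' s') i j → ParentIn r s' i j
    keep {s = s} sp _ p (inj₁ (refl , _)) = ⊥-elim (Split.a∉s sp (child-in s p))
    keep {l = l} {s} sp back p (inj₂ (inj₁ q)) = ⊥-elim (Split.disjoint sp (child-in l (back q)) (child-in s p))
    keep _ _ p (inj₂ (inj₂ q)) = q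

  Sorted : ∀ {n} → LTree n → Set
  Sorted leaf = ⊤
  Sorted (node a m l s) = RightDescL a s × Sorted l × Sorted s

  -- Insertion into the decreasing right spine.
  addRoot : ∀ {n} → Fin n → LTree n → LTree n
  addRoot v leaf = node v false leaf leaf
  addRoot v (node a m l s) with a Finₚ.<? v
  ... | yes _ = node v false leaf (node a m l s)
  ... | no _ = node a m l (addRoot v s)

  swap-sumˡ : ∀ a b c d → a + ((b + c) + d) ≡ b + (a + (c + d))
  swap-sumˡ = solve 4 (λ a b c d → a :+ ((b :+ c) :+ d) := b :+ (a :+ (c :+ d))) refl
    where open +-*-Solver

  swap-sumʳ : ∀ a b c d → a + (b + (c + d)) ≡ c + (a + (b + d))
  swap-sumʳ = solve 4 (λ a b c d → a :+ (b :+ (c :+ d)) := c :+ (a :+ (b :+ d))) refl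
    where open +-*-Solver

  occ-addRoot : ∀ {n} (i v : Fin n) t → occ i (llabels (addRoot v t)) ≡ bit (lookup ⁅ v ⁆ i) + occ i (llabels t)
  occ-addRoot i v leaf = refl
  occ-addRoot i v (node a m l s) with a Finₚ.<? v
  ... | yes _ = refl
  ... | no _ = trans (occ-node i a l (addRoot v s)) (trans
    (cong (λ o → bit (lookup ⁅ a ⁆ i) + (occ i (llabels l) + o)) (occ-addRoot i v s))
    (trans (swap-sumʳ (bit (lookup ⁅ a ⁆ i)) (occ i (llabels l)) (bit (lookup ⁅ v ⁆ i)) (occ i (llabels s)))
      (cong (bit (lookup ⁅ v ⁆ i) +_) (sym (occ-node i a l s)))))

  sorted-addRoot : ∀ {n} (v : Fin n) t → Sorted t → ¬ Has v t → Sorted (addRoot v t)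
  sorted-addRoot v leaf _ _ = tt , tt , tt
  sorted-addRoot v (node a m l s) (a>s , sl , ss) v∉ with a Finₚ.<? v
  ... | yes a<v = a<v , tt , (a>s , sl , ss)
  ... | no a≮v = above s a>s , sl , sorted-addRoot v s ss (v∉ ∘ inj₂ ∘ inj₂)
    where
    v<a : v Fin.< a
    v<a with Finₚ.<-cmp v a
    ... | tri< v<a _ _ = v<a
    ... | tri≈ _ v≡a _ = ⊥-elim (v∉ (inj₁ v≡a))
    ... | tri> _ _ a<v = ⊥-elim (a≮v a<v)
    above : ∀ s → RightDescL a s → RightDescL a (addRoot v s)
    above leaf _ = v<a
    above (node b _ _ _) b<a with b Finₚ.<? v
    ... | yes _ = v<a
    ... | no _ = b<a

  addRoot-old : ∀ {n r} (v : Fin n) t {i j} → ParentIn r t i j → ParentIn r (addRoot v t) i j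
  addRoot-old v (node a m l s) p with a Finₚ.<? v
  ... | yes _ = inj₂ (inj₂ p)
  addRoot-old v (node a m l s) (inj₁ e) | no _ = inj₁ e
  addRoot-old v (node a m l s) (inj₂ (inj₁ p)) | no _ = inj₂ (inj₁ p)
  addRoot-old v (node a m l s) (inj₂ (inj₂ p)) | no _ = inj₂ (inj₂ (addRoot-old v s p))

  addRoot-new : ∀ {n r} (v : Fin n) t → ParentIn r (addRoot v t) v r
  addRoot-new v leaf = inj₁ (refl , refl)
  addRoot-new v (node a m l s) with a Finₚ.<? v
  ... | yes _ = inj₁ (refl , refl)
  ... | no _ = inj₂ (inj₂ (addRoot-new v s))

  record Added {n} (w v : Fin n) (t : LTree n) : Set where
    field
      tree : LTree n
      occ-tree : ∀ i → occ i (llabels tree) ≡ bit (lookup ⁅ v ⁆ i) + occ i (llabels t)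
      sorted : Sorted tree
      root-kept : ∀ {b} → RightDescL b t → RightDescL b tree
      old : ∀ {r i j} → ParentIn r t i j → ParentIn r tree i j
      new : ∀ {r} → ParentIn r tree v (inject₁ w)

  addChild : ∀ {n} (w v : Fin n) t → Sorted t → ¬ Has v t → Has w t → Added w v t
  addChild w v (node a m l s) (a>s , sl , ss) v∉ (inj₁ refl) = record
    { tree = node a m (addRoot v l) s
    ; occ-tree = λ i → trans (occ-node i a (addRoot v l) s) (trans
        (cong (λ o → bit (lookup ⁅ a ⁆ i) + (o + occ i (llabels s))) (occ-addRoot i v l))
        (trans (swap-sumˡ (bit (lookup ⁅ a ⁆ i)) (bit (lookup ⁅ v ⁆ i)) (occ i (llabels l)) (occ i (llabels s)))
          (cong (bit (lookup ⁅ v ⁆ i) +_) (sym (occ-node i a l s)))))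
    ; sorted = a>s , sorted-addRoot v l sl (v∉ ∘ inj₂ ∘ inj₁) , ss
    ; root-kept = id
    ; old = λ { (inj₁ e) → inj₁ e ; (inj₂ (inj₁ p)) → inj₂ (inj₁ (addRoot-old v l p)) ; (inj₂ (inj₂ p)) → inj₂ (inj₂ p) }
    ; new = inj₂ (inj₁ (addRoot-new v l)) }
  addChild w v (node a m l s) (a>s , sl , ss) v∉ (inj₂ (inj₁ h)) = record
    { tree = node a m tree s
    ; occ-tree = λ i → trans (occ-node i a tree s) (trans
        (cong (λ o → bit (lookup ⁅ a ⁆ i) + (o + occ i (llabels s))) (occ-tree i))
        (trans (swap-sumˡ (bit (lookup ⁅ a ⁆ i)) (bit (lookup ⁅ v ⁆ i)) (occ i (llabels l)) (occ i (llabels s)))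
          (cong (bit (lookup ⁅ v ⁆ i) +_) (sym (occ-node i a l s)))))
    ; sorted = a>s , sorted , ss
    ; root-kept = id
    ; old = λ { (inj₁ e) → inj₁ e ; (inj₂ (inj₁ p)) → inj₂ (inj₁ (old p)) ; (inj₂ (inj₂ p)) → inj₂ (inj₂ p) }
    ; new = inj₂ (inj₁ new) }
    where
    open Added (addChild w v l sl (v∉ ∘ inj₂ ∘ inj₁) h)
  addChild w v (node a m l s) (a>s , sl , ss) v∉ (inj₂ (inj₂ h)) = record
    { tree = node a m l tree
    ; occ-tree = λ i → trans (occ-node i a l tree) (trans
        (cong (λ o → bit (lookup ⁅ a ⁆ i) + (occ i (llabels l) + o)) (occ-tree i))
        (trans (swap-sumʳ (bit (lookup ⁅ a ⁆ i)) (occ i (llabels l)) (bit (lookup ⁅ v ⁆ i)) (occ i (llabels s)))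
          (cong (bit (lookup ⁅ v ⁆ i) +_) (sym (occ-node i a l s)))))
    ; sorted = root-kept a>s , sl , sorted
    ; root-kept = id
    ; old = λ { (inj₁ e) → inj₁ e ; (inj₂ (inj₁ p)) → inj₂ (inj₁ p) ; (inj₂ (inj₂ p)) → inj₂ (inj₂ (old p)) }
    ; new = inj₂ (inj₂ new) }
    where
    open Added (addChild w v s ss (v∉ ∘ inj₂ ∘ inj₂) h)

  first-occ : ∀ {n} {C : List (Fin (suc n))} {X v Y} → First C X v Y → ∀ i → occ i X ≡ bit (lookup ⁅ v ⁆ i) + occ i Y
  first-occ (hit _) i = refl
  first-occ (skip {u} {v} {X} {Y} _ f) i = trans (cong (bit (lookup ⁅ u ⁆ i) +_) (first-occ f i))
    (solve 3 (λ a b c → a :+ (b :+ c) := b :+ (a :+ c)) refl (bit (lookup ⁅ u ⁆ i)) (bit (lookup ⁅ v ⁆ i)) (occ i Y))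
    where open +-*-Solver

  record Forest {n} (p : Fin n → Fin (suc n)) (X : List (Fin n)) : Set where
    field
      tree : LTree n
      occ-tree : ∀ i → occ i (llabels tree) ≡ occ i X
      sorted : Sorted tree
      parents : ∀ {u} → u ∈ X → ParentIn (fromℕ n) tree u (p u)

  -- The Prüfer order drives the recursion: the leaf removed first is attached last, when its parent
  -- is the root or already a vertex of the tree.
  grow : ∀ {n} {p : Fin n → Fin (suc n)} {X C} → Code p X C → Unique X → (∀ {u} → u ∈ X → Legal X (p u)) → Forest p X
  grow [] _ _ = record { tree = leaf ; occ-tree = λ _ → refl ; sorted = tt ; parents = λ () }
  grow {n} {p} {X} (cons {c} {C} {v = v} {Y} f e code) uX legal = attach (legal (first-∈ f))
    where
    uY = proj₁ (first-unique-list f uX)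
    v∉Y = proj₂ (first-unique-list f uX)
    shrink : ∀ {u} → p u ∈ c ∷ C → Legal X (p u) → Legal Y (p u)
    shrink _ (inj₁ top) = inj₁ top
    shrink p∈ (inj₂ (w , w∈X , e)) with first-split f w∈X
    ... | inj₁ refl = ⊥-elim (first-∉ f (subst (_∈ c ∷ C) e p∈))
    ... | inj₂ w∈Y = inj₂ (w , w∈Y , e)
    open Forest (grow code uY (λ u∈Y → shrink (there (code-image⁺ code u∈Y)) (legal (first-⊆ f u∈Y))))
    v∉tree : ¬ Has v tree
    v∉tree h = v∉Y (1≤occ⇒∈ Y (subst (1 ≤_) (occ-tree v) (has⇒occ tree h)))
    count : ∀ {t} → (∀ i → occ i (llabels t) ≡ bit (lookup ⁅ v ⁆ i) + occ i (llabels tree)) → ∀ i → occ i (llabels t) ≡ occ i X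
    count h i = trans (h i) (trans (cong (bit (lookup ⁅ v ⁆ i) +_) (occ-tree i)) (sym (first-occ f i)))
    attach : Legal X (p v) → Forest p X
    attach leg with shrink (here e) leg
    ... | inj₁ top = record
      { tree = addRoot v tree ; occ-tree = count {addRoot v tree} (λ i → occ-addRoot i v tree) ; sorted = sorted-addRoot v tree sorted v∉tree
      ; parents = λ u∈X → [ (λ { refl → subst (ParentIn (fromℕ n) (addRoot v tree) v) (sym top) (addRoot-new v tree) })
                          , (λ u∈Y → addRoot-old v tree (parents u∈Y)) ]′ (first-split f u∈X) }
    ... | inj₂ (w , w∈Y , pv≡w) = record
      { tree = A.tree ; occ-tree = count {A.tree} A.occ-tree ; sorted = A.sorted
      ; parents = λ u∈X → [ (λ { refl → subst (ParentIn (fromℕ n) A.tree v) (sym pv≡w) A.new })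
                          , (λ u∈Y → A.old (parents u∈Y)) ]′ (first-split f u∈X) }
      where
      module A = Added (addChild w v tree sorted v∉tree (occ⇒has tree (subst (1 ≤_) (sym (occ-tree w)) (∈⇒1≤occ w∈Y))))

  -- Marks are put on after growing, since only the finished tree shows which vertices have
  -- children.
  mark : ∀ {n} → Subset n → LTree n → LTree n
  mark M leaf = leaf
  mark M (node a _ l s) = node a (lookup M a) (mark M l) (mark M s)

  agrees-mark : ∀ {n} (M : Subset n) t → Agrees M (mark M t)
  agrees-mark M leaf = tt
  agrees-mark M (node a m l s) = refl , agrees-mark M l , agrees-mark M s

  llabels-mark : ∀ {n} (M : Subset n) t → llabels (mark M t) ≡ llabels t
  llabels-mark M leaf = refl
  llabels-mark M (node a m l s) = cong (a ∷_) (cong₂ _++_ (llabels-mark M l) (llabels-mark M s))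

  parent-mark : ∀ {n r} (M : Subset n) t {i j} → ParentIn r t i j → ParentIn r (mark M t) i j
  parent-mark M (node a m l s) (inj₁ e) = inj₁ e
  parent-mark M (node a m l s) (inj₂ (inj₁ p)) = inj₂ (inj₁ (parent-mark M l p))
  parent-mark M (node a m l s) (inj₂ (inj₂ p)) = inj₂ (inj₂ (parent-mark M s p))

  -- A marked vertex has a child, and in a tree with distinct labels that child can only lie in its
  -- left subtree, which is therefore not a leaf.
  mark-wf : ∀ {n} (M : Subset n) r t → Simple t → Sorted t → Outside r t →
    (∀ {a} → Has a t → a Subset.∈ M → ∃ λ j → ParentIn r t j (inject₁ a)) → LWellFormed (mark M t)
  mark-wf M r leaf _ _ _ _ = tt
  mark-wf {n} M r (node a m l s) simple (a>s , sl , ss) out children =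
    desc s a>s , marks l refl ,
    mark-wf M (inject₁ a) l left sl (λ h e → a∉l (subst (λ b → Has b l) (sym (Finₚ.inject₁-injective e)) h)) childrenL ,
    mark-wf M r s right ss (out ∘ inj₂ ∘ inj₂) childrenR
    where
    open Split (split a l s simple)
    desc : ∀ s → RightDescL a s → RightDescL a (mark M s)
    desc leaf _ = tt
    desc (node _ _ _ _) b<a = b<a
    noR : ∀ {b j} → Has b (node a m l s) → ¬ Has b s → ¬ ParentIn r s j (inject₁ b)
    noR h b∉s p with parent-in s p
    ... | inj₁ e = out h (sym e)
    ... | inj₂ (_ , h' , e) with refl ← Finₚ.inject₁-injective e = b∉s h'
    marks : ∀ l' → l' ≡ l → MarkOK (lookup M a) (mark M l')
    marks l' e with lookup M a in eq
    ... | false = tt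
    marks (node _ _ _ _) e | true = tt
    marks leaf refl | true with children (inj₁ refl) (Vecₚ.lookup⇒[]= a M eq)
    ... | _ , inj₁ (_ , e) = out (inj₁ refl) (sym e)
    ... | _ , inj₂ (inj₂ p) = noR (inj₁ refl) a∉s p
    childrenL : ∀ {b} → Has b l → b Subset.∈ M → ∃ λ j → ParentIn (inject₁ a) l j (inject₁ b)
    childrenL h b∈M with children (inj₂ (inj₁ h)) b∈M
    ... | j , inj₂ (inj₁ p) = j , p
    ... | _ , inj₁ (_ , e) = ⊥-elim (out (inj₂ (inj₁ h)) (sym e))
    ... | _ , inj₂ (inj₂ p) = ⊥-elim (noR (inj₂ (inj₁ h)) (disjoint h) p)
    childrenR : ∀ {b} → Has b s → b Subset.∈ M → ∃ λ j → ParentIn r s j (inject₁ b)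
    childrenR h b∈M with children (inj₂ (inj₂ h)) b∈M
    ... | j , inj₂ (inj₂ p) = j , p
    ... | _ , inj₁ (_ , e) = ⊥-elim (out (inj₂ (inj₂ h)) (sym e))
    ... | _ , inj₂ (inj₁ p) with parent-in l p
    ...   | inj₁ e with refl ← Finₚ.inject₁-injective e = ⊥-elim (a∉s h)
    ...   | inj₂ (_ , h' , e) with refl ← Finₚ.inject₁-injective e = ⊥-elim (disjoint h' h)

  root-outside : ∀ {n} (t : LTree n) → Outside (fromℕ n) t
  root-outside t _ = Finₚ.fromℕ≢inject₁

  agrees-unique : ∀ {n} {M M' : Subset n} t → Agrees M t → Agrees M' t → ∀ {i} → Has i t → lookup M i ≡ lookup M' i
  agrees-unique (node a m l s) (e , _) (e' , _) (inj₁ refl) = trans (sym e) e'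
  agrees-unique (node a m l s) (_ , al , _) (_ , al' , _) (inj₂ (inj₁ h)) = agrees-unique l al al' h
  agrees-unique (node a m l s) (_ , _ , as) (_ , _ , as') (inj₂ (inj₂ h)) = agrees-unique s as as' h

  -- Reading parents and growing a forest are only shown to be injective; finiteness of the set of
  -- parent maps does the rest.
  𝒰≅𝒫 : ∀ n k → 𝒰 n k ≅ 𝒫 n k
  𝒰≅𝒫 n k = inverse-from-injections (𝒰 n k) (𝒫 n k) (rankP ∘ proj₁) rankP-injective
    toP (λ {a} {b} → toP-cong {a} {b}) (λ {a} {b} → toP-injective {a} {b})
    toU (λ {a} {b} → toU-injective {a} {b})
    where
    U = Σ (LTree n) (IsU n k)
    P = Σ (Vec (Fin (suc n)) n × Subset n) (IsP n k)
    r = fromℕ n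

    simpleU : (a : U) → Simple (proj₁ a)
    simpleU (t , _ , uniq , _) i = unique⇒occ≤1 uniq
    hasU : (a : U) → ∀ i → Has i (proj₁ a)
    hasU (t , _ , _ , complete , _) i = ∈⇒has t (complete i)
    wfU : (a : U) → LWellFormed (proj₁ a)
    wfU (_ , _ , _ , _ , wf , _) = wf

    parent : (a : U) → Fin n → Fin (suc n)
    parent a i = proj₁ (has-parent r (proj₁ a) (hasU a i))
    parentVec : U → Vec (Fin (suc n)) n
    parentVec a = tabulate (parent a)
    parent-holds : (a : U) → ∀ i → ParentIn r (proj₁ a) i (lookup (parentVec a) i)
    parent-holds a i = subst (ParentIn r (proj₁ a) i) (sym (Vecₚ.lookup∘tabulate (parent a) i)) (proj₂ (has-parent r (proj₁ a) (hasU a i)))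
    parent≡ : (a : U) → ∀ {i j} → ParentIn r (proj₁ a) i j → lookup (parentVec a) i ≡ j
    parent≡ a p = parent-unique (proj₁ a) (simpleU a) (parent-holds a _) p

    markSet : U → Subset n
    markSet a = select (marked? (proj₁ a))
    agreesU : (a : U) → Agrees (markSet a) (proj₁ a)
    agreesU a = agrees-marked (proj₁ a) (simpleU a) (λ _ → select⁻ (marked? (proj₁ a))) (select⁺ (marked? (proj₁ a)))

    toP : U → P
    toP a@(t , _ , uniq , complete , wf , count) = (parentVec a , markSet a) ,
      acyclic (λ i → reach-in r t (root refl) (parent≡ a) (hasU a i)) ,
      (λ i i∈M → let (j , p) = marked-parent r t wf (select⁻ (marked? t) i∈M) in j , parent≡ a p) ,
      trans (sym (weight-complete (markSet a) uniq complete)) (trans (sym (markCount≡weight t (agreesU a))) count)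

    toP-cong : ∀ {a b : U} → proj₁ a ≡ proj₁ b → proj₁ (toP a) ≡ proj₁ (toP b)
    toP-cong {a} {b} refl = cong₂ _,_ (lookup-ext λ i → parent≡ a (parent-holds b i)) refl

    toP-injective : ∀ {a b : U} → proj₁ (toP a) ≡ proj₁ (toP b) → proj₁ a ≡ proj₁ b
    toP-injective {a} {b} e = parents-determine r (proj₁ a) (proj₁ b) (simpleU a) (simpleU b) (wfU a) (wfU b)
      (root-outside (proj₁ a)) (root-outside (proj₁ b)) (agreesU a)
      (subst (λ M → Agrees M (proj₁ b)) (sym (cong proj₂ e)) (agreesU b))
      (λ {i} p → subst (ParentIn r (proj₁ b) i) (trans (sym (cong (λ q → lookup (proj₁ q) i) e)) (parent≡ a p)) (parent-holds b i))
      (λ {i} p → subst (ParentIn r (proj₁ a) i) (trans (cong (λ q → lookup (proj₁ q) i) e) (parent≡ b p)) (parent-holds a i))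

    forest : (b : P) → Forest (lookup (proj₁ (proj₁ b))) (allFin n)
    forest ((p , M) , ac , _) = grow (proj₂ (encode ac n (allFin n) (Listₚ.length-tabulate id))) (Uniqueₚ.allFin⁺ n)
      (λ {u} _ → legal-all (lookup p u))
    skeleton : P → LTree n
    skeleton b = Forest.tree (forest b)
    treeU : P → LTree n
    treeU b = mark (proj₂ (proj₁ b)) (skeleton b)
    labels≡ : (b : P) → llabels (treeU b) ≡ llabels (skeleton b)
    labels≡ b = llabels-mark (proj₂ (proj₁ b)) (skeleton b)
    occ1 : (b : P) → ∀ i → occ i (llabels (skeleton b)) ≡ 1
    occ1 b i = trans (Forest.occ-tree (forest b) i) (occ≡1 (Uniqueₚ.allFin⁺ n) ∈ₚ.∈-allFin i)
    simpleP : (b : P) → Simple (skeleton b)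
    simpleP b i = ℕₚ.≤-reflexive (occ1 b i)

    toU : P → U
    toU b@((p , M) , ac , marks , size) = treeU b , count , uniq , complete , wf ,
      trans (markCount≡weight (treeU b) (agrees-mark M (skeleton b))) (trans (weight-complete M uniq complete) size)
      where
      uniq : Unique (llabels (treeU b))
      uniq = subst Unique (sym (labels≡ b)) (occ≤1⇒unique (llabels (skeleton b)) (simpleP b))
      complete : ∀ i → i ∈ llabels (treeU b)
      complete i = subst (i ∈_) (sym (labels≡ b)) (1≤occ⇒∈ _ (ℕₚ.≤-reflexive (sym (occ1 b i))))
      count : nodeCount (treeU b) ≡ n
      count = trans (nodeCount≡length (treeU b)) (trans (↭-length (complete⇒↭ uniq complete)) (Listₚ.length-tabulate id))
      wf : LWellFormed (treeU b)
      wf = mark-wf M r (skeleton b) (simpleP b) (Forest.sorted (forest b)) (root-outside (skeleton b))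
        λ {a} _ a∈M → let (j , e) = marks a a∈M in
          j , subst (ParentIn r (skeleton b) j) e (Forest.parents (forest b) (∈ₚ.∈-allFin j))

    parentsU : (b : P) → ∀ i → ParentIn r (treeU b) i (lookup (proj₁ (proj₁ b)) i)
    parentsU b i = parent-mark (proj₂ (proj₁ b)) (skeleton b) (Forest.parents (forest b) (∈ₚ.∈-allFin i))

    toU-injective : ∀ {b b' : P} → proj₁ (toU b) ≡ proj₁ (toU b') → proj₁ b ≡ proj₁ b'
    toU-injective {b} {b'} e = cong₂ _,_
      (lookup-ext λ i → parent-unique (treeU b) (simpleU (toU b)) (parentsU b i)
        (subst (λ t → ParentIn r t i (lookup (proj₁ (proj₁ b')) i)) (sym e) (parentsU b' i)))
      (lookup-ext λ i → agrees-unique (treeU b) (agrees-mark (proj₂ (proj₁ b)) (skeleton b))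
        (subst (Agrees (proj₂ (proj₁ b'))) (sym e) (agrees-mark (proj₂ (proj₁ b')) (skeleton b'))) (hasU (toU b) i))

-- Cayley trees and parent maps.

module CayleyTrees where
  open Bijections
  open ParentMaps
  open import Data.Nat using (_≤_; _<_)
  open import Data.Nat.Induction using (<-wellFounded)
  open import Induction.WellFounded using (Acc; acc)
  import Data.Bool.Properties as Boolₚ
  open import Data.Fin.Relation.Unary.Top using (view; ‵fromℕ; ‵inj₁)
  import Data.Fin.Subset.Properties as Subsetₚ
  import Data.Vec.Properties as Vecₚ
  open import Data.List.Membership.Propositional using (_∈_)
  import Data.List.Membership.DecPropositional as DecMem

  does-true : {A : Set} (a? : Dec A) → does a? ≡ true → A
  does-true (yes a) _ = a

  module _ {n} (p : Fin n → Fin (suc n)) where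
    Up : Fin (suc n) → Fin (suc n) → Set
    Up i j = ∃ λ u → i ≡ inject₁ u × p u ≡ j

    Edge : Fin (suc n) → Fin (suc n) → Set
    Edge i j = Up i j ⊎ Up j i

    up? : ∀ i j → Dec (Up i j)
    up? i j = Finₚ.any? λ u → (i Finₚ.≟ inject₁ u) ×-dec (p u Finₚ.≟ j)

    edge? : ∀ i j → Dec (Edge i j)
    edge? i j = up? i j ⊎-dec up? j i

    graph : Graph (suc n)
    graph = tabulate λ i → tabulate λ j → does (edge? i j)

    lookup-graph : ∀ i j → lookup (lookup graph i) j ≡ does (edge? i j)
    lookup-graph i j = trans
      (cong (λ r → lookup r j) (Vecₚ.lookup∘tabulate (λ i → tabulate λ j → does (edge? i j)) i))
      (Vecₚ.lookup∘tabulate (λ j → does (edge? i j)) j)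

    adj⁺ : ∀ {i j} → Edge i j → Adj graph i j
    adj⁺ {i} {j} e = trans (lookup-graph i j) (dec-true (edge? i j) e)

    adj⁻ : ∀ {i j} → Adj graph i j → Edge i j
    adj⁻ {i} {j} a = does-true (edge? i j) (trans (sym (lookup-graph i j)) a)

    up-unique : ∀ {i j j'} → Up i j → Up i j' → j ≡ j'
    up-unique (u , refl , e) (u' , e' , e″) with refl ← Finₚ.inject₁-injective e' = trans (sym e) e″

  walk-trans : ∀ {m} {G : Graph m} {i j k} → Walk G i j → Walk G j k → Walk G i k
  walk-trans here w = w
  walk-trans (there a w) w' = there a (walk-trans w w')

  walk-sym : ∀ {m} {G : Graph m} → (∀ i j → Adj G i j → Adj G j i) → ∀ {i j} → Walk G i j → Walk G j i
  walk-sym sy here = here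
  walk-sym sy (there a w) = walk-trans (walk-sym sy w) (there (sy _ _ a) here)

  module _ {n} {p : Fin n → Fin (suc n)} (ac : Acyclic p) where
    private
      G = graph p
      d : Fin (suc n) → ℕ
      d v = depth (ac v)

    up-shallower : ∀ {i j} → Up p i j → d j < d i
    up-shallower (u , refl , refl) = parent-shallower ac u

    graph-sym : ∀ i j → Adj G i j → Adj G j i
    graph-sym i j a = adj⁺ p ([ inj₂ , inj₁ ]′ (adj⁻ p {i} {j} a))

    walk-to-root : ∀ {v} → Reach p v → Walk G v (fromℕ n)
    walk-to-root (root refl) = here
    walk-to-root (step u refl r) = there (adj⁺ p (inj₁ (u , refl , refl))) (walk-to-root r)

    graph-connected : ∀ i j → Walk G i j
    graph-connected i j = walk-trans (walk-to-root (ac i)) (walk-sym graph-sym (walk-to-root (ac j)))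

    -- A chain without repetition that steps away from the root once can never turn back.
    chain-down : ∀ v w ws → Chain G v (w ∷ ws) → Unique (v ∷ w ∷ ws) → Up p w v →
      d v < d (last w ws) × (ws ≡ [] ⊎ ∃ λ u → u ∈ w ∷ ws × Up p (last w ws) u)
    chain-down v w [] _ _ up = up-shallower up , inj₁ refl
    chain-down v w (y ∷ ys) (_ , a , ch) (v∉ ∷ uniq) up with adj⁻ p a
    ... | inj₁ up' = ⊥-elim (All.lookup v∉ (there (here refl)) (up-unique p up up'))
    ... | inj₂ up' with chain-down w y ys (a , ch) uniq up'
    ...   | lt , inj₁ refl = ℕₚ.<-trans (up-shallower up) lt , inj₂ (w , here refl , up')
    ...   | lt , inj₂ (u , u∈ , up″) = ℕₚ.<-trans (up-shallower up) lt , inj₂ (u , there u∈ , up″)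

    -- The chain either climbs to its end or turns downwards at some vertex; after a turn, the last
    -- vertex has its parent on the chain.
    chain-up : ∀ v w ws → Chain G v (w ∷ ws) → Unique (v ∷ w ∷ ws) → Up p v w →
      d (last w ws) < d v ⊎ ∃ λ u → u ∈ w ∷ ws × Up p (last w ws) u
    chain-up v w [] _ _ up = inj₁ (up-shallower up)
    chain-up v w (y ∷ ys) (_ , a , ch) (_ ∷ uniq) up with adj⁻ p a
    ... | inj₁ up' with chain-up w y ys (a , ch) uniq up'
    ...   | inj₁ lt = inj₁ (ℕₚ.<-trans lt (up-shallower up))
    ...   | inj₂ (u , u∈ , up″) = inj₂ (u , there u∈ , up″)
    chain-up v w (y ∷ ys) (_ , a , ch) (_ ∷ uniq) up | inj₂ up' with chain-down w y ys (a , ch) uniq up'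
    ... | _ , inj₁ refl = inj₂ (w , here refl , up')
    ... | _ , inj₂ (u , u∈ , up″) = inj₂ (u , there u∈ , up″)

    last-∈ : ∀ {A : Set} (a : A) as → last a as ∈ a ∷ as
    last-∈ a [] = here refl
    last-∈ a (b ∷ as) = there (last-∈ b as)

    -- Compare the first edge with the closing one. Either the depths of `v` and of the last vertex
    -- contradict each other, or one vertex gets two distinct parents.
    graph-acyclic : ¬ Cycle G
    graph-acyclic (_ , _ ∷ [] , s≤s () , _)
    graph-acyclic (v , w ∷ y ∷ ys , _ , uniq@(v∉ ∷ w∉ ∷ _) , ch@(a , _) , closing) with adj⁻ p a | adj⁻ p closing
    ... | inj₁ up | inj₁ up' with chain-up v w (y ∷ ys) ch uniq up
    ...   | inj₁ lt = ℕₚ.<-asym lt (up-shallower up')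
    ...   | inj₂ (u , u∈ , up″) = All.lookup v∉ u∈ (up-unique p up' up″)
    graph-acyclic (v , w ∷ y ∷ ys , _ , uniq@(v∉ ∷ w∉ ∷ _) , ch@(a , _) , closing) | inj₁ up | inj₂ up' =
      All.lookup w∉ (last-∈ y ys) (up-unique p up up')
    graph-acyclic (v , w ∷ y ∷ ys , _ , uniq@(v∉ ∷ w∉ ∷ _) , ch@(a , _) , closing) | inj₂ up | c
      with chain-down v w (y ∷ ys) ch uniq up | c
    ... | lt , _ | inj₂ up' = ℕₚ.<-asym lt (up-shallower up')
    ... | _ , inj₂ (u , u∈ , up″) | inj₁ up' = All.lookup v∉ u∈ (up-unique p up' up″)

    graph-isTree : IsTree G
    graph-isTree = graph-sym , (λ i a → [ irr , irr ]′ (adj⁻ p {i} {i} a)) , graph-connected , graph-acyclic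
      where
      irr : ∀ {i} → ¬ Up p i i
      irr up = ℕₚ.<-irrefl refl (up-shallower up)

  -- Induction from the root outwards. If the edge between `u` and `p u` were directed the other way
  -- by `p'`, then `p` and `p'` agreeing at `p u` would make `u` the parent of its own parent.
  graph-injective : ∀ {n} {p p' : Fin n → Fin (suc n)} → Acyclic p → graph p ≡ graph p' → ∀ u → p u ≡ p' u
  graph-injective {n} {p} {p'} ac e u = go (ac (inject₁ u)) u refl
    where
    go : ∀ {v} → Reach p v → ∀ u → v ≡ inject₁ u → p u ≡ p' u
    go (root e') u refl = ⊥-elim (Finₚ.fromℕ≢inject₁ (sym e'))
    go (step u' e' r) u refl with refl ← Finₚ.inject₁-injective e'
      with adj⁻ p' (subst (λ g → Adj g (inject₁ u) (p u)) e (adj⁺ p (inj₁ (u , refl , refl))))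
    ... | inj₁ (u″ , e″ , q) = trans (sym q) (cong p' (sym (Finₚ.inject₁-injective e″)))
    ... | inj₂ (w , pu≡w , p'w≡u) = ⊥-elim (ℕₚ.<-asym (up-shallower ac (u , refl , pu≡w))
          (up-shallower ac (w , refl , trans (go r w pu≡w) p'w≡u)))

  suffix : ∀ {m} {G : Graph m} {i} v vs → i ∈ v ∷ vs → Chain G v vs → Unique (v ∷ vs) →
    ∃ λ us → Chain G i us × Unique (i ∷ us) × last i us ≡ last v vs
  suffix v vs (here refl) ch uniq = vs , ch , uniq , refl
  suffix v (w ∷ vs) (there i∈) (_ , ch) (_ ∷ uniq) = suffix w vs i∈ ch uniq

  simple-path : ∀ {m} {G : Graph m} {i j} → Walk G i j → ∃ λ vs → Chain G i vs × Unique (i ∷ vs) × last i vs ≡ j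
  simple-path here = [] , tt , ([] ∷ []) , refl
  simple-path {m} {i = i} (there {j = k} a w) with simple-path w
  ... | vs , ch , uniq , e with DecMem._∈?_ (Finₚ._≟_ {m}) i (k ∷ vs)
  ...   | yes i∈ with suffix k vs i∈ ch uniq
  ...     | us , ch' , uniq' , e' = us , ch' , uniq' , trans e' e
  simple-path {i = i} (there {j = k} a w) | vs , ch , uniq , e | no i∉ =
    k ∷ vs , (a , ch) , (Allₚ.¬Any⇒All¬ (k ∷ vs) i∉ ∷ uniq) , e

  chain-mono : ∀ {m} {G H : Graph m} → (∀ {i j} → Adj G i j → Adj H i j) → ∀ {v} vs → Chain G v vs → Chain H v vs
  chain-mono sub [] _ = tt
  chain-mono sub (w ∷ vs) (a , ch) = sub a , chain-mono sub vs ch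

  least : {P : ℕ → Set} → (∀ m → Dec (P m)) → ∀ m → P m → ∃ λ k → P k × (∀ {e} → P e → k ≤ e)
  least {P} P? m pm with P? zero
  ... | yes p0 = zero , p0 , λ _ → z≤n
  least {P} P? zero pm | no ¬p0 = ⊥-elim (¬p0 pm)
  least {P} P? (suc m) pm | no ¬p0 with least (P? ∘ suc) m pm
  ... | k , pk , min = suc k , pk , λ { {zero} p0 → ⊥-elim (¬p0 p0) ; {suc e} pe → s≤s (min pe) }

  matrix-ext : ∀ {m} {G H : Graph m} → (∀ {i j} → Adj G i j → Adj H i j) → (∀ {i j} → Adj H i j → Adj G i j) → G ≡ H
  matrix-ext {G = G} {H} to from = lookup-ext λ i → lookup-ext λ j → same (lookup (lookup G i) j) (lookup (lookup H i) j) to from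
    where
    same : ∀ a b → (a ≡ true → b ≡ true) → (b ≡ true → a ≡ true) → a ≡ b
    same true true _ _ = refl
    same false false _ _ = refl
    same true false to _ = sym (to refl)
    same false true _ from = from refl

  -- The parent of a vertex is a neighbour closer to the root; a further edge of G would
  -- close a cycle with the path between its ends in the graph of the parent map.
  module Rooted {n} (G : Graph (suc n)) (tree : IsTree G) where
    private
      sy = proj₁ tree
      irr = proj₁ (proj₂ tree)
      walk = proj₁ (proj₂ (proj₂ tree))
      acy = proj₂ (proj₂ (proj₂ tree))

    -- Walks to the root of a prescribed length: decidable, so that a least length can be searched
    -- for.
    Near : Fin (suc n) → ℕ → Set
    Near v zero = v ≡ fromℕ n
    Near v (suc m) = ∃ λ w → Adj G v w × Near w m

    near? : ∀ v m → Dec (Near v m)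
    near? v zero = v Finₚ.≟ fromℕ n
    near? v (suc m) = Finₚ.any? λ w → (lookup (lookup G v) w Boolₚ.≟ true) ×-dec near? w m

    walk⇒near : ∀ {v} → Walk G v (fromℕ n) → ∃ (Near v)
    walk⇒near w = go w refl
      where
      go : ∀ {v r} → Walk G v r → r ≡ fromℕ n → ∃ (Near v)
      go here e = zero , e
      go (there a w) e with go w e
      ... | m , near = suc m , _ , a , near

    distance : ∀ v → ∃ λ k → Near v k × (∀ {e} → Near v e → k ≤ e)
    distance v with walk⇒near (walk v (fromℕ n))
    ... | m , near = least (near? v) m near

    dist : Fin (suc n) → ℕ
    dist v = proj₁ (distance v)

    closer : ∀ u → ∃ λ w → Adj G (inject₁ u) w × dist w < dist (inject₁ u)
    closer u with distance (inject₁ u)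
    ... | zero , e , _ = ⊥-elim (Finₚ.fromℕ≢inject₁ (sym e))
    -- The second vertex of a shortest walk has a walk of length `m` to the root.
    ... | suc m , (w , a , near) , _ = w , a , s≤s (proj₂ (proj₂ (distance w)) near)

    parents : Vec (Fin (suc n)) n
    parents = tabulate λ u → proj₁ (closer u)

    p : Fin n → Fin (suc n)
    p = lookup parents

    p-adj : ∀ u → Adj G (inject₁ u) (p u)
    p-adj u = subst (Adj G (inject₁ u)) (sym (Vecₚ.lookup∘tabulate _ u)) (proj₁ (proj₂ (closer u)))

    p-closer : ∀ u → dist (p u) < dist (inject₁ u)
    p-closer u = subst (λ w → dist w < dist (inject₁ u)) (sym (Vecₚ.lookup∘tabulate _ u)) (proj₂ (proj₂ (closer u)))

    p-acyclic : Acyclic p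
    p-acyclic v = go v (<-wellFounded (dist v))
      where
      go : ∀ v → Acc _<_ (dist v) → Reach p v
      go v (acc rec) with view v
      ... | ‵fromℕ = root refl
      ... | ‵inj₁ {i = u} _ = step u refl (go (p u) (rec (p-closer u)))

    graph⊆ : ∀ {i j} → Adj (graph p) i j → Adj G i j
    graph⊆ {i} {j} a with adj⁻ p {i} {j} a
    ... | inj₁ (u , refl , refl) = p-adj u
    ... | inj₂ (u , refl , refl) = sy _ _ (p-adj u)

    graph⊇ : ∀ {i j} → Adj G i j → Adj (graph p) i j
    graph⊇ {i} {j} a with edge? p i j
    ... | yes e = adj⁺ p e
    ... | no ¬e with simple-path (graph-connected p-acyclic i j)
    ...   | [] , _ , _ , refl = ⊥-elim (irr i a)
    ...   | w ∷ [] , (a' , _) , _ , refl = ⊥-elim (¬e (adj⁻ p a'))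
    ...   | vs@(_ ∷ _ ∷ _) , ch , uniq , refl =
      ⊥-elim (acy (i , vs , s≤s (s≤s z≤n) , uniq , chain-mono {G = graph p} {G} graph⊆ vs ch , sy _ _ a))

    graph-parents : graph p ≡ G
    graph-parents = matrix-ext {G = graph p} {G} graph⊆ graph⊇

  two-elements : ∀ {m} {S : Subset m} {a b} → a Subset.∈ S → b Subset.∈ S → a ≢ b → 2 ≤ ∣ S ∣
  two-elements a∈ b∈ a≢b = ℕₚ.≤-trans (s≤s (ℕₚ.≤-trans (s≤s z≤n) (Subsetₚ.x∈p⇒∣p-x∣<∣p∣ (Subsetₚ.x∈p∧x≢y⇒x∈p-y a∈ a≢b))))
    (Subsetₚ.x∈p⇒∣p-x∣<∣p∣ b∈)

  other-element : ∀ {m} {S : Subset m} → 2 ≤ ∣ S ∣ → ∀ a → ∃ λ b → b Subset.∈ S × b ≢ a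
  other-element {S = S} h a with Finₚ.any? (λ b → (b Subsetₚ.∈? S) ×-dec ¬? (b Finₚ.≟ a))
  ... | yes (b , b∈ , b≢a) = b , b∈ , b≢a
  ... | no none = ⊥-elim (ℕₚ.<-irrefl refl (ℕₚ.<-≤-trans h
        (ℕₚ.≤-trans (Subsetₚ.p⊆q⇒∣p∣≤∣q∣ sub) (ℕₚ.≤-reflexive (Subsetₚ.∣⁅x⁆∣≡1 a)))))
    where
    sub : S Subset.⊆ ⁅ a ⁆
    sub {b} b∈ with b Finₚ.≟ a
    ... | yes refl = Subsetₚ.x∈⁅x⁆ a
    ... | no b≢a = ⊥-elim (none (b , b∈ , b≢a))

  module _ {n} {p : Fin n → Fin (suc n)} (ac : Acyclic p) where
    -- The parent and the child are two neighbours, distinct because one is shallower and the other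
    -- deeper than `i`.
    child⇒internal : ∀ i → (∃ λ j → p j ≡ inject₁ i) → 2 ≤ degree (graph p) (inject₁ i)
    child⇒internal i (j , e) = two-elements {S = lookup (graph p) (inject₁ i)}
      (Vecₚ.lookup⇒[]= (p i) _ (adj⁺ p (inj₁ (i , refl , refl))))
      (Vecₚ.lookup⇒[]= (inject₁ j) _ (adj⁺ p (inj₂ (j , refl , e))))
      λ pi≡j → ℕₚ.<-asym (up-shallower ac (i , refl , pi≡j)) (up-shallower ac (j , refl , e))

    internal⇒child : ∀ i → 2 ≤ degree (graph p) (inject₁ i) → ∃ λ j → p j ≡ inject₁ i
    internal⇒child i h with other-element {S = lookup (graph p) (inject₁ i)} h (p i)
    ... | b , b∈ , b≢pi with adj⁻ p {inject₁ i} {b} (Vecₚ.[]=⇒lookup b∈)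
    ...   | inj₁ up = ⊥-elim (b≢pi (up-unique p up (i , refl , refl)))
    ...   | inj₂ (j , _ , e) = j , e

  𝒱≅𝒫 : ∀ n k → 𝒱 n k ≅ 𝒫 n k
  𝒱≅𝒫 n k = inverse-from-section (𝒱 n k) (𝒫 n k) to (λ {a} {b} → to-cong {a} {b}) (λ {a} {b} → to-injective {a} {b}) section
    where
    V = Σ (Graph (suc n) × Subset n) (IsV n k)
    P = Σ (Vec (Fin (suc n)) n × Subset n) (IsP n k)
    graphV : V → Graph (suc n)
    graphV a = proj₁ (proj₁ a)
    module R (a : V) = Rooted (graphV a) (proj₁ (proj₂ a))

    to : V → P
    to a@((G , M) , tree , marks , size) = (R.parents a , M) , R.p-acyclic a ,
      (λ i i∈M → internal⇒child (R.p-acyclic a) i (subst (λ g → 2 ≤ degree g (inject₁ i)) (sym (R.graph-parents a)) (marks i i∈M))) , size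

    same-parents : ∀ (a : V) (q : Vec (Fin (suc n)) n) → graph (lookup q) ≡ graphV a → R.parents a ≡ q
    same-parents a q e = lookup-ext (graph-injective (R.p-acyclic a) (trans (R.graph-parents a) (sym e)))

    to-cong : ∀ {a b : V} → proj₁ a ≡ proj₁ b → proj₁ (to a) ≡ proj₁ (to b)
    to-cong {a} {b} e = cong₂ _,_ (same-parents a (R.parents b) (trans (R.graph-parents b) (sym (cong proj₁ e)))) (cong proj₂ e)

    to-injective : ∀ {a b : V} → proj₁ (to a) ≡ proj₁ (to b) → proj₁ a ≡ proj₁ b
    to-injective {a} {b} e = cong₂ _,_
      (trans (sym (R.graph-parents a)) (trans (cong (λ q → graph (lookup (proj₁ q))) e) (R.graph-parents b))) (cong proj₂ e)

    section : ∀ (b : P) → ∃ λ a → proj₁ (to a) ≡ proj₁ b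
    section ((q , M) , ac , marks , size) = a , cong (_, M) (same-parents a q refl)
      where
      a : V
      a = (graph (lookup q) , M) , graph-isTree ac , (λ i i∈M → child⇒internal ac i (marks i i∈M)) , size

-- Composition through parent maps.

open import Data.Nat using (_≤_)
import Function.Construct.Composition as Composition
import Function.Construct.Symmetry as Symmetry

theorem5p1 : (n k : ℕ) → 1 ≤ k → k ≤ n →
    (𝒯 n k ≅ 𝒰 n k) × (𝒰 n k ≅ 𝒱 n k) × (𝒱 n k ≅ 𝒲 n k)
    × (ShiFaces n k ≅ 𝒯 n k)
theorem5p1 (suc n) k _ k≤n =
  Symmetry.inverse (TreeTransfer.𝒰≅𝒯 (suc n) k k≤n) ,
  Composition.inverse (Forests.𝒰≅𝒫 (suc n) k) (Symmetry.inverse (CayleyTrees.𝒱≅𝒫 (suc n) k)) ,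
  Composition.inverse (CayleyTrees.𝒱≅𝒫 (suc n) k) (ParentMaps.𝒫≅𝒲 n k) ,
  Faces.ShiFaces≅𝒯 (suc n) k
theorem5p1 0 (suc k) _ ()
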